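{- Let $\alpha:\mathscr{F}\to\mathscr{F}'$ be a strict homomorphism of frames, $\mathscr{F}=(S,I,R,\sigma,\sigma_1)$, $\mathscr{F}'=(S',I',R',\sigma',\sigma_1')$, which induces an isomorphism $R\cong R'$ and a surjection $S\to S'$ with kernel $\mathfrak{a}$ (so $\mathfrak{a}\subseteq I$). Assume there is a finite filtration $\mathfrak{a}=\mathfrak{a}_0\supseteq\mathfrak{a}_1\supseteq\cdots\supseteq\mathfrak{a}_n=0$ by ideals with $\sigma(\mathfrak{a}_i)\subseteq\mathfrak{a}_{i+1}$ and $\sigma_1(\mathfrak{a}_i)\subseteq\mathfrak{a}_i$, such that $\sigma_1$ is elementwise nilpotent on $\mathfrak{a}_i/\mathfrak{a}_{i+1}$ for each $i$ (for every $x\in\mathfrak{a}_i$ there is $m$ with $\sigma_1^m(x)\in\mathfrak{a}_{i+1}$). Assume moreover that every finitely generated projective $S'$-module lifts to a projective $S$-module. Then $\alpha$ is crystalline.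
   Context: Let $p$ be a prime. A frame is a quintuple $\mathscr{F}=(S,I,R,\sigma,\sigma_1)$ with $S$ a ring, $I$ an ideal, $R=S/I$, $\sigma:S\to S$ a ring endomorphism, $\sigma_1:I\to S$ a $\sigma$-linear map (additive with $\sigma_1(sa)=\sigma(s)\sigma_1(a)$), such that $I+pS$ lies in the Jacobson radical of $S$, $\sigma(a)\equiv a^p \bmod pS$ for $a\in S$, and $\sigma_1(I)$ generates $S$ as an $S$-module. A window over $\mathscr{F}$ is $(P,Q,F,F_1)$ with $P$ a finitely generated projective $S$-module, $Q\subseteq P$ a submodule, $F:P\to P$ and $F_1:Q\to P$ $\sigma$-linear, such that $P=L\oplus T$ with $Q=L\oplus IT$ for some submodules $L,T$, $F_1(ax)=\sigma_1(a)F(x)$ for $a\in I$, $x\in P$, and $F_1(Q)$ generates $P$. A homomorphism of windows is an $S$-linear $g:P\to P'$ with $g(Q)\subseteq Q'$, $F'g=gF$, $F_1'g=gF_1$. A strict homomorphism of frames $\alpha:\mathscr{F}\to\mathscr{F}'$ is a ring homomorphism $S\to S'$ with $\alpha(I)\subseteq I'$, $\sigma'\alpha=\alpha\sigma$, $\sigma_1'\alpha=\alpha\sigma_1$ on $I$. An $\alpha$-homomorphism of windows $\mathscr{P}\to\mathscr{P}'$ is an $S$-linear $g:P\to P'$ with $g(Q)\subseteq Q'$, $F'g=gF$, $F_1'g=gF_1$. The base change $\alpha_*\mathscr{P}$ is the $\mathscr{F}'$-window (unique up to unique isomorphism, underlying module $S'\otimes_SP$) with an $\alpha$-homomorphism $\mathscr{P}\to\alpha_*\mathscr{P}$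 inducing bijections $\Hom_{\mathscr{F}'}(\alpha_*\mathscr{P},\mathscr{P}')\cong\Hom_\alpha(\mathscr{P},\mathscr{P}')$ for all $\mathscr{F}'$-windows $\mathscr{P}'$. The homomorphism $\alpha$ is called crystalline if the functor $\alpha_*$ from windows over $\mathscr{F}$ to windows over $\mathscr{F}'$ is an equivalence of categories. -}

module Defs where

open import Level using (Level; _⊔_) renaming (suc to lsuc)
open import Algebra.Bundles using (CommutativeRing)
open import Algebra.Module.Bundles using (Module)
open import Data.Nat using (ℕ; zero; suc)
open import Data.Fin using (Fin) renaming (zero to fzero; suc to fsuc)
open import Data.Product using (Σ; ∃; _×_; _,_)
open import Relation.Unary using (Pred)

_⇔ₚ_ : ∀ {a b} → Set a → Set b → Set (a ⊔ b)
A ⇔ₚ B = (A → B) × (B → A)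

module RingNotions {c ℓ} (S : CommutativeRing c ℓ) where
  open CommutativeRing S hiding (zero)

  natR : ℕ → Carrier
  natR zero = 0#
  natR (suc n) = 1# + natR n

  pow : Carrier → ℕ → Carrier
  pow x zero = 1#
  pow x (suc n) = x * pow x n

  sumR : ∀ {n} → (Fin n → Carrier) → Carrier
  sumR {zero} f = 0#
  sumR {suc n} f = f fzero + sumR (λ k → f (fsuc k))

  record IsIdeal (I : Pred Carrier (c ⊔ ℓ)) : Set (c ⊔ ℓ) where
    field
      resp  : ∀ {x y} → x ≈ y → I x → I y
      0∈    : I 0#
      +∈    : ∀ {x y} → I x → I y → I (x + y)
      *∈    : ∀ s {x} → I x → I (s * x)

  IsUnit : Carrier → Set (c ⊔ ℓ)
  IsUnit x = ∃ λ y → x * y ≈ 1#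

  Jacobson : Pred Carrier (c ⊔ ℓ)
  Jacobson x = ∀ y → IsUnit (1# - x * y)

open RingNotions public

module _ {c ℓ c' ℓ'} (S : CommutativeRing c ℓ) (S' : CommutativeRing c' ℓ') where
  private
    module A = CommutativeRing S
    module B = CommutativeRing S'

  record IsRingHom (f : A.Carrier → B.Carrier) : Set (c ⊔ ℓ ⊔ ℓ') where
    field
      cong  : ∀ {x y} → x A.≈ y → f x B.≈ f y
      +-hom : ∀ x y → f (x A.+ y) B.≈ f x B.+ f y
      *-hom : ∀ x y → f (x A.* y) B.≈ f x B.* f y
      1-hom : f A.1# B.≈ B.1#

module _ {c ℓ} (p : ℕ) (S : CommutativeRing c ℓ) where
  open CommutativeRing S hiding (zero)

  record Frame : Set (lsuc (c ⊔ ℓ)) where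
    field
      I       : Pred Carrier (c ⊔ ℓ)
      I-ideal : IsIdeal S I
      σ       : Carrier → Carrier
      σ-hom   : IsRingHom S S σ
      σ₁      : (a : Carrier) → I a → Carrier
      σ₁-cong : ∀ {a b} (ha : I a) (hb : I b) → a ≈ b → σ₁ a ha ≈ σ₁ b hb
      σ₁-+    : ∀ {a b} (ha : I a) (hb : I b) (hab : I (a + b)) →
                σ₁ (a + b) hab ≈ σ₁ a ha + σ₁ b hb
      σ₁-*    : ∀ s {a} (ha : I a) (hsa : I (s * a)) →
                σ₁ (s * a) hsa ≈ σ s * σ₁ a ha
      radical : ∀ {a} → I a → ∀ s → Jacobson S (a + natR S p * s)
      frob    : ∀ a → ∃ λ b → σ a ≈ pow S a p + natR S p * b
      σ₁-gen  : ∃ λ n → Σ (Fin n → Carrier) λ s → Σ (Fin n → Carrier) λ a →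
                Σ ((k : Fin n) → I (a k)) λ h →
                sumR S (λ k → s k * σ₁ (a k) (h k)) ≈ 1#

  data Iter (Fr : Frame) : ℕ → Carrier → Carrier → Set (c ⊔ ℓ) where
    done : ∀ {x} → Iter Fr zero x x
    step : ∀ {m x y} (h : Frame.I Fr x) → Iter Fr m (Frame.σ₁ Fr x h) y →
           Iter Fr (suc m) x y

module _ {c ℓ} {p : ℕ} {S S' : CommutativeRing c ℓ} (Fr : Frame p S) (Fr' : Frame p S') where
  private
    module A = CommutativeRing S
    module B = CommutativeRing S'
    module F = Frame Fr
    module F' = Frame Fr'

  record StrictHom : Set (c ⊔ ℓ) where
    field
      α       : A.Carrier → B.Carrier
      α-hom   : IsRingHom S S' α
      I-pres  : ∀ {a} → F.I a → F'.I (α a)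
      σ-comm  : ∀ s → F'.σ (α s) B.≈ α (F.σ s)
      σ₁-comm : ∀ {a} (h : F.I a) → F'.σ₁ (α a) (I-pres h) B.≈ α (F.σ₁ a h)

module _ {c ℓ} {S : CommutativeRing c ℓ} where
  open CommutativeRing S hiding (zero)

  sumM : (M : Module S c ℓ) → ∀ {n} → (Fin n → Module.Carrierᴹ M) → Module.Carrierᴹ M
  sumM M {zero} f = Module.0ᴹ M
  sumM M {suc n} f = Module._+ᴹ_ M (f fzero) (sumM M (λ k → f (fsuc k)))

  record IsSubmodule (M : Module S c ℓ) (N : Pred (Module.Carrierᴹ M) (c ⊔ ℓ)) : Set (c ⊔ ℓ) where
    open Module M
    field
      resp : ∀ {x y} → x ≈ᴹ y → N x → N y
      0∈   : N 0ᴹ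
      +∈   : ∀ {x y} → N x → N y → N (x +ᴹ y)
      *∈   : ∀ s {x} → N x → N (s *ₗ x)

  -- P is finitely generated projective: P is a direct summand (retract) of a
  -- finite free module S^n, i.e. there are an S-linear ι : P → S^n and
  -- π : S^n → P (π v = Σ v_k e_k) with π ∘ ι = id.
  record FGProjective (M : Module S c ℓ) : Set (c ⊔ ℓ) where
    open Module M
    field
      n      : ℕ
      e      : Fin n → Carrierᴹ
      ι      : Carrierᴹ → Fin n → Carrier
      ι-cong : ∀ {x y} → x ≈ᴹ y → ∀ k → ι x k ≈ ι y k
      ι-+    : ∀ x y k → ι (x +ᴹ y) k ≈ ι x k + ι y k
      ι-*    : ∀ s x k → ι (s *ₗ x) k ≈ s * ι x k
      retract : ∀ x → sumM M (λ k → ι x k *ₗ e k) ≈ᴹ x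

module _ {c ℓ} {S S' : CommutativeRing c ℓ} where
  private
    module A = CommutativeRing S
    module B = CommutativeRing S'

  record IsSemilinear (M : Module S c ℓ) (N : Module S' c ℓ)
                      (τ : A.Carrier → B.Carrier)
                      (f : Module.Carrierᴹ M → Module.Carrierᴹ N) : Set (c ⊔ ℓ) where
    private
      module M = Module M
      module N = Module N
    field
      cong : ∀ {x y} → x M.≈ᴹ y → f x N.≈ᴹ f y
      +-hom : ∀ x y → f (x M.+ᴹ y) N.≈ᴹ f x N.+ᴹ f y
      *-hom : ∀ s x → f (s M.*ₗ x) N.≈ᴹ τ s N.*ₗ f x

module _ {c ℓ} {S : CommutativeRing c ℓ} where
  open CommutativeRing S hiding (zero)

  IsLinear : (M N : Module S c ℓ) → (Module.Carrierᴹ M → Module.Carrierᴹ N) → Set (c ⊔ ℓ)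
  IsLinear M N f = IsSemilinear M N (λ s → s) f

  Projective : Module S c ℓ → Set (lsuc (c ⊔ ℓ))
  Projective P = ∀ (M N : Module S c ℓ)
    (f : Module.Carrierᴹ M → Module.Carrierᴹ N) → IsLinear M N f →
    (∀ y → ∃ λ x → Module._≈ᴹ_ N (f x) y) →
    (g : Module.Carrierᴹ P → Module.Carrierᴹ N) → IsLinear P N g →
    ∃ λ (h : Module.Carrierᴹ P → Module.Carrierᴹ M) → IsLinear P M h ×
      (∀ x → Module._≈ᴹ_ N (f (h x)) (g x))

module _ {c ℓ} {p : ℕ} {S : CommutativeRing c ℓ} (Fr : Frame p S) where
  open CommutativeRing S hiding (zero)
  open Frame Fr

  record NormalDecomp (P : Module S c ℓ) (Q : Pred (Module.Carrierᴹ P) (c ⊔ ℓ)) : Set (lsuc (c ⊔ ℓ)) where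
    open Module P
    field
      L T    : Pred Carrierᴹ (c ⊔ ℓ)
      L-sub  : IsSubmodule P L
      T-sub  : IsSubmodule P T
      span   : ∀ x → ∃ λ l → ∃ λ t → L l × T t × x ≈ᴹ l +ᴹ t
      indep  : ∀ {l t} → L l → T t → l +ᴹ t ≈ᴹ 0ᴹ → l ≈ᴹ 0ᴹ
      Q-eq   : ∀ x → Q x ⇔ₚ (∃ λ l → ∃ λ u → L l × x ≈ᴹ l +ᴹ u ×
                 (∃ λ n → Σ (Fin n → Carrier) λ a → Σ (Fin n → Carrierᴹ) λ t →
                   (∀ k → I (a k)) × (∀ k → T (t k)) × u ≈ᴹ sumM P (λ k → a k *ₗ t k)))

  record WindowStr (P : Module S c ℓ) : Set (lsuc (c ⊔ ℓ)) where
    open Module P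
    field
      fgp     : FGProjective P
      Q       : Pred Carrierᴹ (c ⊔ ℓ)
      Q-sub   : IsSubmodule P Q
      decomp  : NormalDecomp P Q
      F       : Carrierᴹ → Carrierᴹ
      F-lin   : IsSemilinear P P σ F
      F₁      : (x : Carrierᴹ) → Q x → Carrierᴹ
      F₁-cong : ∀ {x y} (hx : Q x) (hy : Q y) → x ≈ᴹ y → F₁ x hx ≈ᴹ F₁ y hy
      F₁-+    : ∀ {x y} (hx : Q x) (hy : Q y) (hxy : Q (x +ᴹ y)) →
                F₁ (x +ᴹ y) hxy ≈ᴹ F₁ x hx +ᴹ F₁ y hy
      F₁-*    : ∀ s {x} (hx : Q x) (hsx : Q (s *ₗ x)) →
                F₁ (s *ₗ x) hsx ≈ᴹ σ s *ₗ F₁ x hx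
      F₁-σ₁   : ∀ {a} (ha : I a) x (hax : Q (a *ₗ x)) →
                F₁ (a *ₗ x) hax ≈ᴹ σ₁ a ha *ₗ F x
      F₁-gen  : ∀ x → ∃ λ n → Σ (Fin n → Carrier) λ s → Σ (Fin n → Carrierᴹ) λ y →
                Σ (∀ k → Q (y k)) λ hy → x ≈ᴹ sumM P (λ k → s k *ₗ F₁ (y k) (hy k))

  record Window : Set (lsuc (c ⊔ ℓ)) where
    field
      P   : Module S c ℓ
      str : WindowStr P
    open Module P public
    open WindowStr str public

module _ {c ℓ} {p : ℕ} {S S' : CommutativeRing c ℓ} {Fr : Frame p S} {Fr' : Frame p S'} where
  private
    module A = CommutativeRing S

  record SemiHom (τ : A.Carrier → CommutativeRing.Carrier S')
                 (W : Window Fr) (W' : Window Fr') : Set (c ⊔ ℓ) where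
    private
      module W = Window W
      module W' = Window W'
    field
      g       : W.Carrierᴹ → W'.Carrierᴹ
      g-lin   : IsSemilinear W.P W'.P τ g
      Q-pres  : ∀ {x} → W.Q x → W'.Q (g x)
      F-comm  : ∀ x → W'.F (g x) W'.≈ᴹ g (W.F x)
      F₁-comm : ∀ {x} (hx : W.Q x) → W'.F₁ (g x) (Q-pres hx) W'.≈ᴹ g (W.F₁ x hx)

open SemiHom public using (g)

Hom : ∀ {c ℓ} {p : ℕ} {S : CommutativeRing c ℓ} {Fr : Frame p S} →
      Window Fr → Window Fr → Set (c ⊔ ℓ)
Hom W W' = SemiHom (λ s → s) W W'

module _ {c ℓ} {p : ℕ} {S S' : CommutativeRing c ℓ} {Fr : Frame p S} {Fr' : Frame p S'}
         (φ : StrictHom Fr Fr') where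
  open StrictHom φ

  -- u : W → W' is an α-homomorphism exhibiting W' as α_* W, i.e.
  -- h ↦ h ∘ u is a bijection  Hom(W', W'') ≅ Hom_α(W, W'')  for every W''
  -- (maps compared pointwise up to the module equality).
  IsBaseChange : {W : Window Fr} {W' : Window Fr'} → SemiHom α W W' → Set (lsuc (c ⊔ ℓ))
  IsBaseChange {W} {W'} u = ∀ (W'' : Window Fr') →
      (∀ (h₁ h₂ : Hom W' W'') → (∀ x → Window._≈ᴹ_ W'' (g h₁ (g u x)) (g h₂ (g u x))) →
         ∀ y → Window._≈ᴹ_ W'' (g h₁ y) (g h₂ y))
    × (∀ (k : SemiHom α W W'') → ∃ λ (h : Hom W' W'') →
         ∀ x → Window._≈ᴹ_ W'' (g h (g u x)) (g k x))

  -- α is crystalline: the base change functor α_* is an equivalence of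
  -- categories, i.e. it is defined (base changes exist), fully faithful and
  -- essentially surjective.  Full faithfulness on (W₁, W₂) is expressed via the
  -- universal property:  Hom(W₁,W₂) → Hom(α_*W₁, α_*W₂) ≅ Hom_α(W₁, α_*W₂)
  -- is  g ↦ u₂ ∘ g.
  Crystalline : Set (lsuc (c ⊔ ℓ))
  Crystalline =
      (∀ (W : Window Fr) → ∃ λ (W' : Window Fr') → ∃ λ (u : SemiHom α W W') → IsBaseChange u)
    × (∀ (W₁ W₂ : Window Fr) (W₂' : Window Fr') (u : SemiHom α W₂ W₂') → IsBaseChange u →
         (∀ (g₁ g₂ : Hom W₁ W₂) → (∀ x → Window._≈ᴹ_ W₂' (g u (g g₁ x)) (g u (g g₂ x))) →
            ∀ x → Window._≈ᴹ_ W₂ (g g₁ x) (g g₂ x))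
       × (∀ (k : SemiHom α W₁ W₂') → ∃ λ (h : Hom W₁ W₂) →
            ∀ x → Window._≈ᴹ_ W₂' (g u (g h x)) (g k x)))
    × (∀ (W' : Window Fr') → ∃ λ (W : Window Fr) → ∃ λ (u : SemiHom α W W') → IsBaseChange u)

  -- every finitely generated projective S'-module lifts to a projective
  -- S-module: P' ≅ S' ⊗_S P.  Since S → S' is surjective with kernel 𝔞,
  -- S' ⊗_S P ≅ P / 𝔞P, so this says: there is an α-linear surjection
  -- π : P → P' whose kernel is contained in 𝔞P.
  LiftsProjectives : Set (lsuc (c ⊔ ℓ))
  LiftsProjectives = ∀ (P' : Module S' c ℓ) → FGProjective P' →
    ∃ λ (P : Module S c ℓ) → Projective P ×
      (∃ λ (π : Module.Carrierᴹ P → Module.Carrierᴹ P') → IsSemilinear P P' α π ×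
        (∀ y → ∃ λ x → Module._≈ᴹ_ P' (π x) y) ×
        (∀ x → Module._≈ᴹ_ P' (π x) (Module.0ᴹ P') →
           ∃ λ n → Σ (Fin n → CommutativeRing.Carrier S) λ a →
           Σ (Fin n → Module.Carrierᴹ P) λ y →
             (∀ k → CommutativeRing._≈_ S' (α (a k)) (CommutativeRing.0# S')) ×
             Module._≈ᴹ_ P x (sumM P (λ k → Module._*ₗ_ P (a k) (y k)))))

{-# OPTIONS --safe #-}
module Submission where

-- Let Ψ be F₁ on L and F on T.  Its values generate P, and since σ is a Frobenius lift modulo p its
-- linearization S ⊗_σ P → P is even bijective: otherwise the σ-twists of its kernel would be arbitrarily
-- many independent summands of one finite free module.  A linear map h is a homomorphism of windows iff
-- h Ψ = U h, where U h is F₁ h on L and F h on T, so every linear lift h of an α-homomorphism has an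
-- improvement h' with h' Ψ = U h.  Successive differences take values in 𝔞 P; the nilpotence of σ₁ on
-- the graded pieces and σ(𝔞ᵢ) ⊆ 𝔞ᵢ₊₁ push them down the filtration, so the iteration becomes stationary,
-- and the same descent gives uniqueness.
--
-- Base change along α is P ↦ P / 𝔞P.  To lift a window, lift L and T to projective modules and Ψ to a
-- σ-linear map.  The lifts need not be finitely generated by hypothesis.  If u is an endomorphism of a
-- projective X that factors through S^n and is the identity modulo the radical ideal 𝔞, then u is injective
-- modulo every ideal (by comparison with a free module), and a monic polynomial killing u yields that
-- u is surjective; hence X is finitely generated.

open import Defs
open import Level using (_⊔_)
import Level
open import Algebra.Bundles using (CommutativeRing; RingWithoutOne)
open import Algebra.Module.Bundles using (Module)
import Algebra.Module.Construct.DirectProduct as DirectProduct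
import Algebra.Module.Construct.TensorUnit as TensorUnit
open import Algebra.Module.Structures using (IsModule)
import Algebra.Module.Structures.Biased as Biased
import Algebra.Properties.AbelianGroup as AbelianGroupProperties
import Algebra.Properties.RingWithoutOne as RingWithoutOneProperties
import Algebra.Solver.CommutativeMonoid as CommutativeMonoidSolver
import Algebra.Solver.Ring.NaturalCoefficients.Default as SemiringSolver
open import Algebra.Structures using (IsAbelianGroup)
open import Data.Bool using (Bool; if_then_else_)
open import Data.Empty using (⊥-elim)
open import Data.Fin using (Fin; punchIn; punchOut; splitAt; toℕ) renaming (zero to fzero; suc to fsuc)
import Data.Fin as Fin
import Data.Fin.Properties as Fin
open import Data.Nat using (ℕ; zero; suc; _<_)
import Data.Nat as ℕ
open import Data.Nat.Primality using (Prime; prime⇒nonZero)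
import Data.Nat.Properties as ℕ
open import Data.Product using (Σ; ∃; _×_; _,_; proj₁; proj₂)
open import Data.Sum using (_⊎_; inj₁; inj₂; [_,_]′)
import Data.Sum as Sum
import Data.Sum.Properties as Sum
open import Relation.Nullary using (yes; no; Dec; does)
open import Relation.Nullary.Decidable using (¬?; dec-true; dec-false)
open import Relation.Unary using (Pred)
import Relation.Binary.PropositionalEquality as ≡
import Relation.Binary.Reasoning.Setoid as SetoidReasoning
open ≡ using (_≡_; _≢_)

-- Modules and linear combinations

-- Uniqueness of the improvement h' needs only that `Ψ` generates; its existence needs every
-- relation between values of `Ψ` to hold between the values of `U h` as well, which is injectivity
-- of the linearization. Classically this is a comparison of ranks: for a maximal ideal m, which
-- contains p, the congruence σ(a) = a^p modulo p gives σ^(-1)(m) = m, so S ⊗_σ P and P have equal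
-- rank at m, and a surjection between them is bijective. Constructively there are no maximal ideals
-- to localize at; idempotent matrices, an elimination valid modulo any radical ideal and Nakayama's
-- lemma take their place.
--
-- Universe levels are the second obstacle. `Projective` tests only modules with carrier in Set c
-- and equality in Set ℓ. Quotients are therefore old carriers with a coarser equality, images are
-- presented as quotients, and the free module on X needs an equality encoded by finite labels
-- before X can be split off from it.

module _ {c ℓ} (S : CommutativeRing c ℓ) where
  open CommutativeRing S using (Carrier; 0#; 1#)

  kron : ∀ {n} → Fin n → Fin n → Carrier
  kron fzero fzero = 1#
  kron fzero (fsuc j) = 0#
  kron (fsuc i) fzero = 0#
  kron (fsuc i) (fsuc j) = kron i j

module ModuleFacts {c ℓ} {S : CommutativeRing c ℓ} (M : Module S c ℓ) where
  open CommutativeRing S using (Carrier; 0#; 1#; _+_; _*_; -_)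
  private module S = CommutativeRing S
  open Module M
  open AbelianGroupProperties +ᴹ-abelianGroup public
    using (⁻¹-∙-comm; ⁻¹-involutive; ε⁻¹≈ε; inverseˡ-unique; inverseʳ-unique)
  open CommutativeMonoidSolver +ᴹ-commutativeMonoid public
    using (solve; _⊜_; _⊕_)
  open SetoidReasoning ≈ᴹ-setoid

  infixl 6 _-ᴹ_
  _-ᴹ_ : Carrierᴹ → Carrierᴹ → Carrierᴹ
  x -ᴹ y = x +ᴹ -ᴹ y

  +-interchange : ∀ x y z w → (x +ᴹ y) +ᴹ (z +ᴹ w) ≈ᴹ (x +ᴹ z) +ᴹ (y +ᴹ w)
  +-interchange = solve 4 (λ x y z w → (x ⊕ y) ⊕ (z ⊕ w) ⊜ (x ⊕ z) ⊕ (y ⊕ w)) ≈ᴹ-refl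

  -ᴹ-cong₂ : ∀ {x y z w} → x ≈ᴹ y → z ≈ᴹ w → x -ᴹ z ≈ᴹ y -ᴹ w
  -ᴹ-cong₂ p q = +ᴹ-cong p (-ᴹ‿cong q)

  *ₗ-swap : ∀ s t x → s *ₗ (t *ₗ x) ≈ᴹ t *ₗ (s *ₗ x)
  *ₗ-swap s t x = ≈ᴹ-trans (≈ᴹ-sym (*ₗ-assoc s t x)) (≈ᴹ-trans (*ₗ-congʳ (S.*-comm s t)) (*ₗ-assoc t s x))

  -1*x≈-x : ∀ x → (- 1#) *ₗ x ≈ᴹ -ᴹ x
  -1*x≈-x x = inverseˡ-unique _ _ (begin
    (- 1#) *ₗ x +ᴹ x         ≈⟨ +ᴹ-congˡ (≈ᴹ-sym (*ₗ-identityˡ x)) ⟩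
    (- 1#) *ₗ x +ᴹ 1# *ₗ x   ≈⟨ ≈ᴹ-sym (*ₗ-distribʳ x (- 1#) 1#) ⟩
    (- 1# + 1#) *ₗ x         ≈⟨ *ₗ-congʳ (S.-‿inverseˡ 1#) ⟩
    0# *ₗ x                  ≈⟨ *ₗ-zeroˡ x ⟩
    0ᴹ                       ∎)

  *-neg : ∀ s x → s *ₗ (-ᴹ x) ≈ᴹ -ᴹ (s *ₗ x)
  *-neg s x = inverseˡ-unique _ _ (begin
    s *ₗ (-ᴹ x) +ᴹ s *ₗ x  ≈⟨ ≈ᴹ-sym (*ₗ-distribˡ s _ _) ⟩
    s *ₗ (-ᴹ x +ᴹ x)       ≈⟨ *ₗ-congˡ (-ᴹ‿inverseˡ x) ⟩
    s *ₗ 0ᴹ                ≈⟨ *ₗ-zeroʳ s ⟩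
    0ᴹ                     ∎)

  neg-* : ∀ s x → (- s) *ₗ x ≈ᴹ -ᴹ (s *ₗ x)
  neg-* s x = inverseˡ-unique _ _ (begin
    (- s) *ₗ x +ᴹ s *ₗ x  ≈⟨ ≈ᴹ-sym (*ₗ-distribʳ x _ _) ⟩
    (- s + s) *ₗ x        ≈⟨ *ₗ-congʳ (S.-‿inverseˡ s) ⟩
    0# *ₗ x               ≈⟨ *ₗ-zeroˡ x ⟩
    0ᴹ                    ∎)

  sub-self : ∀ x → x -ᴹ x ≈ᴹ 0ᴹ
  sub-self = -ᴹ‿inverseʳ

  ≈⇒sub≈0 : ∀ {x y} → x ≈ᴹ y → x -ᴹ y ≈ᴹ 0ᴹ
  ≈⇒sub≈0 {x} {y} p = ≈ᴹ-trans (+ᴹ-congʳ p) (sub-self y)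

  add-sub : ∀ x y → y +ᴹ (x -ᴹ y) ≈ᴹ x
  add-sub x y = begin
    y +ᴹ (x -ᴹ y)  ≈⟨ solve 3 (λ x y z → y ⊕ (x ⊕ z) ⊜ x ⊕ (y ⊕ z)) ≈ᴹ-refl x y (-ᴹ y) ⟩
    x +ᴹ (y -ᴹ y)  ≈⟨ +ᴹ-congˡ (sub-self y) ⟩
    x +ᴹ 0ᴹ        ≈⟨ +ᴹ-identityʳ x ⟩
    x              ∎

  sub-add : ∀ x y → (x +ᴹ y) -ᴹ y ≈ᴹ x
  sub-add x y = begin
    (x +ᴹ y) -ᴹ y  ≈⟨ +ᴹ-assoc x y _ ⟩
    x +ᴹ (y -ᴹ y)  ≈⟨ +ᴹ-congˡ (sub-self y) ⟩
    x +ᴹ 0ᴹ        ≈⟨ +ᴹ-identityʳ x ⟩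
    x              ∎

  sub≈0⇒≈ : ∀ {x y} → x -ᴹ y ≈ᴹ 0ᴹ → x ≈ᴹ y
  sub≈0⇒≈ {x} {y} p = begin
    x              ≈⟨ ≈ᴹ-sym (add-sub x y) ⟩
    y +ᴹ (x -ᴹ y)  ≈⟨ +ᴹ-congˡ p ⟩
    y +ᴹ 0ᴹ        ≈⟨ +ᴹ-identityʳ y ⟩
    y              ∎

  sub-+ : ∀ x y z w → (x +ᴹ y) -ᴹ (z +ᴹ w) ≈ᴹ (x -ᴹ z) +ᴹ (y -ᴹ w)
  sub-+ x y z w = begin
    (x +ᴹ y) -ᴹ (z +ᴹ w)           ≈⟨ +ᴹ-congˡ (≈ᴹ-sym (⁻¹-∙-comm z w)) ⟩
    (x +ᴹ y) +ᴹ (-ᴹ z +ᴹ -ᴹ w)     ≈⟨ +-interchange x y (-ᴹ z) (-ᴹ w) ⟩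
    (x -ᴹ z) +ᴹ (y -ᴹ w)           ∎

  *-sub : ∀ s x y → s *ₗ (x -ᴹ y) ≈ᴹ s *ₗ x -ᴹ s *ₗ y
  *-sub s x y = ≈ᴹ-trans (*ₗ-distribˡ s x _) (+ᴹ-congˡ (*-neg s y))

  sub-* : ∀ s t x → (s + - t) *ₗ x ≈ᴹ s *ₗ x -ᴹ t *ₗ x
  sub-* s t x = ≈ᴹ-trans (*ₗ-distribʳ x s _) (+ᴹ-congˡ (neg-* t x))

  sub-chain : ∀ x y z → (x -ᴹ y) +ᴹ (y -ᴹ z) ≈ᴹ x -ᴹ z
  sub-chain x y z = begin
    (x -ᴹ y) +ᴹ (y -ᴹ z)  ≈⟨ ≈ᴹ-sym (+ᴹ-assoc _ y _) ⟩
    ((x -ᴹ y) +ᴹ y) -ᴹ z  ≈⟨ +ᴹ-congʳ (≈ᴹ-trans (+ᴹ-comm _ y) (add-sub x y)) ⟩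
    x -ᴹ z                ∎

  sub-0 : ∀ x → x -ᴹ 0ᴹ ≈ᴹ x
  sub-0 x = ≈ᴹ-trans (+ᴹ-congˡ ε⁻¹≈ε) (+ᴹ-identityʳ x)

  +≈0⇒≈- : ∀ {x y} → x +ᴹ y ≈ᴹ 0ᴹ → x ≈ᴹ -ᴹ y
  +≈0⇒≈- = inverseˡ-unique _ _

  cancelʳ : ∀ {x y z} → x +ᴹ z ≈ᴹ y +ᴹ z → x ≈ᴹ y
  cancelʳ {x} {y} {z} p = begin
    x              ≈⟨ ≈ᴹ-sym (sub-add x z) ⟩
    (x +ᴹ z) -ᴹ z  ≈⟨ +ᴹ-congʳ p ⟩
    (y +ᴹ z) -ᴹ z  ≈⟨ sub-add y z ⟩
    y              ∎

  move-sub : ∀ {x y z} → x ≈ᴹ y +ᴹ z → x -ᴹ z ≈ᴹ y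
  move-sub {x} {y} {z} p = ≈ᴹ-trans (+ᴹ-congʳ p) (sub-add y z)

  sum-cong : ∀ {n} {f g : Fin n → Carrierᴹ} → (∀ k → f k ≈ᴹ g k) → sumM M f ≈ᴹ sumM M g
  sum-cong {zero} p = ≈ᴹ-refl
  sum-cong {suc n} p = +ᴹ-cong (p fzero) (sum-cong λ k → p (fsuc k))

  sum-0 : ∀ {n} {f : Fin n → Carrierᴹ} → (∀ k → f k ≈ᴹ 0ᴹ) → sumM M f ≈ᴹ 0ᴹ
  sum-0 {zero} p = ≈ᴹ-refl
  sum-0 {suc n} p = ≈ᴹ-trans (+ᴹ-cong (p fzero) (sum-0 λ k → p (fsuc k))) (+ᴹ-identityˡ 0ᴹ)

  sum-+ : ∀ {n} (f g : Fin n → Carrierᴹ) → sumM M (λ k → f k +ᴹ g k) ≈ᴹ sumM M f +ᴹ sumM M g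
  sum-+ {zero} f g = ≈ᴹ-sym (+ᴹ-identityˡ 0ᴹ)
  sum-+ {suc n} f g = ≈ᴹ-trans (+ᴹ-congˡ (sum-+ (λ k → f (fsuc k)) (λ k → g (fsuc k))))
    (+-interchange (f fzero) (g fzero) (sumM M (λ k → f (fsuc k))) (sumM M (λ k → g (fsuc k))))

  sum-* : ∀ {n} s (f : Fin n → Carrierᴹ) → s *ₗ sumM M f ≈ᴹ sumM M (λ k → s *ₗ f k)
  sum-* {zero} s f = *ₗ-zeroʳ s
  sum-* {suc n} s f = ≈ᴹ-trans (*ₗ-distribˡ s _ _) (+ᴹ-congˡ (sum-* s (λ k → f (fsuc k))))

  lc : ∀ {n} → (Fin n → Carrier) → (Fin n → Carrierᴹ) → Carrierᴹ
  lc s z = sumM M (λ k → s k *ₗ z k)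

  lc-congˡ : ∀ {n} {s t : Fin n → Carrier} (z : Fin n → Carrierᴹ) → (∀ k → s k S.≈ t k) → lc s z ≈ᴹ lc t z
  lc-congˡ {n} z p = sum-cong {n} λ k → *ₗ-congʳ (p k)

  lc-congʳ : ∀ {n} (s : Fin n → Carrier) {z w : Fin n → Carrierᴹ} → (∀ k → z k ≈ᴹ w k) → lc s z ≈ᴹ lc s w
  lc-congʳ {n} s p = sum-cong {n} λ k → *ₗ-congˡ (p k)

  lc-+ : ∀ {n} (s t : Fin n → Carrier) (z : Fin n → Carrierᴹ) → lc (λ k → s k + t k) z ≈ᴹ lc s z +ᴹ lc t z
  lc-+ {n} s t z = ≈ᴹ-trans (sum-cong {n} λ k → *ₗ-distribʳ _ _ _) (sum-+ (λ k → s k *ₗ z k) (λ k → t k *ₗ z k))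

  lc-* : ∀ {n} y (s : Fin n → Carrier) (z : Fin n → Carrierᴹ) → lc (λ k → y * s k) z ≈ᴹ y *ₗ lc s z
  lc-* {n} y s z = ≈ᴹ-trans (sum-cong {n} λ k → *ₗ-assoc _ _ _) (≈ᴹ-sym (sum-* y (λ k → s k *ₗ z k)))

  lc-sub : ∀ {n} (s t : Fin n → Carrier) (z : Fin n → Carrierᴹ) → lc (λ k → s k S.- t k) z ≈ᴹ lc s z -ᴹ lc t z
  lc-sub {n} s t z = ≈ᴹ-sym (move-sub (≈ᴹ-trans (lc-congˡ z λ k → S.sym (S.trans (S.+-assoc _ _ _)
    (S.trans (S.+-congˡ (S.-‿inverseˡ (t k))) (S.+-identityʳ (s k))))) (lc-+ (λ k → s k S.- t k) t z)))

  lc-kron : ∀ {n} i (f : Fin n → Carrierᴹ) → lc (kron S i) f ≈ᴹ f i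
  lc-kron {suc n} fzero f = ≈ᴹ-trans (+ᴹ-cong (*ₗ-identityˡ _) (sum-0 {n} λ k → *ₗ-zeroˡ _)) (+ᴹ-identityʳ _)
  lc-kron (fsuc i) f = ≈ᴹ-trans (+ᴹ-cong (*ₗ-zeroˡ _) (lc-kron i (λ k → f (fsuc k)))) (+ᴹ-identityˡ _)

  sum-punchIn : ∀ {m} (z : Fin (suc m) → Carrierᴹ) k → sumM M z ≈ᴹ z k +ᴹ sumM M (λ l → z (punchIn k l))
  sum-punchIn z fzero = ≈ᴹ-refl
  sum-punchIn {suc m} z (fsuc k) = ≈ᴹ-trans (+ᴹ-congˡ (sum-punchIn (λ l → z (fsuc l)) k))
    (solve 3 (λ a b d → a ⊕ (b ⊕ d) ⊜ b ⊕ (a ⊕ d)) ≈ᴹ-refl _ _ _)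

  sum-swap : ∀ {m n} (f : Fin m → Fin n → Carrierᴹ) →
    sumM M (λ i → sumM M (f i)) ≈ᴹ sumM M (λ j → sumM M (λ i → f i j))
  sum-swap {zero} {n} f = ≈ᴹ-sym (sum-0 {n} λ _ → ≈ᴹ-refl)
  sum-swap {suc m} f = ≈ᴹ-trans (+ᴹ-congˡ (sum-swap (λ i → f (fsuc i))))
    (≈ᴹ-sym (sum-+ (f fzero) (λ j → sumM M (λ i → f (fsuc i) j))))

  module _ {N : Pred Carrierᴹ (c ⊔ ℓ)} (N-sub : IsSubmodule M N) where
    open IsSubmodule N-sub

    neg∈ : ∀ {x} → N x → N (-ᴹ x)
    neg∈ {x} p = resp (-1*x≈-x x) (*∈ (- 1#) p)

    sub∈ : ∀ {x y} → N x → N y → N (x -ᴹ y)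
    sub∈ p q = +∈ p (neg∈ q)

    sum∈ : ∀ {n} {f : Fin n → Carrierᴹ} → (∀ k → N (f k)) → N (sumM M f)
    sum∈ {zero} p = 0∈
    sum∈ {suc n} p = +∈ (p fzero) (sum∈ λ k → p (fsuc k))

-- Lets results that conclude membership in an ideal or submodule, such as `nakayama` and
-- `combo-reflects`, prove that elements vanish. The lift raises the equation to the level demanded
-- of ideals.
zero-ideal : ∀ {c ℓ} (S : CommutativeRing c ℓ) → let open CommutativeRing S in IsIdeal S (λ a → Level.Lift c (a ≈ 0#))
zero-ideal S = record
  { resp = λ q (Level.lift h) → Level.lift (trans (sym q) h)
  ; 0∈ = Level.lift refl
  ; +∈ = λ (Level.lift h) (Level.lift h') → Level.lift (trans (+-cong h h') (+-identityˡ 0#))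
  ; *∈ = λ r (Level.lift h) → Level.lift (trans (*-congˡ h) (zeroʳ r)) }
  where open CommutativeRing S

unit : ∀ {c ℓ} (S : CommutativeRing c ℓ) → Module S c ℓ
unit S = TensorUnit.⟨module⟩ {R = S}

sumR≡sumM : ∀ {c ℓ} (S : CommutativeRing c ℓ) {n} (f : Fin n → CommutativeRing.Carrier S) →
  sumR S f ≡ sumM (unit S) f
sumR≡sumM S {zero} f = ≡.refl
sumR≡sumM S {suc n} f = ≡.cong (CommutativeRing._+_ S (f fzero)) (sumR≡sumM S (λ k → f (fsuc k)))

module _ {c ℓ} {S : CommutativeRing c ℓ} {M : Module S c ℓ} where
  private module M = Module M

  sum-*ʳ : ∀ {n} (s : Fin n → CommutativeRing.Carrier S) x →
    sumM (unit S) s M.*ₗ x M.≈ᴹ sumM M (λ k → s k M.*ₗ x)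
  sum-*ʳ {zero} s x = M.*ₗ-zeroˡ x
  sum-*ʳ {suc n} s x = M.≈ᴹ-trans (M.*ₗ-distribʳ x _ _) (M.+ᴹ-congˡ (sum-*ʳ (λ k → s (fsuc k)) x))

module SemilinearFacts {c ℓ} {S S' : CommutativeRing c ℓ} {M : Module S c ℓ} {N : Module S' c ℓ}
    {τ : CommutativeRing.Carrier S → CommutativeRing.Carrier S'}
    {f : Module.Carrierᴹ M → Module.Carrierᴹ N} (f-lin : IsSemilinear M N τ f) where
  private
    module M = Module M
    module N = Module N
    module MF = ModuleFacts M
    module NF = ModuleFacts N
  open IsSemilinear f-lin

  map-0 : f M.0ᴹ N.≈ᴹ N.0ᴹ
  map-0 = NF.cancelʳ (N.≈ᴹ-trans (N.≈ᴹ-sym (+-hom M.0ᴹ M.0ᴹ))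
    (N.≈ᴹ-trans (cong (M.+ᴹ-identityˡ M.0ᴹ)) (N.≈ᴹ-sym (N.+ᴹ-identityˡ _))))

  map-neg : ∀ x → f (M.-ᴹ x) N.≈ᴹ N.-ᴹ f x
  map-neg x = NF.inverseˡ-unique _ _ (N.≈ᴹ-trans (N.≈ᴹ-sym (+-hom _ _))
    (N.≈ᴹ-trans (cong (M.-ᴹ‿inverseˡ x)) map-0))

  map-sub : ∀ x y → f (x MF.-ᴹ y) N.≈ᴹ f x NF.-ᴹ f y
  map-sub x y = N.≈ᴹ-trans (+-hom x _) (N.+ᴹ-congˡ (map-neg y))

  map-sum : ∀ {n} (g : Fin n → M.Carrierᴹ) → f (sumM M g) N.≈ᴹ sumM N (λ k → f (g k))
  map-sum {zero} g = map-0
  map-sum {suc n} g = N.≈ᴹ-trans (+-hom _ _) (N.+ᴹ-congˡ (map-sum (λ k → g (fsuc k))))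

  map-lin : ∀ {n} (s : Fin n → CommutativeRing.Carrier S) (g : Fin n → M.Carrierᴹ) →
    f (sumM M (λ k → s k M.*ₗ g k)) N.≈ᴹ sumM N (λ k → τ (s k) N.*ₗ f (g k))
  map-lin s g = N.≈ᴹ-trans (map-sum (λ k → s k M.*ₗ g k)) (NF.sum-cong λ k → *-hom (s k) (g k))

id-linear : ∀ {c ℓ} {S : CommutativeRing c ℓ} (M : Module S c ℓ) → IsLinear M M (λ x → x)
id-linear M = record { cong = λ q → q ; +-hom = λ _ _ → ≈ᴹ-refl ; *-hom = λ _ _ → ≈ᴹ-refl }
  where open Module M

∘-semilinear : ∀ {c ℓ} {S S' S'' : CommutativeRing c ℓ} {L : Module S c ℓ} {M : Module S' c ℓ} {N : Module S'' c ℓ}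
  {τ υ f g} → (∀ {x y} → CommutativeRing._≈_ S' x y → CommutativeRing._≈_ S'' (υ x) (υ y)) →
  IsSemilinear L M τ f → IsSemilinear M N υ g → IsSemilinear L N (λ s → υ (τ s)) (λ x → g (f x))
∘-semilinear {N = N} _ p q = record
  { cong = λ e → Q.cong (P.cong e)
  ; +-hom = λ x y → N.≈ᴹ-trans (Q.cong (P.+-hom x y)) (Q.+-hom _ _)
  ; *-hom = λ s x → N.≈ᴹ-trans (Q.cong (P.*-hom s x)) (Q.*-hom _ _)
  }
  where
  module P = IsSemilinear p
  module Q = IsSemilinear q
  module N = Module N

module _ {c ℓ} {S : CommutativeRing c ℓ} where
  open CommutativeRing S

  ringMap-semilinear : ∀ {S' : CommutativeRing c ℓ} {τ} → IsRingHom S S' τ → IsSemilinear (unit S) (unit S') τ τ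
  ringMap-semilinear h = record { cong = IsRingHom.cong h ; +-hom = IsRingHom.+-hom h ; *-hom = IsRingHom.*-hom h }

  ideal-submodule : ∀ {I : Pred Carrier (c ⊔ ℓ)} → IsIdeal S I → IsSubmodule (unit S) I
  ideal-submodule i = record { resp = I.resp ; 0∈ = I.0∈ ; +∈ = I.+∈ ; *∈ = I.*∈ }
    where module I = IsIdeal i

  ideal-*ʳ : ∀ {I : Pred Carrier (c ⊔ ℓ)} → IsIdeal S I → ∀ {x} s → I x → I (x * s)
  ideal-*ʳ I-ideal s p = IsIdeal.resp I-ideal (*-comm s _) (IsIdeal.*∈ I-ideal s p)

  module _ (Carrierᴹ : Set c) (_≈ᴹ_ : Carrierᴹ → Carrierᴹ → Set ℓ) (_+ᴹ_ : Carrierᴹ → Carrierᴹ → Carrierᴹ)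
           (0ᴹ : Carrierᴹ) (-ᴹ_ : Carrierᴹ → Carrierᴹ) (_*ₗ_ : Carrier → Carrierᴹ → Carrierᴹ) where

    module _ (grp : IsAbelianGroup _≈ᴹ_ _+ᴹ_ 0ᴹ -ᴹ_)
             (cg : ∀ {s t x y} → s ≈ t → x ≈ᴹ y → (s *ₗ x) ≈ᴹ (t *ₗ y))
             (dˡ : ∀ s x y → (s *ₗ (x +ᴹ y)) ≈ᴹ ((s *ₗ x) +ᴹ (s *ₗ y)))
             (dʳ : ∀ x s t → ((s + t) *ₗ x) ≈ᴹ ((s *ₗ x) +ᴹ (t *ₗ x)))
             (as : ∀ s t x → ((s * t) *ₗ x) ≈ᴹ (s *ₗ (t *ₗ x)))
             (idn : ∀ x → (1# *ₗ x) ≈ᴹ x) where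
      private
        module G = IsAbelianGroup grp
        open SetoidReasoning G.setoid

        -- Yields the two zero laws from distributivity, because `0# *ₗ x` and `s *ₗ 0ᴹ` each equal
        -- their own double.
        idem⇒0 : ∀ {x} → (x +ᴹ x) ≈ᴹ x → x ≈ᴹ 0ᴹ
        idem⇒0 {x} p = begin
          x                       ≈⟨ G.sym (G.identityʳ x) ⟩
          (x +ᴹ 0ᴹ)               ≈⟨ G.∙-congˡ (G.sym (G.inverseʳ x)) ⟩
          (x +ᴹ (x +ᴹ (-ᴹ x)))    ≈⟨ G.sym (G.assoc x x _) ⟩
          ((x +ᴹ x) +ᴹ (-ᴹ x))    ≈⟨ G.∙-congʳ p ⟩
          (x +ᴹ (-ᴹ x))           ≈⟨ G.inverseʳ x ⟩
          0ᴹ                      ∎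

      abstract
        isModuleFromLeft : IsModule S _≈ᴹ_ _+ᴹ_ 0ᴹ -ᴹ_ _*ₗ_ (λ x s → s *ₗ x)
        isModuleFromLeft = Biased.IsModuleFromLeft.isModule {commutativeRing = S} record
          { isLeftModule = record
            { isLeftSemimodule = record
              { +ᴹ-isCommutativeMonoid = G.isCommutativeMonoid
              ; isPreleftSemimodule = record
                { *ₗ-cong = cg
                ; *ₗ-zeroˡ = λ x → idem⇒0 (G.trans (G.sym (dʳ x 0# 0#)) (cg (+-identityˡ 0#) G.refl))
                ; *ₗ-distribʳ = dʳ
                ; *ₗ-identityˡ = idn
                ; *ₗ-assoc = as
                ; *ₗ-zeroʳ = λ s → idem⇒0 (G.trans (G.sym (dˡ s 0ᴹ 0ᴹ)) (cg refl (G.identityˡ 0ᴹ)))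
                ; *ₗ-distribˡ = dˡ } }
            ; -ᴹ‿cong = G.⁻¹-cong
            ; -ᴹ‿inverse = G.inverse } }

      mkModule : Module S c ℓ
      mkModule = record { isModule = isModuleFromLeft }

-- The Jacobson radical and Nakayama's lemma

module JacobsonFacts {c ℓ} (S : CommutativeRing c ℓ) where
  open CommutativeRing S hiding (zero)
  open ModuleFacts (unit S) using (sub-self; sub-+; *-sub; sub-0; -ᴹ-cong₂; sub-*; sub-chain)
  open SemiringSolver commutativeSemiring using (solve; _:+_; _:*_; _:=_)
  open SetoidReasoning setoid

  private
    unit-resp : ∀ {x y} → x ≈ y → IsUnit S x → IsUnit S y
    unit-resp p (z , q) = z , trans (*-congʳ (sym p)) q

  jacobson-ideal : IsIdeal S (Jacobson S)
  jacobson-ideal = record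
    { resp = λ p j y → unit-resp (+-congˡ (-‿cong (*-congʳ p))) (j y)
    ; 0∈ = λ y → 1# , trans (*-identityʳ _) (trans (+-congˡ (-‿cong (zeroˡ y))) (sub-0 1#))
    ; +∈ = add
    ; *∈ = λ s {x} j y → unit-resp (+-congˡ (-‿cong (solve 3 (λ x s y → x :* (s :* y) := (s :* x) :* y) refl x s y))) (j (s * y))
    }
    where
    add : ∀ {x w} → Jacobson S x → Jacobson S w → Jacobson S (x + w)
    add {x} {w} jx jw y with jx y
    ... | z , uz with jw (y * z)
    ... | t , vt = z * t , (begin
      (1# - (x + w) * y) * (z * t)               ≈⟨ *-congʳ split ⟩
      (1# - x * y) * (1# - w * (y * z)) * (z * t) ≈⟨ solve 4 (λ u v z t → (u :* v) :* (z :* t) := (u :* z) :* (v :* t)) refl (1# - x * y) (1# - w * (y * z)) z t ⟩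
      ((1# - x * y) * z) * ((1# - w * (y * z)) * t) ≈⟨ *-cong uz vt ⟩
      1# * 1#                                    ≈⟨ *-identityˡ 1# ⟩
      1#                                         ∎)
      where
      -- Since `z` inverts `1# - x * y`, the term `w * y` equals `(1# - x * y) * (w * (y * z))`,
      -- which exposes the common factor.
      split : 1# - (x + w) * y ≈ (1# - x * y) * (1# - w * (y * z))
      split = begin
        1# - (x + w) * y                                      ≈⟨ -ᴹ-cong₂ (sym (+-identityʳ 1#)) (distribʳ y x w) ⟩
        (1# + 0#) - (x * y + w * y)                           ≈⟨ sub-+ 1# 0# (x * y) (w * y) ⟩
        (1# - x * y) + (0# - w * y)                           ≈⟨ +-congˡ (+-identityˡ _) ⟩
        (1# - x * y) - w * y                                  ≈⟨ +-congˡ (-‿cong (begin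
          w * y                          ≈⟨ sym (*-identityʳ _) ⟩
          (w * y) * 1#                   ≈⟨ *-congˡ (sym uz) ⟩
          (w * y) * ((1# - x * y) * z)   ≈⟨ solve 4 (λ w y u z → (w :* y) :* (u :* z) := u :* (w :* (y :* z))) refl w y (1# - x * y) z ⟩
          (1# - x * y) * (w * (y * z))   ∎)) ⟩
        (1# - x * y) - (1# - x * y) * (w * (y * z))           ≈⟨ +-congʳ (sym (*-identityʳ _)) ⟩
        (1# - x * y) * 1# - (1# - x * y) * (w * (y * z))      ≈⟨ sym (*-sub (1# - x * y) 1# (w * (y * z))) ⟩
        (1# - x * y) * (1# - w * (y * z))                     ∎

  -- Difference of two squares: `1# + x * y` times an inverse of 1 - x²y² inverts `1# - x * y`.
  -- Closure under roots is what later removes the exponents produced by the Frobenius congruence.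
  jacobson-sqrt : ∀ {x} → Jacobson S (x * x) → Jacobson S x
  jacobson-sqrt {x} j y with j (y * y)
  ... | z , q = (1# + x * y) * z , (begin
    (1# - x * y) * ((1# + x * y) * z)       ≈⟨ sym (*-assoc _ _ z) ⟩
    (1# - x * y) * (1# + x * y) * z         ≈⟨ *-congʳ factor ⟩
    (1# - (x * x) * (y * y)) * z            ≈⟨ q ⟩
    1#                                      ∎)
    where
    a : Carrier
    a = x * y
    factor : (1# - a) * (1# + a) ≈ 1# - (x * x) * (y * y)
    factor = begin
      (1# - a) * (1# + a)            ≈⟨ distribˡ _ 1# a ⟩
      (1# - a) * 1# + (1# - a) * a   ≈⟨ +-cong (*-identityʳ _) (trans (sub-* 1# a a) (+-congʳ (*-identityˡ a))) ⟩
      (1# - a) + (a - a * a)         ≈⟨ sub-chain 1# a (a * a) ⟩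
      1# - a * a                     ≈⟨ +-congˡ (-‿cong (solve 2 (λ x y → (x :* y) :* (x :* y) := (x :* x) :* (y :* y)) refl x y)) ⟩
      1# - (x * x) * (y * y)         ∎

module _ {c ℓ} {S : CommutativeRing c ℓ} (M : Module S c ℓ)
         {N : Pred (Module.Carrierᴹ M) (c ⊔ ℓ)} (N-sub : IsSubmodule M N) where
  open CommutativeRing S hiding (zero)
  open Module M
  open ModuleFacts M
  open JacobsonFacts S
  open IsSubmodule N-sub
  private module J = IsIdeal jacobson-ideal

  -- Elimination in place of a determinant: `1# - a fzero fzero` is a unit, so the first equation is
  -- solved for `z fzero` and substituted into the others, whose coefficients stay in the radical.
  -- Being a statement about a system of equations, it applies to generators of a module and to
  -- coefficients of a relation alike.
  nakayama : ∀ {m} (z : Fin m → Carrierᴹ) (a : Fin m → Fin m → Carrier) (r : Fin m → Carrierᴹ) →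
    (∀ i j → Jacobson S (a i j)) → (∀ i → N (r i)) →
    (∀ i → z i ≈ᴹ r i +ᴹ sumM M (λ j → a i j *ₗ z j)) → ∀ i → N (z i)
  nakayama {zero} z a r ja nr e ()
  nakayama {suc m} z a r ja nr e = λ { fzero → head ; (fsuc i) → tail i }
    where
    open SetoidReasoning ≈ᴹ-setoid
    z₀ : Carrierᴹ
    z₀ = z fzero
    rest : (Fin m → Carrier) → Carrierᴹ
    rest s = lc s (λ j → z (fsuc j))
    y : Carrier
    y = proj₁ (ja fzero fzero 1#)
    solve₀ : z₀ ≈ᴹ y *ₗ r fzero +ᴹ rest (λ j → y * a fzero (fsuc j))
    solve₀ = begin
      z₀                                           ≈⟨ ≈ᴹ-sym (*ₗ-identityˡ z₀) ⟩
      1# *ₗ z₀                                     ≈⟨ *ₗ-congʳ (trans (sym (proj₂ (ja fzero fzero 1#))) (*-comm _ _)) ⟩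
      (y * (1# - a fzero fzero * 1#)) *ₗ z₀        ≈⟨ *ₗ-assoc _ _ _ ⟩
      y *ₗ ((1# - a fzero fzero * 1#) *ₗ z₀)       ≈⟨ *ₗ-congˡ (≈ᴹ-trans (*ₗ-congʳ (+-congˡ (-‿cong (*-identityʳ _)))) (sub-* 1# _ z₀)) ⟩
      y *ₗ (1# *ₗ z₀ -ᴹ a fzero fzero *ₗ z₀)       ≈⟨ *ₗ-congˡ (move-sub (begin
        1# *ₗ z₀       ≈⟨ *ₗ-identityˡ z₀ ⟩
        z₀             ≈⟨ e fzero ⟩
        r fzero +ᴹ (a fzero fzero *ₗ z₀ +ᴹ rest (λ j → a fzero (fsuc j)))
          ≈⟨ ModuleFacts.solve M 3 (λ r s t → r ⊕ (s ⊕ t) ⊜ (r ⊕ t) ⊕ s) ≈ᴹ-refl (r fzero) (a fzero fzero *ₗ z₀) (rest (λ j → a fzero (fsuc j))) ⟩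
        (r fzero +ᴹ rest (λ j → a fzero (fsuc j))) +ᴹ a fzero fzero *ₗ z₀  ∎)) ⟩
      y *ₗ (r fzero +ᴹ rest (λ j → a fzero (fsuc j)))       ≈⟨ *ₗ-distribˡ y _ _ ⟩
      y *ₗ r fzero +ᴹ y *ₗ rest (λ j → a fzero (fsuc j))    ≈⟨ +ᴹ-congˡ (≈ᴹ-sym (lc-* y (λ j → a fzero (fsuc j)) (λ j → z (fsuc j)))) ⟩
      y *ₗ r fzero +ᴹ rest (λ j → y * a fzero (fsuc j))     ∎
    a' : Fin m → Fin m → Carrier
    a' i j = a (fsuc i) fzero * (y * a fzero (fsuc j)) + a (fsuc i) (fsuc j)
    r' : Fin m → Carrierᴹ
    r' i = r (fsuc i) +ᴹ a (fsuc i) fzero *ₗ (y *ₗ r fzero)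
    reduced : ∀ i → z (fsuc i) ≈ᴹ r' i +ᴹ rest (a' i)
    reduced i = begin
      z (fsuc i)  ≈⟨ e (fsuc i) ⟩
      r (fsuc i) +ᴹ (b *ₗ z₀ +ᴹ rest (λ j → a (fsuc i) (fsuc j)))
        ≈⟨ +ᴹ-congˡ (+ᴹ-congʳ (≈ᴹ-trans (*ₗ-congˡ solve₀) (*ₗ-distribˡ b _ _))) ⟩
      r (fsuc i) +ᴹ ((b *ₗ (y *ₗ r fzero) +ᴹ b *ₗ rest (λ j → y * a fzero (fsuc j))) +ᴹ rest (λ j → a (fsuc i) (fsuc j)))
        ≈⟨ ModuleFacts.solve M 4 (λ r s t u → r ⊕ ((s ⊕ t) ⊕ u) ⊜ (r ⊕ s) ⊕ (t ⊕ u)) ≈ᴹ-refl (r (fsuc i)) _ _ _ ⟩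
      r' i +ᴹ (b *ₗ rest (λ j → y * a fzero (fsuc j)) +ᴹ rest (λ j → a (fsuc i) (fsuc j)))
        ≈⟨ +ᴹ-congˡ (+ᴹ-congʳ (≈ᴹ-sym (lc-* b (λ j → y * a fzero (fsuc j)) (λ j → z (fsuc j))))) ⟩
      r' i +ᴹ (rest (λ j → b * (y * a fzero (fsuc j))) +ᴹ rest (λ j → a (fsuc i) (fsuc j)))
        ≈⟨ +ᴹ-congˡ (≈ᴹ-sym (lc-+ (λ j → b * (y * a fzero (fsuc j))) (λ j → a (fsuc i) (fsuc j)) (λ j → z (fsuc j)))) ⟩
      r' i +ᴹ rest (a' i)  ∎
      where
      b : Carrier
      b = a (fsuc i) fzero
    tail : ∀ i → N (z (fsuc i))
    tail = nakayama (λ i → z (fsuc i)) a' r'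
      (λ i j → J.+∈ (ideal-*ʳ jacobson-ideal _ (ja (fsuc i) fzero)) (ja (fsuc i) (fsuc j)))
      (λ i → +∈ (nr (fsuc i)) (*∈ _ (*∈ y (nr fzero)))) reduced
    head : N z₀
    head = resp (≈ᴹ-sym solve₀) (+∈ (*∈ y (nr fzero)) (sum∈ N-sub λ j → *∈ _ (tail j)))

-- Matrices

-- In the situation of a surjection A from the twist of im e onto im e, with section B, the idempotent
-- δ cuts out ker A; its twists embed as independent summands of every iterated twist of im e.
module TwistedDefect {c ℓ} (R : RingWithoutOne c ℓ) where
  open RingWithoutOne R

  module Twist (σ : Carrier → Carrier) (σ-cong : ∀ {x y} → x ≈ y → σ x ≈ σ y)
      (σ-* : ∀ x y → σ (x * y) ≈ σ x * σ y) (σ-0 : σ 0# ≈ 0#)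
      (e A B : Carrier) (ee : e * e ≈ e) (eA : e * A ≈ A) (Aσe : A * σ e ≈ A)
      (σeB : σ e * B ≈ B) (Be : B * e ≈ B) (AB : A * B ≈ e) where
    open RingWithoutOneProperties R
    open SetoidReasoning setoid

    private
      inner : ∀ a b c d → (a * b) * (c * d) ≈ a * ((b * c) * d)
      inner a b c d = trans (*-assoc a b _) (*-congˡ (sym (*-assoc b c d)))

      sub-self : ∀ {x y} → x ≈ y → x - y ≈ 0#
      sub-self p = trans (+-congʳ p) (-‿inverseʳ _)

      σ-inner : ∀ a b c d → (a * σ b) * (σ c * d) ≈ a * (σ (b * c) * d)
      σ-inner a b c d = trans (inner a (σ b) (σ c) d) (*-congˡ (*-congʳ (sym (σ-* b c))))

      σ-zero : ∀ {x y} → x * y ≈ 0# → σ x * σ y ≈ 0#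
      σ-zero p = trans (sym (σ-* _ _)) (trans (σ-cong p) σ-0)

    -- `B * A` projects the image of `σ e` onto the copy of the image of `e` embedded by the section
    -- `B`; the complementary idempotent has image ker `A`.
    δ : Carrier
    δ = σ e - B * A

    Aδ : A * δ ≈ 0#
    Aδ = trans (x[y-z]≈xy-xz A (σ e) (B * A)) (sub-self (begin
      A * σ e      ≈⟨ Aσe ⟩
      A            ≈⟨ sym eA ⟩
      e * A        ≈⟨ *-congʳ (sym AB) ⟩
      A * B * A    ≈⟨ *-assoc A B A ⟩
      A * (B * A)  ∎))

    δB : δ * B ≈ 0#
    δB = trans ([y-z]x≈yx-zx B (σ e) (B * A)) (sub-self (begin
      σ e * B      ≈⟨ σeB ⟩
      B            ≈⟨ sym Be ⟩
      B * e        ≈⟨ *-congˡ (sym AB) ⟩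
      B * (A * B)  ≈⟨ sym (*-assoc B A B) ⟩
      B * A * B    ∎))

    σeδ : σ e * δ ≈ δ
    σeδ = trans (x[y-z]≈xy-xz (σ e) (σ e) (B * A))
      (+-cong (trans (sym (σ-* e e)) (σ-cong ee)) (-‿cong (trans (sym (*-assoc (σ e) B A)) (*-congʳ σeB))))

    δδ : δ * δ ≈ δ
    δδ = begin
      δ * δ                    ≈⟨ [y-z]x≈yx-zx δ (σ e) (B * A) ⟩
      σ e * δ - B * A * δ      ≈⟨ +-cong σeδ (-‿cong (trans (*-assoc B A δ) (trans (*-congˡ Aδ) (zeroʳ B)))) ⟩
      δ - 0#                   ≈⟨ +-congˡ (trans (sym (+-identityˡ _)) (-‿inverseʳ 0#)) ⟩
      δ + 0#                   ≈⟨ +-identityʳ δ ⟩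
      δ                        ∎

    -- Composites through the iterated twists: `A^ m` maps the image of σ^m e onto that of `e`, and
    -- `B^ m` is a section of it.
    A^ B^ : ℕ → Carrier
    A^ zero = e
    A^ (suc m) = A * σ (A^ m)
    B^ zero = e
    B^ (suc m) = σ (B^ m) * B

    A^B^ : ∀ m → A^ m * B^ m ≈ e
    A^B^ zero = ee
    A^B^ (suc m) = begin
      (A * σ (A^ m)) * (σ (B^ m) * B)  ≈⟨ σ-inner A (A^ m) (B^ m) B ⟩
      A * (σ (A^ m * B^ m) * B)        ≈⟨ *-congˡ (*-congʳ (σ-cong (A^B^ m))) ⟩
      A * (σ e * B)                    ≈⟨ *-congˡ σeB ⟩
      A * B                            ≈⟨ AB ⟩
      e                                ∎

    -- `D m i` is the i-th twist of `δ`; `V m i` embeds its image into that of σ^m e, and `W m i`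
    -- maps back. Passing from m to m + 1 twists the old summands and adds ker `A`, carried along
    -- the section `σ (B^ m)`.
    V W D : ∀ m → Fin m → Carrier
    V (suc m) fzero = σ (B^ m) * δ
    V (suc m) (fsuc i) = σ (V m i)
    W (suc m) fzero = δ * σ (A^ m)
    W (suc m) (fsuc i) = σ (W m i)
    D (suc m) fzero = δ
    D (suc m) (fsuc i) = σ (D m i)

    -- With `WB^` this feeds `WV-off`: the old summands lie in the kernel of `A^ m`, the new one is
    -- carried by the section `B^ m`, so every mixed product contains a vanishing factor.
    A^V : ∀ m i → A^ m * V m i ≈ 0#
    A^V (suc m) fzero = begin
      (A * σ (A^ m)) * (σ (B^ m) * δ)  ≈⟨ σ-inner A (A^ m) (B^ m) δ ⟩
      A * (σ (A^ m * B^ m) * δ)        ≈⟨ *-congˡ (trans (*-congʳ (σ-cong (A^B^ m))) σeδ) ⟩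
      A * δ                            ≈⟨ Aδ ⟩
      0#                               ∎
    A^V (suc m) (fsuc i) = trans (*-assoc A _ _) (trans (*-congˡ (σ-zero (A^V m i))) (zeroʳ A))

    WB^ : ∀ m i → W m i * B^ m ≈ 0#
    WB^ (suc m) fzero = begin
      (δ * σ (A^ m)) * (σ (B^ m) * B)  ≈⟨ σ-inner δ (A^ m) (B^ m) B ⟩
      δ * (σ (A^ m * B^ m) * B)        ≈⟨ *-congˡ (trans (*-congʳ (σ-cong (A^B^ m))) σeB) ⟩
      δ * B                            ≈⟨ δB ⟩
      0#                               ∎
    WB^ (suc m) (fsuc i) = trans (sym (*-assoc _ _ B)) (trans (*-congʳ (σ-zero (WB^ m i))) (zeroˡ B))

    WV-off : ∀ m i j → i ≢ j → W m i * V m j ≈ 0#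
    WV-off (suc m) fzero fzero i≢j = ⊥-elim (i≢j ≡.refl)
    WV-off (suc m) fzero (fsuc j) _ = trans (*-assoc δ _ _) (trans (*-congˡ (σ-zero (A^V m j))) (zeroʳ δ))
    WV-off (suc m) (fsuc i) fzero _ = trans (sym (*-assoc _ _ δ)) (trans (*-congʳ (σ-zero (WB^ m i))) (zeroˡ δ))
    WV-off (suc m) (fsuc i) (fsuc j) i≢j = σ-zero (WV-off m i j λ p → i≢j (≡.cong fsuc p))

    WV-diag : ∀ m i → W m i * V m i ≈ D m i
    WV-diag (suc m) fzero = begin
      (δ * σ (A^ m)) * (σ (B^ m) * δ)  ≈⟨ σ-inner δ (A^ m) (B^ m) δ ⟩
      δ * (σ (A^ m * B^ m) * δ)        ≈⟨ *-congˡ (trans (*-congʳ (σ-cong (A^B^ m))) σeδ) ⟩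
      δ * δ                            ≈⟨ δδ ⟩
      δ                                ∎
    WV-diag (suc m) (fsuc i) = trans (sym (σ-* _ _)) (σ-cong (WV-diag m i))

module Matrices {c ℓ} (S : CommutativeRing c ℓ) where
  open CommutativeRing S hiding (zero)
  private
    U = unit S
  open ModuleFacts U using (sum-cong; sum-+; sum-*; sum-swap; sum-0; sum-punchIn)
  open SetoidReasoning setoid

  Mat : ℕ → Set c
  Mat n = Fin n → Fin n → Carrier

  dot : ∀ {n} → (Fin n → Carrier) → (Fin n → Carrier) → Carrier
  dot v w = sumM U (λ k → v k * w k)

  infixl 7 _·_
  _·_ : ∀ {n} → Mat n → Mat n → Mat n
  (A · B) i j = dot (A i) (λ k → B k j)

  sum-distribʳ : ∀ {n} (f : Fin n → Carrier) s → sumM U f * s ≈ sumM U (λ k → f k * s)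
  sum-distribʳ {n} f s = trans (*-comm _ s) (trans (sum-* s f) (sum-cong {n} λ k → *-comm s (f k)))

  ·-assoc : ∀ {n} (A B C : Mat n) i j → ((A · B) · C) i j ≈ (A · (B · C)) i j
  ·-assoc {n} A B C i j = begin
    sumM U (λ k → sumM U (λ l → A i l * B l k) * C k j)
      ≈⟨ sum-cong {n} (λ k → trans (sum-distribʳ (λ l → A i l * B l k) (C k j)) (sum-cong {n} λ l → *-assoc _ _ _)) ⟩
    sumM U (λ k → sumM U (λ l → A i l * (B l k * C k j)))
      ≈⟨ sum-swap {n} {n} (λ k l → A i l * (B l k * C k j)) ⟩
    sumM U (λ l → sumM U (λ k → A i l * (B l k * C k j)))
      ≈⟨ sum-cong {n} (λ l → sym (sum-* (A i l) (λ k → B l k * C k j))) ⟩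
    sumM U (λ l → A i l * sumM U (λ k → B l k * C k j)) ∎

  -- The structure stops short of a unit because the idempotents `e` and `σ e` serve as identities
  -- in the computation with defects.
  matrixRing : ℕ → RingWithoutOne c ℓ
  matrixRing n = record
    { Carrier = Mat n
    ; _≈_ = λ A B → ∀ i j → A i j ≈ B i j
    ; _+_ = λ A B i j → A i j + B i j
    ; _*_ = _·_
    ; -_ = λ A i j → - A i j
    ; 0# = λ i j → 0#
    ; isRingWithoutOne = record
      { +-isAbelianGroup = record
        { isGroup = record
          { isMonoid = record
            { isSemigroup = record
              { isMagma = record
                { isEquivalence = record
                  { refl = λ i j → refl ; sym = λ p i j → sym (p i j) ; trans = λ p q i j → trans (p i j) (q i j) }
                ; ∙-cong = λ p q i j → +-cong (p i j) (q i j) }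
              ; assoc = λ A B C i j → +-assoc _ _ _ }
            ; identity = (λ A i j → +-identityˡ _) , (λ A i j → +-identityʳ _) }
          ; inverse = (λ A i j → -‿inverseˡ _) , (λ A i j → -‿inverseʳ _)
          ; ⁻¹-cong = λ p i j → -‿cong (p i j) }
        ; comm = λ A B i j → +-comm _ _ }
      ; *-cong = λ p q i j → sum-cong {n} λ k → *-cong (p i k) (q k j)
      ; *-assoc = ·-assoc
      ; distrib = (λ A B C i j → trans (sum-cong {n} λ k → distribˡ _ _ _) (sum-+ (λ k → A i k * B k j) (λ k → A i k * C k j)))
                , (λ A B C i j → trans (sum-cong {n} λ k → distribʳ _ _ _) (sum-+ (λ k → B i k * A k j) (λ k → C i k * A k j))) } }

  module _ {σ : Carrier → Carrier} (σ-hom : IsRingHom S S σ) where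
    mapMat : ∀ {n} → Mat n → Mat n
    mapMat A i j = σ (A i j)

    mapMat-· : ∀ {n} (A B : Mat n) i j → mapMat (A · B) i j ≈ (mapMat A · mapMat B) i j
    mapMat-· A B i j = SemilinearFacts.map-lin (ringMap-semilinear σ-hom) (A i) (λ k → B k j)

  prod : ∀ {n} → (Fin n → Carrier) → Carrier
  prod {zero} f = 1#
  prod {suc n} f = f fzero * prod (λ k → f (fsuc k))

  prod-scale : ∀ {n} s (f : Fin n → Carrier) → prod (λ k → s * f k) ≈ pow S s n * prod f
  prod-scale {zero} s f = sym (*-identityˡ 1#)
  prod-scale {suc n} s f = trans (*-congˡ (prod-scale s (λ k → f (fsuc k))))
    (solve 4 (λ s x y z → (s :* x) :* (y :* z) := (s :* y) :* (x :* z)) refl s (f fzero) (pow S s n) (prod (λ k → f (fsuc k))))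
    where open SemiringSolver commutativeSemiring using (solve; _:*_; _:=_)

  module RadicalIdeal (R : Pred Carrier (c ⊔ ℓ)) (R-ideal : IsIdeal S R) (sqrt : ∀ {x} → R (x * x) → R x) where
    open IsIdeal R-ideal
    open SemiringSolver commutativeSemiring using (solve; _:*_; _:+_; _:=_)

    -- Multiplying x^(n+2) by x^n gives the square of x^(n+1), so one square root lowers the
    -- exponent by one.
    pow-root : ∀ n {x} → R (pow S x (suc n)) → R x
    pow-root zero p = resp (*-identityʳ _) p
    pow-root (suc n) {x} p = pow-root n (sqrt (resp
      (solve 2 (λ x y → y :* (x :* (x :* y)) := (x :* y) :* (x :* y)) refl x (pow S x n)) (*∈ (pow S x n) p)))

    pow-* : ∀ n x y → pow S (x * y) n ≈ pow S x n * pow S y n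
    pow-* zero x y = sym (*-identityˡ 1#)
    pow-* (suc n) x y = trans (*-congˡ (pow-* n x y))
      (solve 4 (λ x y z w → (x :* y) :* (z :* w) := (x :* z) :* (y :* w)) refl x y (pow S x n) (pow S y n))

    pow-root-* : ∀ n {x y} → R (pow S x (suc n) * y) → R (x * y)
    pow-root-* n {x} {y} p = pow-root n (resp
      (trans (solve 3 (λ x y z → z :* (x :* y) := x :* (y :* z)) refl (pow S x (suc n)) y (pow S y n)) (sym (pow-* (suc n) x y)))
      (*∈ (pow S y n) p))

    -- Over a ring in which the product of the c i is invertible, n + 1 vectors in S^n with a
    -- biorthogonal family would exhibit S^(n+1) as a summand of S^n.
    biorthogonal : ∀ n (w v : Fin (suc n) → Fin n → Carrier) (c : Fin (suc n) → Carrier) →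
      (∀ i → dot (w i) (v i) ≈ c i) → (∀ i j → i ≢ j → dot (w i) (v j) ≈ 0#) → R (prod c)
    biorthogonal zero w v c diag off = resp (trans (*-comm _ _) (*-congʳ (diag fzero))) (*∈ 1# 0∈)
    biorthogonal (suc n) w v c diag off = resp
      (trans (sym (sum-distribʳ (λ k → w fzero k * v fzero k) c')) (*-congʳ (diag fzero)))
      (ModuleFacts.sum∈ U (ideal-submodule R-ideal) λ k → resp (sym (*-assoc _ _ _)) (*∈ (w fzero k) (pivot k)))
      where
      c' : Carrier
      c' = prod (λ i → c (fsuc i))
      module _ (k : Fin (suc n)) where
        s : Carrier
        s = v fzero k
        -- Cross-multiplied elimination of coordinate `k` against `v fzero`. Pairings with
        -- `w (fsuc i)` only gain the factor `s`, since `v fzero` is orthogonal to these vectors,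
        -- and coordinate `k` can then be dropped. Recursion yields s^(n+1) c', from which a radical
        -- ideal allows the passage to s c'.
        v' : Fin (suc n) → Fin (suc n) → Carrier
        v' j l = s * v (fsuc j) l + - v (fsuc j) k * v fzero l
        v'k≈0 : ∀ j → v' j k ≈ 0#
        v'k≈0 j = trans (+-cong (*-comm _ _) (ModuleFacts.neg-* U _ _)) (-‿inverseʳ _)
        dot-v' : ∀ i j → dot (w (fsuc i)) (v' j) ≈ s * dot (w (fsuc i)) (v (fsuc j))
        dot-v' i j = begin
          dot (w (fsuc i)) (v' j)
            ≈⟨ sum-cong {suc n} (λ l → solve 5 (λ w s x t y → w :* (s :* x :+ t :* y) := s :* (w :* x) :+ t :* (w :* y)) refl
                 (w (fsuc i) l) s (v (fsuc j) l) (- v (fsuc j) k) (v fzero l)) ⟩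
          sumM U (λ l → s * (w (fsuc i) l * v (fsuc j) l) + - v (fsuc j) k * (w (fsuc i) l * v fzero l))
            ≈⟨ sum-+ (λ l → s * (w (fsuc i) l * v (fsuc j) l)) (λ l → - v (fsuc j) k * (w (fsuc i) l * v fzero l)) ⟩
          sumM U (λ l → s * (w (fsuc i) l * v (fsuc j) l)) + sumM U (λ l → - v (fsuc j) k * (w (fsuc i) l * v fzero l))
            ≈⟨ sym (+-cong (sum-* s (λ l → w (fsuc i) l * v (fsuc j) l)) (sum-* (- v (fsuc j) k) (λ l → w (fsuc i) l * v fzero l))) ⟩
          s * dot (w (fsuc i)) (v (fsuc j)) + - v (fsuc j) k * dot (w (fsuc i)) (v fzero)
            ≈⟨ +-congˡ (trans (*-congˡ (off (fsuc i) fzero λ ())) (zeroʳ _)) ⟩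
          s * dot (w (fsuc i)) (v (fsuc j)) + 0#
            ≈⟨ +-identityʳ _ ⟩
          s * dot (w (fsuc i)) (v (fsuc j)) ∎
        dot-punched : ∀ i j → dot (λ l → w (fsuc i) (punchIn k l)) (λ l → v' j (punchIn k l)) ≈ s * dot (w (fsuc i)) (v (fsuc j))
        dot-punched i j = begin
          dot (λ l → w (fsuc i) (punchIn k l)) (λ l → v' j (punchIn k l))  ≈⟨ sym (+-identityˡ _) ⟩
          0# + dot (λ l → w (fsuc i) (punchIn k l)) (λ l → v' j (punchIn k l))  ≈⟨ +-congʳ (sym (trans (*-congˡ (v'k≈0 j)) (zeroʳ _))) ⟩
          w (fsuc i) k * v' j k + dot (λ l → w (fsuc i) (punchIn k l)) (λ l → v' j (punchIn k l))  ≈⟨ sym (sum-punchIn (λ l → w (fsuc i) l * v' j l) k) ⟩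
          dot (w (fsuc i)) (v' j)            ≈⟨ dot-v' i j ⟩
          s * dot (w (fsuc i)) (v (fsuc j))  ∎
        scaled : R (prod (λ i → s * c (fsuc i)))
        scaled = biorthogonal n (λ i l → w (fsuc i) (punchIn k l)) (λ j l → v' j (punchIn k l)) (λ i → s * c (fsuc i))
          (λ i → trans (dot-punched i i) (*-congˡ (diag (fsuc i))))
          (λ i j i≢j → trans (dot-punched i j) (trans (*-congˡ (off (fsuc i) (fsuc j) λ { ≡.refl → i≢j ≡.refl })) (zeroʳ s)))
        pivot : R (s * c')
        pivot = pow-root-* n (resp (prod-scale s (λ i → c (fsuc i))) scaled)

-- Injectivity of the linearization

module FrameFacts {c ℓ} {p : ℕ} {S : CommutativeRing c ℓ} (Fr : Frame p S) where
  open CommutativeRing S hiding (zero)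
  open Frame Fr
  open JacobsonFacts S
  open Matrices S
  open ModuleFacts (unit S) using (sum-cong; add-sub; sub-add; sub∈)
  private
    U = unit S
    module I = IsIdeal I-ideal
    module J = IsIdeal jacobson-ideal
    module σ = IsRingHom σ-hom

  open SemilinearFacts (ringMap-semilinear σ-hom) public using () renaming (map-0 to σ-0; map-lin to σ-lin)

  σ₁-0 : ∀ {a} (h : I a) → a ≈ 0# → σ₁ a h ≈ 0#
  σ₁-0 h q = trans (σ₁-cong h (I.*∈ 0# I.0∈) (trans q (sym (zeroˡ 0#)))) (trans (σ₁-* 0# I.0∈ _) (trans (*-congʳ σ-0) (zeroˡ _)))

  I⊆jacobson : ∀ {a} → I a → Jacobson S a
  I⊆jacobson {a} ha = J.resp (trans (+-congˡ (zeroʳ _)) (+-identityʳ a)) (radical ha 0#)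

  p*∈jacobson : ∀ s → Jacobson S (natR S p * s)
  p*∈jacobson s = J.resp (+-identityˡ _) (radical I.0∈ s)

  private
    open RadicalIdeal (Jacobson S) jacobson-ideal jacobson-sqrt

    root-p : .{{ℕ.NonZero p}} → ∀ q → q ≡ p → ∀ {x y} → Jacobson S (pow S x q * y) → Jacobson S (x * y)
    root-p (suc q) _ j = pow-root-* q j
    root-p {{nz}} zero ≡.refl j with () ← ℕ.>-nonZero⁻¹ 0 {{nz}}

  -- Multiples of p lie in the radical, so modulo the radical σ x is x^p; closure under roots then
  -- disposes of the exponent.
  untwist : .{{ℕ.NonZero p}} → ∀ {x y} → Jacobson S (σ x * y) → Jacobson S (x * y)
  untwist {x} {y} j with frob x
  ... | b , eq = root-p p ≡.refl (J.resp cancel (sub∈ (ideal-submodule jacobson-ideal) j (p*∈jacobson (b * y))))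
    where
    open SetoidReasoning setoid
    cancel : σ x * y - natR S p * (b * y) ≈ pow S x p * y
    cancel = begin
      σ x * y - natR S p * (b * y)                                  ≈⟨ +-congʳ (trans (*-congʳ eq) (distribʳ y _ _)) ⟩
      (pow S x p * y + natR S p * b * y) - natR S p * (b * y)       ≈⟨ +-congʳ (+-congˡ (*-assoc _ b y)) ⟩
      (pow S x p * y + natR S p * (b * y)) - natR S p * (b * y)     ≈⟨ sub-add _ _ ⟩
      pow S x p * y                                                 ∎

  module _ .{{_ : ℕ.NonZero p}} {n : ℕ} (e A B : Mat n)
      (ee : ∀ i j → (e · e) i j ≈ e i j) (eA : ∀ i j → (e · A) i j ≈ A i j)
      (Aσe : ∀ i j → (A · mapMat σ-hom e) i j ≈ A i j) (σeB : ∀ i j → (mapMat σ-hom e · B) i j ≈ B i j)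
      (Be : ∀ i j → (B · e) i j ≈ B i j) (AB : ∀ i j → (A · B) i j ≈ e i j) where
    private
      module T = TwistedDefect (matrixRing n)
      open T.Twist (mapMat σ-hom) (λ q i j → σ.cong (q i j)) (mapMat-· σ-hom) (λ i j → σ-0) e A B ee eA Aσe σeB Be AB

      untwist-D : ∀ m i a b y → Jacobson S (D m i a b * y) → Jacobson S (δ a b * y)
      untwist-D (suc m) fzero a b y j = j
      untwist-D (suc m) (fsuc i) a b y j = untwist-D m i a b y (untwist j)

    open SemiringSolver commutativeSemiring using (solve; _:*_; _:+_; _:=_)
    private
      -- The factors of the product are exchanged for `x` one at a time. The cofactor `y` absorbs
      -- the remaining factors, so that the hypothesis on a single factor acts inside the product.
      peel : ∀ {m} (f : Fin m → Carrier) x → (∀ i y → Jacobson S (f i * y) → Jacobson S (x * y)) →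
        ∀ y → Jacobson S (prod f * y) → Jacobson S (pow S x m * y)
      peel {zero} f x h y j = j
      peel {suc m} f x h y j = J.resp (solve 3 (λ x w y → w :* (x :* y) := (x :* w) :* y) refl x (pow S x m) y)
        (peel (λ i → f (fsuc i)) x (λ i → h (fsuc i)) (x * y)
          (J.resp (solve 3 (λ x w y → x :* (w :* y) := w :* (x :* y)) refl x (prod (λ i → f (fsuc i))) y)
            (h fzero _ (J.resp (*-assoc _ _ _) j))))

      -- For a fixed entry, the rows `a` of the `W` and the columns `b` of the `V` are n + 1
      -- biorthogonal pairs in S^n, one more than the rank admits, with pairings the twists of
      -- `δ a b`. The product of these lies in the radical, and after untwisting so does the power
      -- of `δ a b` with exponent n + 1.
      δ∈jacobson : ∀ a b → Jacobson S (δ a b)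
      δ∈jacobson a b = pow-root n (J.resp (*-identityʳ _) (peel (λ i → D (suc n) i a b) (δ a b)
        (λ i y → untwist-D (suc n) i a b y) 1# (J.resp (sym (*-identityʳ _))
          (biorthogonal n (λ i → W (suc n) i a) (λ i l → V (suc n) i l b) (λ i → D (suc n) i a b)
            (λ i → WV-diag (suc n) i a b) (λ i j i≢j → WV-off (suc n) i j i≢j a b)))))

      -- Each column z of the idempotent matrix `δ` satisfies z = δ z with radical coefficients, and
      -- Nakayama's lemma leaves only zero.
      δ≈0 : ∀ a b → δ a b ≈ 0#
      δ≈0 a b = Level.lower (nakayama U (ideal-submodule (zero-ideal S)) (λ i → δ i b) δ (λ _ → 0#) δ∈jacobson (λ _ → Level.lift refl)
        (λ i → trans (sym (δδ i b)) (sym (+-identityˡ _))) a)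

    twist-injective : ∀ (r : Fin n → Carrier) → (∀ k → dot (A k) r ≈ 0#) → ∀ k → dot (λ j → σ (e k j)) r ≈ 0#
    twist-injective r Ar≈0 k = begin
      dot (λ j → σ (e k j)) r     ≈⟨ sum-cong {n} (λ j → *-congʳ (ModuleFacts.sub≈0⇒≈ U (δ≈0 k j))) ⟩
      -- The vector `r` is read as a matrix with all columns equal, so that associativity of matrix
      -- products applies.
      dot ((B · A) k) r           ≈⟨ ·-assoc B A (λ i _ → r i) k k ⟩
      dot (B k) (λ j → dot (A j) r)  ≈⟨ ModuleFacts.sum-0 U {n} (λ j → trans (*-congˡ (Ar≈0 j)) (zeroʳ _)) ⟩
      0#                          ∎
      where open SetoidReasoning setoid

module _ {c ℓ} {S : CommutativeRing c ℓ} (M : Module S c ℓ) where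
  open CommutativeRing S hiding (zero)
  open Module M
  open ModuleFacts M

  lc-lc : ∀ {m n} (r : Fin m → Carrier) (t : Fin m → Fin n → Carrier) (z : Fin n → Carrierᴹ) →
    lc r (λ i → lc (t i) z) ≈ᴹ lc (λ j → sumM (unit S) (λ i → r i * t i j)) z
  lc-lc {m} {n} r t z = begin
    lc r (λ i → lc (t i) z)
      ≈⟨ sum-cong {m} (λ i → ≈ᴹ-sym (lc-* (r i) (t i) z)) ⟩
    sumM M (λ i → sumM M (λ j → (r i * t i j) *ₗ z j))
      ≈⟨ sum-swap {m} {n} (λ i j → (r i * t i j) *ₗ z j) ⟩
    sumM M (λ j → sumM M (λ i → (r i * t i j) *ₗ z j))
      ≈⟨ sum-cong {n} (λ j → ≈ᴹ-sym (sum-*ʳ {M = M} (λ i → r i * t i j) (z j))) ⟩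
    lc (λ j → sumM (unit S) (λ i → r i * t i j)) z  ∎
    where open SetoidReasoning ≈ᴹ-setoid

  -- Generation as an induction principle over submodules; it is applied to spans, preimages,
  -- equalizers and images.
  Generates : (Carrierᴹ → Carrierᴹ) → Set (Level.suc (c ⊔ ℓ))
  Generates f = ∀ {N : Pred Carrierᴹ (c ⊔ ℓ)} → IsSubmodule M N → (∀ y → N (f y)) → ∀ x → N x

  InSpan : ∀ {n} → (Fin n → Carrierᴹ) → Pred Carrierᴹ (c ⊔ ℓ)
  InSpan {n} z x = ∃ λ (r : Fin n → Carrier) → x ≈ᴹ lc r z

  span-submodule : ∀ {n} (z : Fin n → Carrierᴹ) → IsSubmodule M (InSpan z)
  span-submodule {n} z = record
    { resp = λ p (r , q) → r , ≈ᴹ-trans (≈ᴹ-sym p) q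
    ; 0∈ = (λ _ → 0#) , ≈ᴹ-sym (sum-0 {n} λ k → *ₗ-zeroˡ (z k))
    ; +∈ = λ (r , p) (s , q) → (λ k → r k + s k) , ≈ᴹ-trans (+ᴹ-cong p q) (≈ᴹ-sym (lc-+ r s z))
    ; *∈ = λ s (r , p) → (λ k → s * r k) , ≈ᴹ-trans (*ₗ-congˡ p) (≈ᴹ-sym (lc-* s r z)) }

module FGP {c ℓ} {S : CommutativeRing c ℓ} {M : Module S c ℓ} (fgp : FGProjective M) where
  open CommutativeRing S hiding (zero)
  open Module M
  open FGProjective fgp public
  open ModuleFacts M
  private U = unit S

  ι-lin : ∀ k → IsLinear M U (λ x → ι x k)
  ι-lin k = record { cong = λ p → ι-cong p k ; +-hom = λ x y → ι-+ x y k ; *-hom = λ s x → ι-* s x k }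

  ι-injective : ∀ {x y} → (∀ k → ι x k ≈ ι y k) → x ≈ᴹ y
  ι-injective {x} {y} p = ≈ᴹ-trans (≈ᴹ-sym (retract x)) (≈ᴹ-trans (lc-congˡ e p) (retract y))

  ι-lc : ∀ {m} (s : Fin m → Carrier) (z : Fin m → Carrierᴹ) k → ι (lc s z) k ≈ sumM U (λ j → s j * ι (z j) k)
  ι-lc s z k = SemilinearFacts.map-lin (ι-lin k) s z

  ι-0 : ∀ k → ι 0ᴹ k ≈ 0#
  ι-0 k = SemilinearFacts.map-0 (ι-lin k)

  -- I M in coordinates: for finitely generated projective M this agrees with the finite sums Σ aₖ yₖ, aₖ ∈ I.
  infix 8 _·M
  _·M : Pred Carrier (c ⊔ ℓ) → Pred Carrierᴹ (c ⊔ ℓ)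
  (I ·M) x = ∀ k → I (ι x k)

  module _ {I : Pred Carrier (c ⊔ ℓ)} (I-ideal : IsIdeal S I) where
    private module I = IsIdeal I-ideal

    ·M-submodule : IsSubmodule M (I ·M)
    ·M-submodule = record
      { resp = λ p h k → I.resp (ι-cong p k) (h k)
      ; 0∈ = λ k → I.resp (sym (ι-0 k)) I.0∈
      ; +∈ = λ hx hy k → I.resp (sym (ι-+ _ _ k)) (I.+∈ (hx k) (hy k))
      ; *∈ = λ s hx k → I.resp (sym (ι-* s _ k)) (I.*∈ s (hx k)) }

    ·M-intro : ∀ {a} x → I a → (I ·M) (a *ₗ x)
    ·M-intro x h k = I.resp (sym (ι-* _ x k)) (ideal-*ʳ I-ideal _ h)

    ·M-lc : ∀ {m} {a : Fin m → Carrier} x → (∀ k → I (a k)) → (I ·M) (lc a x)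
    ·M-lc x h = sum∈ ·M-submodule λ j → ·M-intro (x j) (h j)

    ·M-lin : ∀ {f} → IsLinear M M f → ∀ {x} → (I ·M) x → (I ·M) (f x)
    ·M-lin {f} f-lin {x} h = IsSubmodule.resp ·M-submodule
      (≈ᴹ-trans (≈ᴹ-sym (SemilinearFacts.map-lin f-lin (ι x) e)) (IsSemilinear.cong f-lin (retract x)))
      (·M-lc (λ j → f (e j)) h)

  module _ {S' : CommutativeRing c ℓ} {N : Module S' c ℓ} {τ : Carrier → CommutativeRing.Carrier S'} where
    private
      module N = Module N
      module NF = ModuleFacts N
      module S' = CommutativeRing S'

    expand : ∀ {f} → IsSemilinear M N τ f → ∀ x → f x N.≈ᴹ NF.lc (λ j → τ (ι x j)) (λ j → f (e j))
    expand f-lin x = N.≈ᴹ-trans (IsSemilinear.cong f-lin (≈ᴹ-sym (retract x))) (SemilinearFacts.map-lin f-lin (ι x) e)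

    -- The composite M → S^n → N whose second map sends the j-th basis vector to `z j`. The `e j`
    -- are no basis: the value at `e j` is `z j` only if `z` respects the relations recorded by
    -- `ι (e j)`.
    fromImages : (Fin n → N.Carrierᴹ) → Carrierᴹ → N.Carrierᴹ
    fromImages z x = NF.lc (λ j → τ (ι x j)) z

    fromImages-lin : IsRingHom S S' τ → ∀ z → IsSemilinear M N τ (fromImages z)
    fromImages-lin τ-hom z = record
      { cong = λ p → NF.lc-congˡ z λ j → τ.cong (ι-cong p j)
      ; +-hom = λ x y → N.≈ᴹ-trans (NF.lc-congˡ z λ j → S'.trans (τ.cong (ι-+ x y j)) (τ.+-hom _ _))
                          (NF.lc-+ (λ j → τ (ι x j)) (λ j → τ (ι y j)) z)
      ; *-hom = λ s x → N.≈ᴹ-trans (NF.lc-congˡ z λ j → S'.trans (τ.cong (ι-* s x j)) (τ.*-hom _ _))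
                          (NF.lc-* (τ s) (λ j → τ (ι x j)) z) }
      where module τ = IsRingHom τ-hom

    agree : ∀ {f g} → IsSemilinear M N τ f → IsSemilinear M N τ g →
      (∀ j → f (e j) N.≈ᴹ g (e j)) → ∀ x → f x N.≈ᴹ g x
    agree f-lin g-lin p x = N.≈ᴹ-trans (expand f-lin x)
      (N.≈ᴹ-trans (NF.lc-congʳ (λ j → τ (ι x j)) p) (N.≈ᴹ-sym (expand g-lin x)))

id-hom : ∀ {c ℓ} (S : CommutativeRing c ℓ) → IsRingHom S S (λ s → s)
id-hom S = record { cong = λ p → p ; +-hom = λ _ _ → refl ; *-hom = λ _ _ → refl ; 1-hom = refl }
  where open CommutativeRing S

-- A σ-linear Ψ : P → P whose values generate P has a bijective linearization S ⊗_σ P → P.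
module Linearization {c ℓ} {p : ℕ} .{{_ : ℕ.NonZero p}} {S : CommutativeRing c ℓ} (Fr : Frame p S)
    {P : Module S c ℓ} (fgp : FGProjective P)
    {Ψ : Module.Carrierᴹ P → Module.Carrierᴹ P} (Ψ-lin : IsSemilinear P P (Frame.σ Fr) Ψ)
    (gen : Generates P Ψ) where
  open CommutativeRing S hiding (zero)
  open Frame Fr
  open FrameFacts Fr
  open Module P
  open ModuleFacts P
  open FGP fgp
  open Matrices S
  private
    U = unit S
    module UF = ModuleFacts U
    module R = RingWithoutOne (matrixRing n)

    e∈span : ∀ i → InSpan P (λ j → Ψ (e j)) (e i)
    e∈span i = gen (span-submodule P (λ j → Ψ (e j))) (λ y → (λ j → σ (ι y j)) , expand Ψ-lin y) (e i)

    ε A B₀ : Mat n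
    ε k j = ι (e j) k
    A k j = ι (Ψ (e j)) k
    B₀ j i = proj₁ (e∈span i) j

    σε : Mat n
    σε = mapMat σ-hom ε

    e≈ : ∀ i → e i ≈ᴹ lc (λ j → B₀ j i) (λ j → Ψ (e j))
    e≈ i = proj₂ (e∈span i)

    coords : ∀ x k → dot (ε k) (ι x) ≈ ι x k
    coords x k = trans (UF.sum-cong {n} λ j → *-comm _ _) (trans (sym (ι-lc (ι x) e k)) (ι-cong (retract x) k))

    Aσε : ∀ k j → (A · σε) k j ≈ A k j
    Aσε k j = trans (UF.sum-cong {n} λ l → *-comm _ _)
      (trans (sym (ι-lc (λ l → σ (ι (e j) l)) (λ l → Ψ (e l)) k)) (ι-cong (≈ᴹ-sym (expand Ψ-lin (e j))) k))

    AB₀ : ∀ k i → (A · B₀) k i ≈ ε k i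
    AB₀ k i = trans (UF.sum-cong {n} λ j → *-comm _ _)
      (trans (sym (ι-lc (λ j → B₀ j i) (λ j → Ψ (e j)) k)) (ι-cong (≈ᴹ-sym (e≈ i)) k))

    εε : ∀ k j → (ε · ε) k j ≈ ε k j
    εε k j = coords (e j) k

    -- `B₀` records some expression of the generators through the `Ψ (e j)`. Compression by the
    -- idempotents on both sides turns it into a map from the image of `ε` to that of `σε`, and
    -- `A · B` is still `ε`.
    B : Mat n
    B = σε · (B₀ · ε)

    σεσε : ∀ k j → (σε · σε) k j ≈ σε k j
    σεσε k j = trans (sym (mapMat-· σ-hom ε ε k j)) (IsRingHom.cong σ-hom (εε k j))

    -- S ⊗_σ P is the image of `σε`, and its map to P is given by `A`; a relation between the
    -- `Ψ (e j)` therefore has to become zero under `σε`.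
    injective : ∀ r → lc r (λ j → Ψ (e j)) ≈ᴹ 0ᴹ → ∀ k → dot (σε k) r ≈ 0#
    injective r r∈ker = twist-injective ε A B εε (λ k j → coords (Ψ (e j)) k) Aσε
      (R.trans (R.sym (R.*-assoc σε σε (B₀ · ε))) (R.*-congʳ σεσε))
      (R.trans (R.*-assoc σε (B₀ · ε) ε) (R.*-congˡ (R.trans (R.*-assoc B₀ ε ε) (R.*-congˡ εε))))
      (R.trans (R.sym (R.*-assoc A σε (B₀ · ε))) (R.trans (R.*-congʳ Aσε)
        (R.trans (R.sym (R.*-assoc A B₀ ε)) (R.trans (R.*-congʳ AB₀) εε))))
      r (λ k → trans (UF.sum-cong {n} λ j → *-comm _ _)
          (trans (sym (ι-lc r (λ j → Ψ (e j)) k)) (trans (ι-cong r∈ker k) (ι-0 k))))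

  module _ {N : Module S c ℓ} {G : Carrierᴹ → Module.Carrierᴹ N} (G-lin : IsSemilinear P N σ G) where
    private
      module N = Module N
      module NF = ModuleFacts N

      -- Forced by `e≈`: a linear map carrying each `Ψ x` to `G x` can only take this value at
      -- `e i`.
      H : Fin n → N.Carrierᴹ
      H i = NF.lc (λ j → B₀ j i) (λ j → G (e j))

    linearize : Carrierᴹ → N.Carrierᴹ
    linearize = fromImages {N = N} {τ = λ s → s} H

    linearize-lin : IsLinear P N linearize
    linearize-lin = fromImages-lin (id-hom S) H

    -- At `e j` the two sides differ by the combination of the `G (e l)` with coefficients `d j`, a
    -- relation between the `Ψ (e l)`. Expanding each `G (e l)` once more multiplies `d j` by `σε`,
    -- and `injective` makes the result zero.
    linearize-Ψ : ∀ x → linearize (Ψ x) N.≈ᴹ G x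
    linearize-Ψ = agree Ψ̂-lin G-lin λ j → NF.sub≈0⇒≈ (begin
        linearize (Ψ (e j)) NF.-ᴹ G (e j)
          ≈⟨ NF.-ᴹ-cong₂ (lc-lc N (ι (Ψ (e j))) (λ i l → B₀ l i) (λ l → G (e l))) (expand G-lin (e j)) ⟩
        NF.lc (r j) (λ l → G (e l)) NF.-ᴹ NF.lc (λ l → σε l j) (λ l → G (e l))
          ≈⟨ N.≈ᴹ-sym (NF.lc-sub (r j) (λ l → σε l j) (λ l → G (e l))) ⟩
        NF.lc (d j) (λ l → G (e l))
          ≈⟨ NF.lc-congʳ (d j) (λ l → expand G-lin (e l)) ⟩
        NF.lc (d j) (λ l → NF.lc (λ m → σε m l) (λ m → G (e m)))
          ≈⟨ lc-lc N (d j) (λ l m → σε m l) (λ m → G (e m)) ⟩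
        NF.lc (λ m → sumM U (λ l → d j l * σε m l)) (λ m → G (e m))
          ≈⟨ NF.sum-0 {n} (λ m → N.≈ᴹ-trans (N.*ₗ-congʳ (trans (UF.sum-cong {n} λ l → *-comm _ _) (injective (d j) (d∈ker j) m))) (N.*ₗ-zeroˡ _)) ⟩
        N.0ᴹ ∎)
      where
      open SetoidReasoning N.≈ᴹ-setoid
      Ψ̂-lin : IsSemilinear P N σ (λ x → linearize (Ψ x))
      Ψ̂-lin = ∘-semilinear (λ q → q) Ψ-lin linearize-lin
      r d : Fin n → Fin n → Carrier
      r j l = sumM U (λ i → ι (Ψ (e j)) i * B₀ l i)
      d j l = r j l - σε l j
      d∈ker : ∀ j → lc (d j) (λ l → Ψ (e l)) ≈ᴹ 0ᴹ
      d∈ker j = ≈ᴹ-trans (lc-sub (r j) (λ l → σε l j) (λ l → Ψ (e l))) (≈⇒sub≈0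
        (≈ᴹ-trans (≈ᴹ-sym (lc-lc P (ι (Ψ (e j))) (λ i l → B₀ l i) (λ l → Ψ (e l))))
          (≈ᴹ-trans (lc-congʳ (ι (Ψ (e j))) (λ i → ≈ᴹ-sym (e≈ i)))
            (≈ᴹ-trans (retract (Ψ (e j))) (expand Ψ-lin (e j))))))

-- Windows and normal representations

module WindowFacts {c ℓ} {p : ℕ} {S : CommutativeRing c ℓ} {Fr : Frame p S} (W : Window Fr) where
  open CommutativeRing S using (Carrier; 0#; 1#; _+_; _*_)
  private
    module Fr = Frame Fr
  open Window W
  open ModuleFacts P
  open FGP fgp public using (ι-lin; ι-injective; ι-lc; ι-0; _·M; ·M-submodule; ·M-intro; ·M-lc; ·M-lin; expand; fromImages; fromImages-lin; agree)
  open FGProjective fgp public using (n; e; ι; ι-cong; ι-+; ι-*; retract)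
  open NormalDecomp decomp public
  private
    module L = IsSubmodule L-sub
    module T = IsSubmodule T-sub
    module Q = IsSubmodule Q-sub

  pL pT : Carrierᴹ → Carrierᴹ
  pL x = proj₁ (span x)
  pT x = proj₁ (proj₂ (span x))

  pL∈L : ∀ x → L (pL x)
  pL∈L x = proj₁ (proj₂ (proj₂ (span x)))

  pT∈T : ∀ x → T (pT x)
  pT∈T x = proj₁ (proj₂ (proj₂ (proj₂ (span x))))

  split : ∀ x → x ≈ᴹ pL x +ᴹ pT x
  split x = proj₂ (proj₂ (proj₂ (proj₂ (span x))))

  split-unique : ∀ {l l' t t'} → L l → L l' → T t → T t' → l +ᴹ t ≈ᴹ l' +ᴹ t' → l ≈ᴹ l' × t ≈ᴹ t'
  split-unique {l} {l'} {t} {t'} hl hl' ht ht' q = sub≈0⇒≈ l-l'≈0 , sub≈0⇒≈ (≈ᴹ-trans (≈ᴹ-sym (+ᴹ-identityˡ _)) (≈ᴹ-trans (+ᴹ-congʳ (≈ᴹ-sym l-l'≈0)) sum≈0))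
    where
    sum≈0 : (l -ᴹ l') +ᴹ (t -ᴹ t') ≈ᴹ 0ᴹ
    sum≈0 = ≈ᴹ-trans (≈ᴹ-sym (sub-+ l t l' t')) (≈⇒sub≈0 q)
    l-l'≈0 : l -ᴹ l' ≈ᴹ 0ᴹ
    l-l'≈0 = indep (sub∈ L-sub hl hl') (sub∈ T-sub ht ht') sum≈0

  p-unique : ∀ {x l t} → L l → T t → x ≈ᴹ l +ᴹ t → pL x ≈ᴹ l × pT x ≈ᴹ t
  p-unique {x} hl ht q = split-unique (pL∈L x) hl (pT∈T x) ht (≈ᴹ-trans (≈ᴹ-sym (split x)) q)

  private
    p-cong : ∀ {x y} → x ≈ᴹ y → pL x ≈ᴹ pL y × pT x ≈ᴹ pT y
    p-cong {x} {y} q = p-unique (pL∈L y) (pT∈T y) (≈ᴹ-trans q (split y))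

    p-+ : ∀ x y → pL (x +ᴹ y) ≈ᴹ pL x +ᴹ pL y × pT (x +ᴹ y) ≈ᴹ pT x +ᴹ pT y
    p-+ x y = p-unique (L.+∈ (pL∈L x) (pL∈L y)) (T.+∈ (pT∈T x) (pT∈T y)) (≈ᴹ-trans (+ᴹ-cong (split x) (split y))
      (+-interchange (pL x) (pT x) (pL y) (pT y)))

    p-* : ∀ s x → pL (s *ₗ x) ≈ᴹ s *ₗ pL x × pT (s *ₗ x) ≈ᴹ s *ₗ pT x
    p-* s x = p-unique (L.*∈ s (pL∈L x)) (T.*∈ s (pT∈T x)) (≈ᴹ-trans (*ₗ-congˡ (split x)) (*ₗ-distribˡ s _ _))

  pL-lin : IsLinear P P pL
  pL-lin = record { cong = λ q → proj₁ (p-cong q) ; +-hom = λ x y → proj₁ (p-+ x y) ; *-hom = λ s x → proj₁ (p-* s x) }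

  pT-lin : IsLinear P P pT
  pT-lin = record { cong = λ q → proj₂ (p-cong q) ; +-hom = λ x y → proj₂ (p-+ x y) ; *-hom = λ s x → proj₂ (p-* s x) }

  private
    module pL = IsSemilinear pL-lin
    module pT = IsSemilinear pT-lin

  pL-L : ∀ {l} → L l → pL l ≈ᴹ l
  pL-L hl = proj₁ (p-unique hl T.0∈ (≈ᴹ-sym (+ᴹ-identityʳ _)))

  pT-L : ∀ {l} → L l → pT l ≈ᴹ 0ᴹ
  pT-L hl = proj₂ (p-unique hl T.0∈ (≈ᴹ-sym (+ᴹ-identityʳ _)))

  pL-T : ∀ {t} → T t → pL t ≈ᴹ 0ᴹ
  pL-T ht = proj₁ (p-unique L.0∈ ht (≈ᴹ-sym (+ᴹ-identityˡ _)))

  pT-T : ∀ {t} → T t → pT t ≈ᴹ t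
  pT-T ht = proj₂ (p-unique L.0∈ ht (≈ᴹ-sym (+ᴹ-identityˡ _)))

  L⊆Q : ∀ {l} → L l → Q l
  L⊆Q {l} hl = proj₂ (Q-eq l) (l , 0ᴹ , hl , ≈ᴹ-sym (+ᴹ-identityʳ l) , 0 , (λ ()) , (λ ()) , (λ ()) , (λ ()) , ≈ᴹ-refl)

  record QDecomp (x : Carrierᴹ) : Set (c ⊔ ℓ) where
    field
      m   : ℕ
      a   : Fin m → Carrier
      t   : Fin m → Carrierᴹ
      a∈I : ∀ k → Fr.I (a k)
      t∈T : ∀ k → T (t k)
      pT≈ : pT x ≈ᴹ lc a t

  Q-decomp : ∀ {x} → Q x → QDecomp x
  Q-decomp {x} hx with proj₁ (Q-eq x) hx
  ... | l , u , hl , x≈ , m , a , t , ha , ht , u≈ = record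
    { m = m ; a = a ; t = t ; a∈I = ha ; t∈T = ht
    ; pT≈ = proj₂ (p-unique hl (sum∈ T-sub λ k → T.*∈ (a k) (ht k)) (≈ᴹ-trans x≈ (+ᴹ-congˡ u≈))) }

  -- With the converse below, `Q` is the preimage of IP under the projection to `T`: a condition on
  -- coordinates, free of existential witnesses.
  Q⇒pT∈IP : ∀ {x} → Q x → (Fr.I ·M) (pT x)
  Q⇒pT∈IP hx = IsSubmodule.resp (·M-submodule Fr.I-ideal) (≈ᴹ-sym pT≈) (·M-lc Fr.I-ideal t a∈I)
    where open QDecomp (Q-decomp hx)

  pT∈IP⇒Q : ∀ {x} → (Fr.I ·M) (pT x) → Q x
  -- The vectors are `pT (e j)` instead of `e j` so that they lie in `T`. Since `pT` fixes `pT x`,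
  -- applying it to the expansion of `pT x` keeps the coefficients.
  pT∈IP⇒Q {x} h = proj₂ (Q-eq x) (pL x , pT x , pL∈L x , split x , n , ι (pT x) , (λ j → pT (e j)) , h , (λ j → pT∈T (e j)) ,
    ≈ᴹ-trans (≈ᴹ-sym (pT-T (pT∈T x))) (expand pT-lin (pT x)))

  IP⊆Q : ∀ {x} → (Fr.I ·M) x → Q x
  IP⊆Q h = pT∈IP⇒Q (·M-lin Fr.I-ideal pT-lin h)

  I*⊆Q : ∀ {a} → Fr.I a → ∀ x → Q (a *ₗ x)
  I*⊆Q ha x = IP⊆Q (·M-intro Fr.I-ideal x ha)

  F₁-sum : ∀ {m} (x : Fin m → Carrierᴹ) (hx : ∀ k → Q (x k)) (h : Q (sumM P x)) → F₁ (sumM P x) h ≈ᴹ sumM P (λ k → F₁ (x k) (hx k))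
  F₁-sum {zero} x hx h = ≈ᴹ-trans (F₁-cong h (Q.*∈ 0# Q.0∈) (≈ᴹ-sym (*ₗ-zeroˡ 0ᴹ))) (≈ᴹ-trans (F₁-* 0# Q.0∈ _)
    (≈ᴹ-trans (*ₗ-congʳ (FrameFacts.σ-0 Fr)) (*ₗ-zeroˡ _)))
  F₁-sum {suc m} x hx h = ≈ᴹ-trans (F₁-+ (hx fzero) tail h) (+ᴹ-congˡ (F₁-sum (λ k → x (fsuc k)) (λ k → hx (fsuc k)) tail))
    where
    tail : Q (sumM P (λ k → x (fsuc k)))
    tail = sum∈ Q-sub λ k → hx (fsuc k)

  F₁-lc : ∀ {m} (a : Fin m → Carrier) (ha : ∀ k → Fr.I (a k)) (x : Fin m → Carrierᴹ) (h : Q (lc a x)) →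
    F₁ (lc a x) h ≈ᴹ sumM P (λ k → Fr.σ₁ (a k) (ha k) *ₗ F (x k))
  F₁-lc {m} a ha x h = ≈ᴹ-trans (F₁-sum (λ k → a k *ₗ x k) (λ k → I*⊆Q (ha k) (x k)) h)
    (sum-cong {m} λ k → F₁-σ₁ (ha k) (x k) (I*⊆Q (ha k) (x k)))

  Ψ : Carrierᴹ → Carrierᴹ
  Ψ x = F₁ (pL x) (L⊆Q (pL∈L x)) +ᴹ F (pT x)

  Ψ-lin : IsSemilinear P P Fr.σ Ψ
  Ψ-lin = record
    { cong = λ q → +ᴹ-cong (F₁-cong _ _ (pL.cong q)) (F.cong (pT.cong q))
    ; +-hom = λ x y → ≈ᴹ-trans (+ᴹ-cong
        (≈ᴹ-trans (F₁-cong _ (Q.+∈ (L⊆Q (pL∈L x)) (L⊆Q (pL∈L y))) (pL.+-hom x y)) (F₁-+ _ _ _))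
        (≈ᴹ-trans (F.cong (pT.+-hom x y)) (F.+-hom _ _)))
        (+-interchange _ _ _ _)
    ; *-hom = λ s x → ≈ᴹ-trans (+ᴹ-cong
        (≈ᴹ-trans (F₁-cong _ (Q.*∈ s (L⊆Q (pL∈L x))) (pL.*-hom s x)) (F₁-* s _ _))
        (≈ᴹ-trans (F.cong (pT.*-hom s x)) (F.*-hom s _)))
        (≈ᴹ-sym (*ₗ-distribˡ _ _ _)) }
    where module F = IsSemilinear F-lin

  private
    module F = IsSemilinear F-lin

  Ψ-L : ∀ {l} (hl : L l) → Ψ l ≈ᴹ F₁ l (L⊆Q hl)
  Ψ-L hl = ≈ᴹ-trans (+ᴹ-cong (F₁-cong _ _ (pL-L hl)) (≈ᴹ-trans (F.cong (pT-L hl)) (SemilinearFacts.map-0 F-lin))) (+ᴹ-identityʳ _)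

  Ψ-T : ∀ {t} → T t → Ψ t ≈ᴹ F t
  Ψ-T ht = ≈ᴹ-trans (+ᴹ-cong (≈ᴹ-trans (F₁-cong _ Q.0∈ (pL-T ht)) (F₁-sum {zero} (λ ()) (λ ()) Q.0∈)) (F.cong (pT-T ht))) (+ᴹ-identityˡ _)

  -- `Ψ` determines `F₁`, because on IT the rule F₁(a t) = σ₁(a) F(t) refers only to `F` on `T`.
  -- Hence a submodule containing the values of `Ψ` contains those of `F₁`.
  F₁-Ψ : ∀ {x} (hx : Q x) → let open QDecomp (Q-decomp hx) in
    F₁ x hx ≈ᴹ Ψ (pL x) +ᴹ sumM P (λ k → Fr.σ₁ (a k) (a∈I k) *ₗ Ψ (t k))
  F₁-Ψ {x} hx = ≈ᴹ-trans (F₁-cong hx (Q.+∈ (L⊆Q (pL∈L x)) u∈Q) (≈ᴹ-trans (split x) (+ᴹ-congˡ pT≈)))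
    (≈ᴹ-trans (F₁-+ _ _ _) (+ᴹ-cong (≈ᴹ-sym (Ψ-L (pL∈L x)))
      (≈ᴹ-trans (F₁-lc a a∈I t u∈Q) (sum-cong {m} λ k → *ₗ-congˡ (≈ᴹ-sym (Ψ-T (t∈T k)))))))
    where
    open QDecomp (Q-decomp hx)
    u∈Q : Q (lc a t)
    u∈Q = sum∈ Q-sub λ k → I*⊆Q (a∈I k) (t k)

  Ψ-generates : Generates P Ψ
  Ψ-generates N-sub hΨ x with F₁-gen x
  ... | m , s , y , hy , x≈ = N.resp (≈ᴹ-sym x≈) (sum∈ N-sub λ k → N.*∈ (s k) (N.resp (≈ᴹ-sym (F₁-Ψ (hy k)))
      (N.+∈ (hΨ _) (sum∈ N-sub {QDecomp.m (Q-decomp (hy k))} λ j → N.*∈ _ (hΨ _)))))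
    where module N = IsSubmodule N-sub

-- Base change

id-SemiHom : ∀ {c ℓ} {p : ℕ} {S : CommutativeRing c ℓ} {Fr : Frame p S} (W : Window Fr) → Hom W W
id-SemiHom W = record
  { g = λ x → x
  ; g-lin = id-linear P
  ; Q-pres = λ q → q ; F-comm = λ _ → ≈ᴹ-refl ; F₁-comm = λ _ → ≈ᴹ-refl }
  where open Window W

∘-Hom : ∀ {c ℓ} {p : ℕ} {S : CommutativeRing c ℓ} {Fr : Frame p S} {W W' W'' : Window Fr} →
  Hom W' W'' → Hom W W' → Hom W W''
∘-Hom {W'' = W''} h k = record
  { g = λ x → h.g (k.g x)
  ; g-lin = ∘-semilinear (λ q → q) k.g-lin h.g-lin
  ; Q-pres = λ q → h.Q-pres (k.Q-pres q)
  ; F-comm = λ x → ≈ᴹ-trans (h.F-comm _) (IsSemilinear.cong h.g-lin (k.F-comm x))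
  ; F₁-comm = λ hx → ≈ᴹ-trans (h.F₁-comm _) (IsSemilinear.cong h.g-lin (k.F₁-comm hx)) }
  where
  module h = SemiHom h
  module k = SemiHom k
  open Window W''

module Reduction {c ℓ} {p : ℕ} {S S' : CommutativeRing c ℓ} {Fr : Frame p S} {Fr' : Frame p S'} (φ : StrictHom Fr Fr')
    (I-refl : ∀ s → Frame.I Fr' (StrictHom.α φ s) → Frame.I Fr s)
    (surj : ∀ s' → ∃ λ s → CommutativeRing._≈_ S' (StrictHom.α φ s) s')
    (K : Pred (CommutativeRing.Carrier S) (c ⊔ ℓ)) (K-ideal : IsIdeal S K)
    (K⇔ker : ∀ x → K x ⇔ₚ CommutativeRing._≈_ S' (StrictHom.α φ x) (CommutativeRing.0# S')) where
  open StrictHom φ public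
  private
    module S = CommutativeRing S
    module S' = CommutativeRing S'
    module Fr = Frame Fr
    module Fr' = Frame Fr'
    module I' = IsIdeal Fr'.I-ideal
    module αH = IsRingHom α-hom

  K⇒0 : ∀ {a} → K a → α a S'.≈ S'.0#
  K⇒0 {a} = proj₁ (K⇔ker a)

  0⇒K : ∀ {a} → α a S'.≈ S'.0# → K a
  0⇒K {a} = proj₂ (K⇔ker a)

  lift : S'.Carrier → S.Carrier
  lift s' = proj₁ (surj s')

  α-lift : ∀ s' → α (lift s') S'.≈ s'
  α-lift s' = proj₂ (surj s')

  lift-I : ∀ {a'} → Fr'.I a' → Fr.I (lift a')
  lift-I {a'} h = I-refl _ (I'.resp (S'.sym (α-lift a')) h)

  K⊆I : ∀ {a} → K a → Fr.I a
  K⊆I {a} h = I-refl a (I'.resp (S'.sym (K⇒0 h)) I'.0∈)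

  K-σ : ∀ {a} → K a → K (Fr.σ a)
  K-σ {a} h = 0⇒K (S'.trans (S'.sym (σ-comm a)) (S'.trans (IsRingHom.cong Fr'.σ-hom (K⇒0 h)) (FrameFacts.σ-0 Fr')))

  K-σ₁ : ∀ {a} (h : Fr.I a) → K a → K (Fr.σ₁ a h)
  K-σ₁ {a} h ha = 0⇒K (S'.trans (S'.sym (σ₁-comm h)) (FrameFacts.σ₁-0 Fr' _ (K⇒0 ha)))

  module _ {P : Module S c ℓ} (fgp : FGProjective P) where
    open FGP fgp
    K-kills : ∀ {P' : Module S' c ℓ} {f} → IsSemilinear P P' α f → ∀ {x} → (K ·M) x → Module._≈ᴹ_ P' (f x) (Module.0ᴹ P')
    K-kills {P'} f-lin {x} h = P'.≈ᴹ-trans (expand f-lin x) (ModuleFacts.sum-0 P' {n} λ j →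
      P'.≈ᴹ-trans (P'.*ₗ-congʳ (K⇒0 (h j))) (P'.*ₗ-zeroˡ _))
      where module P' = Module P'

    K-σ-lin : ∀ {P₂ : Module S c ℓ} (fgp₂ : FGProjective P₂) {f} → IsSemilinear P P₂ Fr.σ f → ∀ {x} → (K ·M) x → FGP._·M fgp₂ K (f x)
    K-σ-lin {P₂} fgp₂ {f} f-lin {x} h = IsSubmodule.resp (FGP.·M-submodule fgp₂ K-ideal) (Module.≈ᴹ-sym P₂ (expand f-lin x))
      (FGP.·M-lc fgp₂ K-ideal (λ j → f (e j)) λ j → K-σ (h j))

  module _ {W : Window Fr} {W' : Window Fr'} (u : SemiHom α W W') where
    private
      module W = Window W
      module W' = Window W'
      module u = SemiHom u

    -- The elementwise form of a base change along a surjection: P' is P / K P, and `Q` is the full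
    -- preimage of Q'. In contrast to `IsBaseChange` it does not quantify over windows; the two
    -- notions are shown to imply each other.
    record IsReduction : Set (c ⊔ ℓ) where
      field
        surjective : ∀ y → ∃ λ x → u.g x W'.≈ᴹ y
        kernel     : ∀ x → u.g x W'.≈ᴹ W'.0ᴹ → FGP._·M W.fgp K x
        Q-reflect  : ∀ x → W'.Q (u.g x) → W.Q x

    module _ (good : IsReduction) where
      open IsReduction good

      -- An α-linear map kills K P and so is constant on the fibres of `u`. The factorization is
      -- evaluated at chosen preimages, and `Q-reflect` puts preimages of elements of Q' into `Q`.
      reduction⇒baseChange : IsBaseChange φ u
      reduction⇒baseChange W'' = unique , extend
        where
        module W'' = Window W''
        module W''F = ModuleFacts W''.P

        unique : (h₁ h₂ : Hom W' W'') → (∀ x → g h₁ (u.g x) W''.≈ᴹ g h₂ (u.g x)) → ∀ y → g h₁ y W''.≈ᴹ g h₂ y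
        unique h₁ h₂ q y with surjective y
        ... | x , ux≈y = W''.≈ᴹ-trans (IsSemilinear.cong (SemiHom.g-lin h₁) (W'.≈ᴹ-sym ux≈y))
          (W''.≈ᴹ-trans (q x) (IsSemilinear.cong (SemiHom.g-lin h₂) ux≈y))

        extend : (k : SemiHom α W W'') → ∃ λ (h : Hom W' W'') → ∀ x → g h (u.g x) W''.≈ᴹ g k x
        extend k = hom , λ x → value W'.≈ᴹ-refl
          where
          module k = SemiHom k
          module kl = IsSemilinear k.g-lin
          module ul = IsSemilinear u.g-lin
          pre : W'.Carrierᴹ → W.Carrierᴹ
          pre y = proj₁ (surjective y)
          u-pre : ∀ y → u.g (pre y) W'.≈ᴹ y
          u-pre y = proj₂ (surjective y)
          descends : ∀ {x y} → u.g x W'.≈ᴹ u.g y → k.g x W''.≈ᴹ k.g y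
          descends {x} {y} q = W''F.sub≈0⇒≈ (W''.≈ᴹ-trans (W''.≈ᴹ-sym (SemilinearFacts.map-sub k.g-lin x y))
            (K-kills W.fgp k.g-lin (kernel _ (W'.≈ᴹ-trans (SemilinearFacts.map-sub u.g-lin x y) (ModuleFacts.≈⇒sub≈0 W'.P q)))))
          h : W'.Carrierᴹ → W''.Carrierᴹ
          h y = k.g (pre y)
          value : ∀ {x y} → u.g x W'.≈ᴹ y → h y W''.≈ᴹ k.g x
          value {x} {y} q = descends (W'.≈ᴹ-trans (u-pre y) (W'.≈ᴹ-sym q))
          hQ : ∀ {y} → W'.Q y → W''.Q (h y)
          hQ {y} hy = k.Q-pres (Q-reflect _ (IsSubmodule.resp W'.Q-sub (W'.≈ᴹ-sym (u-pre y)) hy))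
          hom : Hom W' W''
          hom = record
            { g = h
            ; g-lin = record
              { cong = λ {x} {y} q → value (W'.≈ᴹ-trans (u-pre y) (W'.≈ᴹ-sym q))
              ; +-hom = λ x y → W''.≈ᴹ-trans (value (W'.≈ᴹ-trans (ul.+-hom _ _) (W'.+ᴹ-cong (u-pre x) (u-pre y)))) (kl.+-hom _ _)
              ; *-hom = λ s x → W''.≈ᴹ-trans (value (W'.≈ᴹ-trans (ul.*-hom (lift s) _) (W'.*ₗ-cong (α-lift s) (u-pre x))))
                  (W''.≈ᴹ-trans (kl.*-hom (lift s) _) (W''.*ₗ-congʳ (α-lift s))) }
            ; Q-pres = hQ
            ; F-comm = λ y → W''.≈ᴹ-trans (k.F-comm (pre y)) (W''.≈ᴹ-sym (value (W'.≈ᴹ-trans (W'.≈ᴹ-sym (u.F-comm (pre y)))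
                (IsSemilinear.cong W'.F-lin (u-pre y)))))
            ; F₁-comm = λ {y} hy → let hx = Q-reflect _ (IsSubmodule.resp W'.Q-sub (W'.≈ᴹ-sym (u-pre y)) hy) in
                W''.≈ᴹ-trans (k.F₁-comm hx)
                (W''.≈ᴹ-sym (value (W'.≈ᴹ-trans (W'.≈ᴹ-sym (u.F₁-comm hx)) (W'.F₁-cong _ hy (u-pre y)))))
            }

  -- The base change is P / K P : the carrier of P with a coarser equality.
  module Quotient (W : Window Fr) where
    open Window W
    open WindowFacts W
    open ModuleFacts P using (add-sub; _-ᴹ_; sub∈)

    private
      module Q = IsSubmodule Q-sub

    χ : Carrierᴹ → Fin n → S'.Carrier
    χ x k = α (ι x k)

    χ-lin : ∀ k → IsSemilinear P (unit S') α (λ x → χ x k)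
    χ-lin k = ∘-semilinear αH.cong (ι-lin k) (ringMap-semilinear α-hom)

    infix 4 _~_
    -- Congruence modulo K P, tested on the coordinates in S'. Membership of the difference in
    -- `K ·M` is the same condition at a level too high for the equality of a module.
    _~_ : Carrierᴹ → Carrierᴹ → Set ℓ
    x ~ y = ∀ k → χ x k S'.≈ χ y k

    ~-refl : ∀ {x} → x ~ x
    ~-refl k = S'.refl

    ~-sym : ∀ {x y} → x ~ y → y ~ x
    ~-sym q k = S'.sym (q k)

    ~-trans : ∀ {x y z} → x ~ y → y ~ z → x ~ z
    ~-trans q r k = S'.trans (q k) (r k)

    ≈⇒~ : ∀ {x y} → x ≈ᴹ y → x ~ y
    ≈⇒~ q k = IsSemilinear.cong (χ-lin k) q

    ~⇒K : ∀ {x y} → x ~ y → (K ·M) (x -ᴹ y)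
    ~⇒K {x} {y} q k = 0⇒K (S'.trans (SemilinearFacts.map-sub (χ-lin k) x y) (ModuleFacts.≈⇒sub≈0 (unit S') (q k)))

    K⇒~ : ∀ {x y} → (K ·M) (x -ᴹ y) → x ~ y
    K⇒~ {x} {y} h k = ModuleFacts.sub≈0⇒≈ (unit S') (S'.trans (S'.sym (SemilinearFacts.map-sub (χ-lin k) x y)) (K⇒0 (h k)))

    χ-+ : ∀ x y k → χ (x +ᴹ y) k S'.≈ χ x k S'.+ χ y k
    χ-+ x y k = IsSemilinear.+-hom (χ-lin k) x y

    χ-neg : ∀ x k → χ (-ᴹ x) k S'.≈ S'.- χ x k
    χ-neg x k = SemilinearFacts.map-neg (χ-lin k) x

    _*'_ : S'.Carrier → Carrierᴹ → Carrierᴹ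
    s' *' x = lift s' *ₗ x

    χ-* : ∀ s' x k → χ (s' *' x) k S'.≈ s' S'.* χ x k
    χ-* s' x k = S'.trans (IsSemilinear.*-hom (χ-lin k) _ x) (S'.*-congʳ (α-lift s'))

    P₀ : Module S' c ℓ
    P₀ = mkModule Carrierᴹ _~_ _+ᴹ_ 0ᴹ -ᴹ_ _*'_
      (record
        { isGroup = record
          { isMonoid = record
            { isSemigroup = record
              { isMagma = record
                { isEquivalence = record { refl = ~-refl ; sym = ~-sym ; trans = ~-trans }
                ; ∙-cong = λ q r k → S'.trans (χ-+ _ _ k) (S'.trans (S'.+-cong (q k) (r k)) (S'.sym (χ-+ _ _ k))) }
              ; assoc = λ x y z → ≈⇒~ (+ᴹ-assoc x y z) }
            ; identity = (λ x → ≈⇒~ (+ᴹ-identityˡ x)) , (λ x → ≈⇒~ (+ᴹ-identityʳ x)) }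
          ; inverse = (λ x → ≈⇒~ (-ᴹ‿inverseˡ x)) , (λ x → ≈⇒~ (-ᴹ‿inverseʳ x))
          ; ⁻¹-cong = λ q k → S'.trans (χ-neg _ k) (S'.trans (S'.-‿cong (q k)) (S'.sym (χ-neg _ k))) }
        ; comm = λ x y → ≈⇒~ (+ᴹ-comm x y) })
      (λ q r k → S'.trans (χ-* _ _ k) (S'.trans (S'.*-cong q (r k)) (S'.sym (χ-* _ _ k))))
      (λ s x y → ≈⇒~ (*ₗ-distribˡ (lift s) x y))
      (λ x s t k → S'.trans (χ-* _ _ k) (S'.trans (S'.distribʳ _ s t) (S'.sym
        (S'.trans (χ-+ _ _ k) (S'.+-cong (χ-* s x k) (χ-* t x k))))))
      (λ s t x k → S'.trans (χ-* _ _ k) (S'.trans (S'.*-assoc s t _) (S'.sym (S'.trans (χ-* s _ k) (S'.*-congˡ (χ-* t x k))))))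
      (λ x k → S'.trans (χ-* _ _ k) (S'.*-identityˡ _))

    id-lin : IsSemilinear P P₀ α (λ x → x)
    id-lin = record { cong = ≈⇒~ ; +-hom = λ _ _ → ~-refl
      ; *-hom = λ s x k → S'.trans (IsSemilinear.*-hom (χ-lin k) s x) (S'.sym (χ-* _ x k)) }

    K⊆Q : ∀ {x} → (K ·M) x → Q x
    K⊆Q h = IP⊆Q λ k → K⊆I (h k)

    Q-resp : ∀ {x y} → x ~ y → Q x → Q y
    Q-resp {x} {y} q hx = Q.resp (add-sub y x) (Q.+∈ hx (K⊆Q (~⇒K (~-sym q))))

    Q₀-sub : IsSubmodule P₀ Q
    Q₀-sub = record { resp = Q-resp ; 0∈ = Q.0∈ ; +∈ = Q.+∈ ; *∈ = λ s → Q.*∈ (lift s) }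

    -- Represents the image in P / K P of a submodule of P, which by itself need not respect the
    -- coarser equality.
    saturate : Pred Carrierᴹ (c ⊔ ℓ) → Pred Carrierᴹ (c ⊔ ℓ)
    saturate N x = ∃ λ y → N y × x ~ y

    saturate-sub : ∀ {N} → IsSubmodule P N → IsSubmodule P₀ (saturate N)
    saturate-sub N-sub = record
      { resp = λ q (y , hy , r) → y , hy , ~-trans (~-sym q) r
      ; 0∈ = _ , N.0∈ , ~-refl
      ; +∈ = λ (y , hy , q) (z , hz , r) → _ , N.+∈ hy hz , Module.+ᴹ-cong P₀ q r
      ; *∈ = λ s (y , hy , q) → _ , N.*∈ (lift s) hy , Module.*ₗ-congˡ P₀ q }
      where module N = IsSubmodule N-sub

    K-0 : ∀ {x} → x ~ 0ᴹ → (K ·M) x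
    K-0 q k = 0⇒K (S'.trans (q k) (SemilinearFacts.map-0 (χ-lin k)))

    0-K : ∀ {x} → (K ·M) x → x ~ 0ᴹ
    0-K h k = S'.trans (K⇒0 (h k)) (S'.sym (SemilinearFacts.map-0 (χ-lin k)))

    decomp₀ : NormalDecomp Fr' P₀ Q
    decomp₀ = record
      { L = saturate L ; T = saturate T
      ; L-sub = saturate-sub L-sub ; T-sub = saturate-sub T-sub
      ; span = λ x → pL x , pT x , (_ , pL∈L x , ~-refl) , (_ , pT∈T x , ~-refl) , ≈⇒~ (split x)
      ; indep = λ { (l , hl , q) (t , ht , r) e → ~-trans q (0-K (IsSubmodule.resp (·M-submodule K-ideal)
          (proj₁ (p-unique hl ht ≈ᴹ-refl)) (·M-lin K-ideal pL-lin
            (K-0 (~-trans (Module.+ᴹ-cong P₀ (~-sym q) (~-sym r)) e))))) }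
      ; Q-eq = λ x → (λ hx → let open QDecomp (Q-decomp hx) in
            pL x , pT x , (_ , pL∈L x , ~-refl) , ≈⇒~ (split x) , m , (λ k → α (a k)) , t , (λ k → I-pres (a∈I k)) , (λ k → _ , t∈T k , ~-refl) ,
            ~-trans (≈⇒~ pT≈) (SemilinearFacts.map-lin id-lin a t))
        , λ { (l , v , (l₁ , hl , q) , x~ , m , a , t , ha , ht , v~) → Q-resp (~-sym x~)
            (Q.+∈ (Q-resp (~-sym q) (L⊆Q hl)) (Q-resp (~-sym v~) (ModuleFacts.sum∈ P₀ Q₀-sub {m} λ k → I*⊆Q (lift-I (ha k)) (t k)))) } }

    -- On K P, which lies in IP, `F₁` acts on coordinates through σ₁, and σ₁ preserves `K`. This is
    -- what lets `F₁` descend to the quotient.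
    K-F₁ : ∀ {x} (h : Q x) → (K ·M) x → (K ·M) (F₁ x h)
    K-F₁ {x} h hx = IsSubmodule.resp (·M-submodule K-ideal) (≈ᴹ-trans (≈ᴹ-sym (F₁-lc (ι x) (λ k → K⊆I (hx k)) e h')) (F₁-cong h' h (retract x)))
      (·M-lc K-ideal _ λ k → K-σ₁ (K⊆I (hx k)) (hx k))
      where
      h' : Q (ModuleFacts.lc P (ι x) e)
      h' = Q.resp (≈ᴹ-sym (retract x)) h

    ~-cong-of : ∀ {τ f} → IsSemilinear P P τ f → (∀ {x} → (K ·M) x → (K ·M) (f x)) → ∀ {x y} → x ~ y → f x ~ f y
    ~-cong-of f-lin hf {x} {y} q = K⇒~ (IsSubmodule.resp (·M-submodule K-ideal) (SemilinearFacts.map-sub f-lin x y) (hf (~⇒K q)))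

    *'-α : ∀ s x → s *ₗ x ~ α s *' x
    *'-α s x = IsSemilinear.*-hom id-lin s x

    W₀ : Window Fr'
    W₀ = record { P = P₀ ; str = record
      { fgp = record
        { n = n ; e = e ; ι = χ ; ι-cong = λ q → q ; ι-+ = χ-+ ; ι-* = χ-*
        ; retract = λ x → ~-trans (~-sym (SemilinearFacts.map-lin id-lin (ι x) e)) (≈⇒~ (retract x)) }
      ; Q = Q
      ; Q-sub = Q₀-sub
      ; decomp = decomp₀
      ; F = F
      ; F-lin = record
        { cong = ~-cong-of F-lin (K-σ-lin fgp fgp F-lin)
        ; +-hom = λ x y → ≈⇒~ (IsSemilinear.+-hom F-lin x y)
        ; *-hom = λ s x → ~-trans (≈⇒~ (IsSemilinear.*-hom F-lin (lift s) x)) (~-trans (*'-α _ _) (Module.*ₗ-congʳ P₀ (lift-σ s))) }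
      ; F₁ = F₁
      ; F₁-cong = λ {x} {y} hx hy q → K⇒~ (IsSubmodule.resp (·M-submodule K-ideal)
          (≈ᴹ-sym (ModuleFacts.move-sub P (≈ᴹ-trans (F₁-cong hx (Q.+∈ (sub∈ Q-sub hx hy) hy) (≈ᴹ-sym (≈ᴹ-trans (+ᴹ-comm _ _) (add-sub x y)))) (F₁-+ (sub∈ Q-sub hx hy) hy _))))
          (K-F₁ (sub∈ Q-sub hx hy) (~⇒K q)))
      ; F₁-+ = λ hx hy hxy → ≈⇒~ (F₁-+ hx hy hxy)
      ; F₁-* = λ s hx hsx → ~-trans (≈⇒~ (F₁-* (lift s) hx hsx)) (~-trans (*'-α _ _) (Module.*ₗ-congʳ P₀ (lift-σ s)))
      ; F₁-σ₁ = λ {a} ha x hax → ~-trans (≈⇒~ (F₁-σ₁ (lift-I ha) x hax)) (~-trans (*'-α _ _) (Module.*ₗ-congʳ P₀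
          (S'.trans (S'.sym (σ₁-comm (lift-I ha))) (Fr'.σ₁-cong _ ha (α-lift a)))))
      ; F₁-gen = λ x → gen₀ x (F₁-gen x) } }
      where
      lift-σ : ∀ s → α (Fr.σ (lift s)) S'.≈ Fr'.σ s
      lift-σ s = S'.trans (S'.sym (σ-comm (lift s))) (IsRingHom.cong Fr'.σ-hom (α-lift s))
      gen₀ : ∀ x → (∃ λ n → Σ (Fin n → S.Carrier) λ s → Σ (Fin n → Carrierᴹ) λ y →
                Σ (∀ k → Q (y k)) λ hy → x ≈ᴹ sumM P (λ k → s k *ₗ F₁ (y k) (hy k))) →
             ∃ λ n → Σ (Fin n → S'.Carrier) λ s → Σ (Fin n → Carrierᴹ) λ y →
                Σ (∀ k → Q (y k)) λ hy → x ~ sumM P₀ (λ k → s k *' F₁ (y k) (hy k))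
      gen₀ x (m , s , y , hy , q) = m , (λ k → α (s k)) , y , hy , ~-trans (≈⇒~ q) (SemilinearFacts.map-lin id-lin s (λ k → F₁ (y k) (hy k)))

    u₀ : SemiHom α W W₀
    u₀ = record { g = λ x → x ; g-lin = id-lin ; Q-pres = λ h → h ; F-comm = λ x → ~-refl ; F₁-comm = λ _ → ~-refl }

    u₀-reduction : IsReduction u₀
    u₀-reduction = record { surjective = λ y → y , ~-refl ; kernel = λ x → K-0 ; Q-reflect = λ x h → h }

  module _ {W : Window Fr} {W' : Window Fr'} (u : SemiHom α W W') (bc : IsBaseChange φ u) where
    private
      open Quotient W using (W₀; u₀; u₀-reduction; K-0; Q-resp)
      module W' = Window W'
      h' : Hom W' W₀
      h' = proj₁ (proj₂ (bc W₀) u₀)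
      h'u : ∀ x → Window._≈ᴹ_ W₀ (g h' (g u x)) x
      h'u = proj₂ (proj₂ (bc W₀) u₀)
      h : Hom W₀ W'
      h = proj₁ (proj₂ (reduction⇒baseChange u₀ u₀-reduction W') u)
      hu₀ : ∀ x → g h x W'.≈ᴹ g u x
      hu₀ = proj₂ (proj₂ (reduction⇒baseChange u₀ u₀-reduction W') u)
      hh' : ∀ y → g h (g h' y) W'.≈ᴹ y
      hh' = proj₁ (bc W') (∘-Hom h h') (id-SemiHom W') λ x →
        W'.≈ᴹ-trans (IsSemilinear.cong (SemiHom.g-lin h) (h'u x)) (hu₀ x)

    -- The universal properties of `u` and of the quotient map `u₀` identify W' with `W₀` compatibly
    -- with the maps from W, and the three properties are carried over from the quotient.
    baseChange⇒reduction : IsReduction u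
    baseChange⇒reduction = record
      { surjective = λ y → g h' y , W'.≈ᴹ-trans (W'.≈ᴹ-sym (hu₀ _)) (hh' y)
      ; kernel = λ x q → K-0 (λ k → S'.trans (S'.sym (h'u x k)) (S'.trans (IsSemilinear.cong (SemiHom.g-lin h') q k)
          (SemilinearFacts.map-0 (SemiHom.g-lin h') k)))
      ; Q-reflect = λ x hx → Q-resp (h'u x) (SemiHom.Q-pres h' hx) }

-- Full faithfulness

module _ {c ℓ} {S S' : CommutativeRing c ℓ} {M : Module S c ℓ} {N : Module S' c ℓ}
         {τ : CommutativeRing.Carrier S → CommutativeRing.Carrier S'}
         {f g : Module.Carrierᴹ M → Module.Carrierᴹ N} (f-lin : IsSemilinear M N τ f) (g-lin : IsSemilinear M N τ g) where
  private
    module N = Module N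
    module NF = ModuleFacts N
    module f = IsSemilinear f-lin
    module g = IsSemilinear g-lin

  equalizer-submodule : IsSubmodule M (λ x → Level.Lift c (f x N.≈ᴹ g x))
  equalizer-submodule = record
    { resp = λ q (Level.lift r) → Level.lift (N.≈ᴹ-trans (f.cong (Module.≈ᴹ-sym M q)) (N.≈ᴹ-trans r (g.cong q)))
    ; 0∈ = Level.lift (N.≈ᴹ-trans (SemilinearFacts.map-0 f-lin) (N.≈ᴹ-sym (SemilinearFacts.map-0 g-lin)))
    ; +∈ = λ (Level.lift q) (Level.lift r) → Level.lift (N.≈ᴹ-trans (f.+-hom _ _) (N.≈ᴹ-trans (N.+ᴹ-cong q r) (N.≈ᴹ-sym (g.+-hom _ _))))
    ; *∈ = λ s (Level.lift q) → Level.lift (N.≈ᴹ-trans (f.*-hom _ _) (N.≈ᴹ-trans (N.*ₗ-congˡ q) (N.≈ᴹ-sym (g.*-hom _ _)))) }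

  sub-semilinear : IsSemilinear M N τ (λ x → f x NF.-ᴹ g x)
  sub-semilinear = record
    { cong = λ q → NF.-ᴹ-cong₂ (f.cong q) (g.cong q)
    ; +-hom = λ x y → N.≈ᴹ-trans (NF.-ᴹ-cong₂ (f.+-hom x y) (g.+-hom x y)) (NF.sub-+ _ _ _ _)
    ; *-hom = λ s x → N.≈ᴹ-trans (NF.-ᴹ-cong₂ (f.*-hom s x) (g.*-hom s x)) (N.≈ᴹ-sym (NF.*-sub _ _ _)) }

module _ {c ℓ} {S : CommutativeRing c ℓ} {M N : Module S c ℓ} {f : Module.Carrierᴹ M → Module.Carrierᴹ N} (f-lin : IsLinear M N f) where
  private module f = IsSemilinear f-lin

  preimage-submodule : ∀ {X} → IsSubmodule N X → IsSubmodule M (λ x → X (f x))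
  preimage-submodule X-sub = record
    { resp = λ q → X.resp (f.cong q)
    ; 0∈ = X.resp (Module.≈ᴹ-sym N (SemilinearFacts.map-0 f-lin)) X.0∈
    ; +∈ = λ q r → X.resp (Module.≈ᴹ-sym N (f.+-hom _ _)) (X.+∈ q r)
    ; *∈ = λ s q → X.resp (Module.≈ᴹ-sym N (f.*-hom s _)) (X.*∈ s q) }
    where module X = IsSubmodule X-sub

id-StrictHom : ∀ {c ℓ} {p : ℕ} {S : CommutativeRing c ℓ} (Fr : Frame p S) → StrictHom Fr Fr
id-StrictHom {S = S} Fr = record
  { α = λ s → s ; α-hom = id-hom S ; I-pres = λ h → h ; σ-comm = λ _ → refl ; σ₁-comm = λ _ → refl }
  where open CommutativeRing S

module _ {c ℓ} {p : ℕ} {S S' : CommutativeRing c ℓ} {Fr : Frame p S} {Fr' : Frame p S'} (φ : StrictHom Fr Fr')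
         {W : Window Fr} {W' : Window Fr'} where
  open StrictHom φ
  private
    module S = CommutativeRing S
    module S' = CommutativeRing S'
    module Fr = Frame Fr
    module Fr' = Frame Fr'
    module W = Window W
    module W' = Window W'
    module WF = WindowFacts W
    module W'F = WindowFacts W'
    module PF = ModuleFacts W.P
    module P'F = ModuleFacts W'.P
    module αH = IsRingHom α-hom

  -- F is determined by F₁, since σ₁(I) generates the unit ideal.
  semiHom-fromΨ : (h : W.Carrierᴹ → W'.Carrierᴹ) → IsSemilinear W.P W'.P α h →
    (hQ : ∀ {x} → W.Q x → W'.Q (h x)) →
    (∀ {l} (hl : WF.L l) → W'.F₁ (h l) (hQ (WF.L⊆Q hl)) W'.≈ᴹ h (WF.Ψ l)) →
    (∀ {t} → WF.T t → W'.F (h t) W'.≈ᴹ h (WF.Ψ t)) → SemiHom α W W'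
  semiHom-fromΨ h h-lin hQ onL onT = record { g = h ; g-lin = h-lin ; Q-pres = hQ ; F-comm = F-comm ; F₁-comm = F₁-comm }
    where
    open SetoidReasoning W'.≈ᴹ-setoid
    module h = IsSemilinear h-lin
    module Q' = IsSubmodule W'.Q-sub

    F₁-comm : ∀ {x} (hx : W.Q x) → W'.F₁ (h x) (hQ hx) W'.≈ᴹ h (W.F₁ x hx)
    F₁-comm {x} hx = begin
      W'.F₁ (h x) (hQ hx)  ≈⟨ W'.F₁-cong (hQ hx) (Q'.+∈ (hQ (WF.L⊆Q (WF.pL∈L x))) r) decomposed ⟩
      W'.F₁ (h (WF.pL x) W'.+ᴹ P'F.lc (λ k → α (a k)) (λ k → h (t k))) _  ≈⟨ W'.F₁-+ _ r _ ⟩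
      W'.F₁ (h (WF.pL x)) _ W'.+ᴹ W'.F₁ (P'F.lc (λ k → α (a k)) (λ k → h (t k))) r
        ≈⟨ W'.+ᴹ-cong (onL (WF.pL∈L x)) (W'F.F₁-lc (λ k → α (a k)) (λ k → I-pres (a∈I k)) (λ k → h (t k)) r) ⟩
      h (WF.Ψ (WF.pL x)) W'.+ᴹ sumM W'.P (λ k → Fr'.σ₁ (α (a k)) (I-pres (a∈I k)) W'.*ₗ W'.F (h (t k)))
        ≈⟨ W'.+ᴹ-congˡ (P'F.sum-cong {m} λ k → W'.*ₗ-cong (σ₁-comm (a∈I k)) (onT (t∈T k))) ⟩
      h (WF.Ψ (WF.pL x)) W'.+ᴹ P'F.lc (λ k → α (Fr.σ₁ (a k) (a∈I k))) (λ k → h (WF.Ψ (t k)))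
        ≈⟨ W'.+ᴹ-congˡ (W'.≈ᴹ-sym (SemilinearFacts.map-lin h-lin (λ k → Fr.σ₁ (a k) (a∈I k)) (λ k → WF.Ψ (t k)))) ⟩
      h (WF.Ψ (WF.pL x)) W'.+ᴹ h (PF.lc (λ k → Fr.σ₁ (a k) (a∈I k)) (λ k → WF.Ψ (t k)))  ≈⟨ W'.≈ᴹ-sym (h.+-hom _ _) ⟩
      h (WF.Ψ (WF.pL x) W.+ᴹ PF.lc (λ k → Fr.σ₁ (a k) (a∈I k)) (λ k → WF.Ψ (t k)))  ≈⟨ h.cong (W.≈ᴹ-sym (WF.F₁-Ψ hx)) ⟩
      h (W.F₁ x hx)  ∎
      where
      open WF.QDecomp (WF.Q-decomp hx)
      r : W'.Q (P'F.lc (λ k → α (a k)) (λ k → h (t k)))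
      r = P'F.sum∈ W'.Q-sub λ k → W'F.I*⊆Q (I-pres (a∈I k)) (h (t k))
      decomposed : h x W'.≈ᴹ h (WF.pL x) W'.+ᴹ P'F.lc (λ k → α (a k)) (λ k → h (t k))
      decomposed = W'.≈ᴹ-trans (h.cong (WF.split x)) (W'.≈ᴹ-trans (h.+-hom _ _) (W'.+ᴹ-congˡ
        (W'.≈ᴹ-trans (h.cong pT≈) (SemilinearFacts.map-lin h-lin a t))))

    F-comm : ∀ x → W'.F (h x) W'.≈ᴹ h (W.F x)
    F-comm x with Fr.σ₁-gen
    ... | m , s , a , a∈I , gen = W'.≈ᴹ-sym (begin
      h (W.F x)  ≈⟨ h.cong (W.≈ᴹ-trans (W.≈ᴹ-sym (W.*ₗ-identityˡ _)) (W.*ₗ-congʳ (S.sym one))) ⟩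
      h (sumM (unit S) (λ k → s k S.* Fr.σ₁ (a k) (a∈I k)) W.*ₗ W.F x)
        ≈⟨ h.cong (W.≈ᴹ-trans (sum-*ʳ {M = W.P} (λ k → s k S.* Fr.σ₁ (a k) (a∈I k)) (W.F x)) (PF.sum-cong {m} λ k →
             W.≈ᴹ-trans (W.*ₗ-assoc _ _ _) (W.*ₗ-congˡ (W.≈ᴹ-sym (W.F₁-σ₁ (a∈I k) x (WF.I*⊆Q (a∈I k) x)))))) ⟩
      h (PF.lc s (λ k → W.F₁ (a k W.*ₗ x) (WF.I*⊆Q (a∈I k) x)))
        ≈⟨ SemilinearFacts.map-lin h-lin s (λ k → W.F₁ (a k W.*ₗ x) (WF.I*⊆Q (a∈I k) x)) ⟩
      P'F.lc (λ k → α (s k)) (λ k → h (W.F₁ (a k W.*ₗ x) (WF.I*⊆Q (a∈I k) x)))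
        ≈⟨ P'F.sum-cong {m} (λ k → W'.*ₗ-congˡ (W'.≈ᴹ-sym (F₁-comm (WF.I*⊆Q (a∈I k) x)))) ⟩
      P'F.lc (λ k → α (s k)) (λ k → W'.F₁ (h (a k W.*ₗ x)) (hQ (WF.I*⊆Q (a∈I k) x)))
        ≈⟨ P'F.sum-cong {m} (λ k → W'.*ₗ-congˡ (W'.≈ᴹ-trans (W'.F₁-cong _ (W'F.I*⊆Q (I-pres (a∈I k)) (h x)) (h.*-hom (a k) x))
             (W'.≈ᴹ-trans (W'.F₁-σ₁ (I-pres (a∈I k)) (h x) _) (W'.*ₗ-congʳ (σ₁-comm (a∈I k)))))) ⟩
      P'F.lc (λ k → α (s k)) (λ k → α (Fr.σ₁ (a k) (a∈I k)) W'.*ₗ W'.F (h x))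
        ≈⟨ P'F.sum-cong {m} (λ k → W'.≈ᴹ-trans (W'.≈ᴹ-sym (W'.*ₗ-assoc _ _ _)) (W'.*ₗ-congʳ (S'.sym (αH.*-hom _ _)))) ⟩
      sumM W'.P (λ k → α (s k S.* Fr.σ₁ (a k) (a∈I k)) W'.*ₗ W'.F (h x))
        ≈⟨ W'.≈ᴹ-sym (sum-*ʳ {M = W'.P} (λ k → α (s k S.* Fr.σ₁ (a k) (a∈I k))) (W'.F (h x))) ⟩
      sumM (unit S') (λ k → α (s k S.* Fr.σ₁ (a k) (a∈I k))) W'.*ₗ W'.F (h x)
        ≈⟨ W'.*ₗ-congʳ (S'.trans (S'.sym (SemilinearFacts.map-sum (ringMap-semilinear α-hom) (λ k → s k S.* Fr.σ₁ (a k) (a∈I k))))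
             (S'.trans (αH.cong one) αH.1-hom)) ⟩
      S'.1# W'.*ₗ W'.F (h x)  ≈⟨ W'.*ₗ-identityˡ _ ⟩
      W'.F (h x)  ∎)
      where
      one : sumM (unit S) (λ k → s k S.* Fr.σ₁ (a k) (a∈I k)) S.≈ S.1#
      one = S.trans (S.reflexive (≡.sym (sumR≡sumM S (λ k → s k S.* Fr.σ₁ (a k) (a∈I k))))) gen

-- Turns elementwise nilpotence into a single exponent for finitely many elements; the sum of the
-- bounds serves as a common bound.
uniform-bound : ∀ {a} {k} (B : ℕ → Fin k → Set a) → (∀ m {j} → B m j → B (suc m) j) →
  (∀ j → ∃ λ m → B m j) → ∃ λ m → ∀ j → B m j
uniform-bound {k = zero} B mono h = 0 , λ ()
uniform-bound {a} {suc k} B mono h with h fzero | uniform-bound (λ m j → B m (fsuc j)) (λ m → mono m) (λ j → h (fsuc j))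
... | m , b | m' , bs = m ℕ.+ m' , λ { fzero → ≡.subst (λ i → B i fzero) (ℕ.+-comm m' m) (raise m' b) ; (fsuc j) → raise m (bs j) }
  where
  raise : ∀ d {i j} → B i j → B (d ℕ.+ i) j
  raise zero q = q
  raise (suc d) q = mono _ (raise d q)

-- Descent of differences along the filtration

module Filtered {c ℓ} {p : ℕ} .{{_ : ℕ.NonZero p}} {S S' : CommutativeRing c ℓ} {Fr : Frame p S} {Fr' : Frame p S'} (φ : StrictHom Fr Fr')
    (I-refl : ∀ s → Frame.I Fr' (StrictHom.α φ s) → Frame.I Fr s)
    (surj : ∀ s' → ∃ λ s → CommutativeRing._≈_ S' (StrictHom.α φ s) s')
    (N : ℕ) (𝔞 : ℕ → Pred (CommutativeRing.Carrier S) (c ⊔ ℓ))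
    (𝔞-ideal : ∀ i → IsIdeal S (𝔞 i))
    (𝔞₀ : ∀ x → 𝔞 zero x ⇔ₚ CommutativeRing._≈_ S' (StrictHom.α φ x) (CommutativeRing.0# S'))
    (𝔞N : ∀ x → 𝔞 N x ⇔ₚ CommutativeRing._≈_ S x (CommutativeRing.0# S))
    (𝔞-⊇ : ∀ i → i ℕ.< N → ∀ x → 𝔞 (suc i) x → 𝔞 i x)
    (𝔞-σ : ∀ i → i ℕ.< N → ∀ x → 𝔞 i x → 𝔞 (suc i) (Frame.σ Fr x))
    (𝔞-σ₁ : ∀ i → i ℕ.< N → ∀ x (h : Frame.I Fr x) → 𝔞 i x → 𝔞 i (Frame.σ₁ Fr x h))
    (𝔞-nil : ∀ i → i ℕ.< N → ∀ x → 𝔞 i x → ∃ λ m → ∃ λ y → Iter p S Fr m x y × 𝔞 (suc i) y) where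
  open Reduction φ I-refl surj (𝔞 zero) (𝔞-ideal zero) 𝔞₀
  private
    module S = CommutativeRing S
    module Fr = Frame Fr
    module I = IsIdeal Fr.I-ideal
    module FF = FrameFacts Fr

  𝔞⊆𝔞₀ : ∀ i → i ℕ.≤ N → ∀ {x} → 𝔞 i x → 𝔞 zero x
  𝔞⊆𝔞₀ zero _ h = h
  𝔞⊆𝔞₀ (suc i) i<N h = 𝔞⊆𝔞₀ i (ℕ.<⇒≤ i<N) (𝔞-⊇ i i<N _ h)

  𝔞⊆I : ∀ i → i ℕ.≤ N → ∀ {x} → 𝔞 i x → Fr.I x
  𝔞⊆I i i≤N h = K⊆I (𝔞⊆𝔞₀ i i≤N h)

  -- The hypothesis covers i < N; at the last step `𝔞 N` is zero and σ₁(0) = 0. That step occurs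
  -- because `𝔞⊆𝔟` uses the index i + 1.
  𝔞-σ₁' : ∀ i → i ℕ.≤ N → ∀ {x} (h : Fr.I x) → 𝔞 i x → 𝔞 i (Fr.σ₁ x h)
  𝔞-σ₁' i i≤N {x} h hx with ℕ.m≤n⇒m<n∨m≡n i≤N
  ... | inj₁ i<N = 𝔞-σ₁ i i<N x h hx
  ... | inj₂ ≡.refl = proj₂ (𝔞N _) (FF.σ₁-0 h (proj₁ (𝔞N x) hx))

  module Height (i : ℕ) (i<N : i ℕ.< N) where
    -- Refines the step from `𝔞 (suc i)` to `𝔞 i` by how many applications of σ₁ carry an element
    -- into `𝔞 (suc i)`. These sets are ideals because σ₁ is σ-linear, they increase with m and
    -- exhaust `𝔞 i` by nilpotence, while σ₁ and σ both lower m.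
    𝔟 : ℕ → Pred S.Carrier (c ⊔ ℓ)
    𝔟 zero a = 𝔞 (suc i) a
    𝔟 (suc m) a = 𝔞 i a × Σ (Fr.I a) λ h → 𝔟 m (Fr.σ₁ a h)

    private module 𝔞i = IsIdeal (𝔞-ideal i)

    𝔟-ideal : ∀ m → IsIdeal S (𝔟 m)
    𝔟-ideal zero = 𝔞-ideal (suc i)
    𝔟-ideal (suc m) = record
      { resp = λ q (hx , h , hσ) → 𝔞i.resp q hx , I.resp q h , B.resp (Fr.σ₁-cong h _ q) hσ
      ; 0∈ = 𝔞i.0∈ , I.0∈ , B.resp (S.sym (FF.σ₁-0 I.0∈ S.refl)) B.0∈
      ; +∈ = λ (hx , h , hσ) (hx' , h' , hσ') → 𝔞i.+∈ hx hx' , I.+∈ h h' , B.resp (S.sym (Fr.σ₁-+ h h' _)) (B.+∈ hσ hσ')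
      ; *∈ = λ s (hx , h , hσ) → 𝔞i.*∈ s hx , I.*∈ s h , B.resp (S.sym (Fr.σ₁-* s h _)) (B.*∈ (Fr.σ s) hσ) }
      where module B = IsIdeal (𝔟-ideal m)

    𝔞⊆𝔟 : ∀ m {a} → 𝔞 (suc i) a → 𝔟 m a
    𝔞⊆𝔟 zero h = h
    𝔞⊆𝔟 (suc m) {a} h = 𝔞-⊇ i i<N a h , 𝔞⊆I (suc i) i<N h , 𝔞⊆𝔟 m (𝔞-σ₁' (suc i) i<N _ h)

    𝔟-mono : ∀ m {a} → 𝔟 m a → 𝔟 (suc m) a
    𝔟-mono zero h = 𝔞⊆𝔟 1 h
    𝔟-mono (suc m) (hx , h , hσ) = hx , h , 𝔟-mono m hσ

    𝔟-exhausts : ∀ {a} → 𝔞 i a → ∃ λ m → 𝔟 m a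
    𝔟-exhausts {a} h with 𝔞-nil i i<N a h
    ... | m , y , it , hy = m , iterate it h
      where
      iterate : ∀ {m x} → Iter p S Fr m x y → 𝔞 i x → 𝔟 m x
      iterate done _ = hy
      iterate (step h it) hx = hx , h , iterate it (𝔞-σ₁ i i<N _ h hx)

    𝔟⊆I : ∀ m {a} → 𝔟 m a → Fr.I a
    𝔟⊆I zero h = 𝔞⊆I (suc i) i<N h
    𝔟⊆I (suc m) (_ , h , _) = h

    𝔟-σ₁ : ∀ m {a} (h : Fr.I a) → 𝔟 (suc m) a → 𝔟 m (Fr.σ₁ a h)
    𝔟-σ₁ m h (_ , h' , hσ) = IsIdeal.resp (𝔟-ideal m) (Fr.σ₁-cong h' h S.refl) hσ

    𝔟-σ : ∀ m {a} → 𝔟 (suc m) a → 𝔟 m (Fr.σ a)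
    𝔟-σ m (hx , _) = 𝔞⊆𝔟 m (𝔞-σ i i<N _ hx)

  module _ (W₁ W₂ : Window Fr) where
    private
      module W₁ = Window W₁
      module W₂ = Window W₂
      module F₁ = WindowFacts W₁
      module F₂ = WindowFacts W₂
      module P₂ = ModuleFacts W₂.P
      Map : Set c
      Map = W₁.Carrierᴹ → W₂.Carrierᴹ

    Into : Pred S.Carrier (c ⊔ ℓ) → Map → Set (c ⊔ ℓ)
    Into J d = ∀ x → (J F₂.·M) (d x)

    -- The recursion obeyed by differences of successive lifts. Membership in `Q` is an argument so
    -- that the relation makes sense for every map `d`.
    Next : Map → Map → Set (c ⊔ ℓ)
    Next d d' = ∀ x (h : W₂.Q (d (F₁.pL x))) → d' (F₁.Ψ x) W₂.≈ᴹ W₂.F₁ (d (F₁.pL x)) h W₂.+ᴹ W₂.F (d (F₁.pT x))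

    -- One step of the descent. Inside IP, `F₁` acts on coefficients by σ₁ and `F` by σ, so the
    -- recursion moves `J` to `J'` on the values of `Ψ`; these generate the source, hence d' is
    -- controlled everywhere.
    next-into : ∀ {J J'} → IsIdeal S J' → (∀ {a} → J a → Fr.I a) →
      (∀ {a} (h : Fr.I a) → J a → J' (Fr.σ₁ a h)) → (∀ {a} → J a → J' (Fr.σ a)) →
      ∀ {d d'} → IsLinear W₁.P W₂.P d' → Next d d' → Into J d → Into J' d'
    next-into {J} {J'} J'-ideal J⊆I J-σ₁ J-σ {d} {d'} d'-lin next d-into =
      F₁.Ψ-generates (preimage-submodule d'-lin J'P) λ y →
        J'P.resp (W₂.≈ᴹ-sym (next y (d∈Q _))) (J'P.+∈ (F₁-into (d∈Q _) (d-into _)) (F-into (d-into _)))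
      where
      J'P : IsSubmodule W₂.P (J' F₂.·M)
      J'P = F₂.·M-submodule J'-ideal
      module J'P = IsSubmodule J'P
      d∈Q : ∀ x → W₂.Q (d x)
      d∈Q x = F₂.IP⊆Q λ k → J⊆I (d-into x k)
      F-into : ∀ {z} → (J F₂.·M) z → (J' F₂.·M) (W₂.F z)
      F-into h = J'P.resp (W₂.≈ᴹ-sym (F₂.expand W₂.F-lin _)) (F₂.·M-lc J'-ideal (λ j → W₂.F (F₂.e j)) λ k → J-σ (h k))
      F₁-into : ∀ {z} (hz : W₂.Q z) → (J F₂.·M) z → (J' F₂.·M) (W₂.F₁ z hz)
      F₁-into {z} hz h = J'P.resp
        (W₂.≈ᴹ-trans (W₂.≈ᴹ-sym (F₂.F₁-lc (F₂.ι z) (λ k → J⊆I (h k)) F₂.e h')) (W₂.F₁-cong h' hz (F₂.retract z)))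
        (F₂.·M-lc J'-ideal (λ j → W₂.F (F₂.e j)) λ k → J-σ₁ (J⊆I (h k)) (h k))
        where
        h' : W₂.Q (P₂.lc (F₂.ι z) F₂.e)
        h' = IsSubmodule.resp W₂.Q-sub (W₂.≈ᴹ-sym (F₂.retract z)) hz

    into-from-generators : ∀ {J} → IsIdeal S J → ∀ {d} → IsLinear W₁.P W₂.P d → (∀ j → (J F₂.·M) (d (F₁.e j))) → Into J d
    into-from-generators J-ideal {d} d-lin h x = JP.resp (W₂.≈ᴹ-sym (F₁.expand d-lin x)) (P₂.sum∈ JP λ j → JP.*∈ (F₁.ι x j) (h j))
      where
      JP = F₂.·M-submodule J-ideal
      module JP = IsSubmodule JP

    module _ (D : ℕ → Map) (D-lin : ∀ m → IsLinear W₁.P W₂.P (D m)) (D-next : ∀ m → Next (D m) (D (suc m)))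
             (D-into : Into (𝔞 zero) (D zero)) where
      descend-height : ∀ i i<N m k → Into (Height.𝔟 i i<N m) (D k) → Into (𝔞 (suc i)) (D (m ℕ.+ k))
      descend-height i i<N zero k h = h
      descend-height i i<N (suc m) k h = ≡.subst (λ r → Into (𝔞 (suc i)) (D r)) (ℕ.+-suc m k)
        (descend-height i i<N m (suc k) (next-into (𝔟-ideal m) (𝔟⊆I (suc m)) (𝔟-σ₁ m) (𝔟-σ m) (D-lin (suc k)) (D-next k) h))
        where open Height i i<N

      -- A linear map is controlled by its values on the finitely many `e j`, each with finitely
      -- many coordinates. One `m` therefore serves for all of them, and `m` further terms of the
      -- sequence reach `𝔞 (suc i)`.
      descend : ∀ i → i ℕ.≤ N → ∃ λ k → Into (𝔞 i) (D k)
      descend zero _ = 0 , D-into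
      descend (suc i) i<N with descend i (ℕ.<⇒≤ i<N)
      ... | k , h with uniform-bound (λ m j → (𝔟 m F₂.·M) (D k (F₁.e j))) (λ m q l → 𝔟-mono m (q l))
                         (λ j → uniform-bound (λ m l → 𝔟 m (F₂.ι (D k (F₁.e j)) l)) (λ m → 𝔟-mono m) (λ l → 𝔟-exhausts (h (F₁.e j) l)))
        where open Height i i<N
      ... | m , hm = m ℕ.+ k , descend-height i i<N m k (into-from-generators (Height.𝔟-ideal i i<N m) (D-lin k) hm)

      eventually-0 : ∃ λ k → ∀ x → D k x W₂.≈ᴹ W₂.0ᴹ
      eventually-0 with descend N ℕ.≤-refl
      ... | k , h = k , λ x → F₂.ι-injective λ l → S.trans (proj₁ (𝔞N _) (h x l)) (S.sym (F₂.ι-0 l))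

    module _ (h : Map) (h-lin : IsLinear W₁.P W₂.P h) (hQ : ∀ {x} → W₁.Q x → W₂.Q (h x)) where
      U : Map
      U x = W₂.F₁ (h (F₁.pL x)) (hQ (F₁.L⊆Q (F₁.pL∈L x))) W₂.+ᴹ W₂.F (h (F₁.pT x))

      private
        module h = IsSemilinear h-lin
        module F = IsSemilinear W₂.F-lin
        module pL = IsSemilinear F₁.pL-lin
        module pT = IsSemilinear F₁.pT-lin
        module Q = IsSubmodule W₂.Q-sub
        hL : ∀ x → W₂.Q (h (F₁.pL x))
        hL x = hQ (F₁.L⊆Q (F₁.pL∈L x))

      U-lin : IsSemilinear W₁.P W₂.P Fr.σ U
      U-lin = record
        { cong = λ q → W₂.+ᴹ-cong (W₂.F₁-cong _ _ (h.cong (pL.cong q))) (F.cong (h.cong (pT.cong q)))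
        ; +-hom = λ x y → W₂.≈ᴹ-trans (W₂.+ᴹ-cong
            (W₂.≈ᴹ-trans (W₂.F₁-cong _ (Q.+∈ (hL x) (hL y)) (W₂.≈ᴹ-trans (h.cong (pL.+-hom x y)) (h.+-hom _ _))) (W₂.F₁-+ _ _ _))
            (W₂.≈ᴹ-trans (F.cong (W₂.≈ᴹ-trans (h.cong (pT.+-hom x y)) (h.+-hom _ _))) (F.+-hom _ _)))
            (P₂.+-interchange _ _ _ _)
        ; *-hom = λ s x → W₂.≈ᴹ-trans (W₂.+ᴹ-cong
            (W₂.≈ᴹ-trans (W₂.F₁-cong _ (Q.*∈ s (hL x)) (W₂.≈ᴹ-trans (h.cong (pL.*-hom s x)) (h.*-hom _ _))) (W₂.F₁-* s _ _))
            (W₂.≈ᴹ-trans (F.cong (W₂.≈ᴹ-trans (h.cong (pT.*-hom s x)) (h.*-hom _ _))) (F.*-hom s _)))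
            (W₂.≈ᴹ-sym (W₂.*ₗ-distribˡ _ _ _)) }

      U-L : ∀ {l} (hl : F₁.L l) → W₂.F₁ (h l) (hQ (F₁.L⊆Q hl)) W₂.≈ᴹ U l
      U-L hl = W₂.≈ᴹ-sym (W₂.≈ᴹ-trans (W₂.+ᴹ-cong (W₂.F₁-cong _ _ (h.cong (F₁.pL-L hl)))
        (W₂.≈ᴹ-trans (F.cong (W₂.≈ᴹ-trans (h.cong (F₁.pT-L hl)) (SemilinearFacts.map-0 h-lin))) (SemilinearFacts.map-0 W₂.F-lin)))
        (W₂.+ᴹ-identityʳ _))

      U-T : ∀ {t} → F₁.T t → W₂.F (h t) W₂.≈ᴹ U t
      U-T ht = W₂.≈ᴹ-sym (W₂.≈ᴹ-trans (W₂.+ᴹ-cong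
        (W₂.≈ᴹ-trans (W₂.F₁-cong _ Q.0∈ (W₂.≈ᴹ-trans (h.cong (F₁.pL-T ht)) (SemilinearFacts.map-0 h-lin))) (F₂.F₁-sum {zero} (λ ()) (λ ()) Q.0∈))
        (F.cong (h.cong (F₁.pT-T ht))))
        (W₂.+ᴹ-identityˡ _))

      hom-fromU : (∀ x → h (F₁.Ψ x) W₂.≈ᴹ U x) → Hom W₁ W₂
      hom-fromU q = semiHom-fromΨ (id-StrictHom Fr) {W = W₁} {W' = W₂} h h-lin hQ
        (λ hl → W₂.≈ᴹ-trans (U-L hl) (W₂.≈ᴹ-sym (q _))) (λ ht → W₂.≈ᴹ-trans (U-T ht) (W₂.≈ᴹ-sym (q _)))

    -- By additivity of `F₁` and `F`, the relation h' Ψ = U h passes to differences as a recursion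
    -- on them alone. This matters because only the differences, not the lifts, take values in 𝔞 P.
    U-difference : ∀ {h h'} (h-lin : IsLinear W₁.P W₂.P h) (h'-lin : IsLinear W₁.P W₂.P h')
      (hQ : ∀ {x} → W₁.Q x → W₂.Q (h x)) (h'Q : ∀ {x} → W₁.Q x → W₂.Q (h' x)) (k k' : Map) →
      (∀ x → k (F₁.Ψ x) W₂.≈ᴹ U h h-lin hQ x) → (∀ x → k' (F₁.Ψ x) W₂.≈ᴹ U h' h'-lin h'Q x) →
      Next (λ x → h x P₂.-ᴹ h' x) (λ x → k x P₂.-ᴹ k' x)
    U-difference {h} {h'} h-lin h'-lin hQ h'Q k k' q q' x hd = W₂.≈ᴹ-trans (P₂.-ᴹ-cong₂ (q x) (q' x)) (W₂.≈ᴹ-trans (P₂.sub-+ _ _ _ _)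
      (W₂.+ᴹ-cong (P₂.move-sub (W₂.≈ᴹ-trans (W₂.F₁-cong _ (IsSubmodule.+∈ W₂.Q-sub hd (h'Q (F₁.L⊆Q (F₁.pL∈L x))))
          (W₂.≈ᴹ-sym (W₂.≈ᴹ-trans (W₂.+ᴹ-comm _ _) (P₂.add-sub _ _)))) (W₂.F₁-+ hd _ _)))
        (W₂.≈ᴹ-sym (SemilinearFacts.map-sub W₂.F-lin _ _))))

    module _ {W₂' : Window Fr'} (u : SemiHom α W₂ W₂') (red : IsReduction u) where
      private
        module W₂' = Window W₂'
        module u = SemiHom u
        module ul = IsSemilinear u.g-lin
      open IsReduction red

      -- The difference of two homomorphisms is its own successor under `Next`, so a constant
      -- sequence enters the descent and must vanish.
      faithful : (g₁ g₂ : Hom W₁ W₂) → (∀ x → u.g (g g₁ x) W₂'.≈ᴹ u.g (g g₂ x)) → ∀ x → g g₁ x W₂.≈ᴹ g g₂ x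
      faithful g₁ g₂ q x = P₂.sub≈0⇒≈ (proj₂ (eventually-0 (λ _ → d) (λ _ → sub-semilinear g₁.g-lin g₂.g-lin)
          (λ _ → U-difference g₁.g-lin g₂.g-lin g₁.Q-pres g₂.Q-pres g₁.g g₂.g (hom-U g₁) (hom-U g₂))
          (λ x → kernel _ (W₂'.≈ᴹ-trans (SemilinearFacts.map-sub u.g-lin _ _) (ModuleFacts.≈⇒sub≈0 W₂'.P (q x))))) x)
        where
        module g₁ = SemiHom g₁
        module g₂ = SemiHom g₂
        d : Map
        d x = g₁.g x P₂.-ᴹ g₂.g x
        hom-U : (h : Hom W₁ W₂) → ∀ x → g h (F₁.Ψ x) W₂.≈ᴹ U (g h) (SemiHom.g-lin h) (SemiHom.Q-pres h) x
        hom-U h x = W₂.≈ᴹ-trans (IsSemilinear.+-hom (SemiHom.g-lin h) _ _)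
          (W₂.≈ᴹ-sym (W₂.+ᴹ-cong (SemiHom.F₁-comm h _) (SemiHom.F-comm h _)))

      module _ (k : SemiHom α W₁ W₂') where
        private
          module k = SemiHom k

        -- Compatibility with `F` and `F₁` is left to the iteration. Compatibility with `Q` comes
        -- from `Q-reflect`, because `Q` is the full preimage of that of the reduction.
        record LinearLift : Set (c ⊔ ℓ) where
          field
            map     : Map
            map-lin : IsLinear W₁.P W₂.P map
            lifts   : ∀ x → u.g (map x) W₂'.≈ᴹ k.g x

          map-Q : ∀ {x} → W₁.Q x → W₂.Q (map x)
          map-Q hx = Q-reflect _ (IsSubmodule.resp W₂'.Q-sub (W₂'.≈ᴹ-sym (lifts _)) (k.Q-pres hx))

        initial : LinearLift
        initial = record
          { map = F₁.fromImages {N = W₂.P} {τ = λ s → s} z ; map-lin = map-lin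
          ; lifts = F₁.agree (∘-semilinear αH.cong map-lin u.g-lin) k.g-lin λ j →
              W₂'.≈ᴹ-trans (SemilinearFacts.map-lin u.g-lin (F₁.ι (F₁.e j)) z)
                (W₂'.≈ᴹ-trans (ModuleFacts.lc-congʳ W₂'.P (λ l → α (F₁.ι (F₁.e j) l)) (λ l → proj₂ (surjective (k.g (F₁.e l)))))
                  (W₂'.≈ᴹ-sym (F₁.expand k.g-lin (F₁.e j)))) }
          where
          module αH = IsRingHom α-hom
          z : Fin F₁.n → W₂.Carrierᴹ
          z j = proj₁ (surjective (k.g (F₁.e j)))
          map-lin : IsLinear W₁.P W₂.P (F₁.fromImages {N = W₂.P} {τ = λ s → s} z)
          map-lin = F₁.fromImages-lin (id-hom S) z

        module _ (l : LinearLift) where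
          open LinearLift l
          open Linearization Fr W₁.fgp F₁.Ψ-lin F₁.Ψ-generates

          improved : Map
          improved = linearize (U-lin map map-lin map-Q)

          improved-Ψ : ∀ x → improved (F₁.Ψ x) W₂.≈ᴹ U map map-lin map-Q x
          improved-Ψ = linearize-Ψ (U-lin map map-lin map-Q)

          improve : LinearLift
          improve = record
            { map = improved
            ; map-lin = linearize-lin (U-lin map map-lin map-Q)
            -- Comparison on the values of `Ψ` suffices; there both sides agree because `u` and `k`
            -- commute with `F₁` and `F` and the previous map already lifts `k`.
            ; lifts = λ x → Level.lower (F₁.Ψ-generates (equalizer-submodule (∘-semilinear αH.cong (linearize-lin (U-lin map map-lin map-Q)) u.g-lin) k.g-lin)
                (λ y → Level.lift (W₂'.≈ᴹ-trans (ul.cong (improved-Ψ y)) (W₂'.≈ᴹ-trans (ul.+-hom _ _)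
                  (W₂'.≈ᴹ-trans (W₂'.+ᴹ-cong
                    (W₂'.≈ᴹ-trans (W₂'.≈ᴹ-sym (u.F₁-comm _)) (W₂'.≈ᴹ-trans (W₂'.F₁-cong _ (k.Q-pres _) (lifts _)) (k.F₁-comm (F₁.L⊆Q (F₁.pL∈L y)))))
                    (W₂'.≈ᴹ-trans (W₂'.≈ᴹ-sym (u.F-comm _)) (W₂'.≈ᴹ-trans (IsSemilinear.cong W₂'.F-lin (lifts _)) (k.F-comm _))))
                  (W₂'.≈ᴹ-sym (IsSemilinear.+-hom k.g-lin _ _)))))) x) }
            where module αH = IsRingHom α-hom

        approx : ℕ → LinearLift
        approx zero = initial
        approx (suc m) = improve (approx m)

        full : ∃ λ (h : Hom W₁ W₂) → ∀ x → u.g (g h x) W₂'.≈ᴹ k.g x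
        full = hom-fromU (map (approx m)) (map-lin (approx m)) (map-Q (approx m))
            -- Vanishing of `D m` says that improving the m-th lift does not change it, so
            -- `improved-Ψ` becomes the equation h Ψ = U h for that lift.
            (λ x → W₂.≈ᴹ-trans (W₂.≈ᴹ-sym (P₂.sub≈0⇒≈ (D≈0 (F₁.Ψ x)))) (improved-Ψ (approx m) x))
          , lifts (approx m)
          where
          open LinearLift
          D : ℕ → Map
          D m x = map (approx (suc m)) x P₂.-ᴹ map (approx m) x
          stable : ∃ λ m → ∀ x → D m x W₂.≈ᴹ W₂.0ᴹ
          stable = eventually-0 D (λ m → sub-semilinear (map-lin (approx (suc m))) (map-lin (approx m)))
            (λ m → U-difference (map-lin (approx (suc m))) (map-lin (approx m)) (map-Q (approx (suc m))) (map-Q (approx m)) (map (approx (suc (suc m)))) (map (approx (suc m)))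
               (improved-Ψ (approx (suc m))) (improved-Ψ (approx m)))
            -- The first two lifts agree after `u`, so their difference takes values in its kernel 𝔞
            -- P, where the descent starts.
            (λ x → kernel _ (W₂'.≈ᴹ-trans (SemilinearFacts.map-sub u.g-lin _ _)
               (ModuleFacts.≈⇒sub≈0 W₂'.P (W₂'.≈ᴹ-trans (lifts (approx 1) x) (W₂'.≈ᴹ-sym (lifts (approx 0) x))))))
          m : ℕ
          m = proj₁ stable
          D≈0 : ∀ x → D m x W₂.≈ᴹ W₂.0ᴹ
          D≈0 = proj₂ stable

-- Projective modules that are finitely generated modulo a radical ideal

module OperatorPolynomials {c ℓ} {S : CommutativeRing c ℓ} (X : Module S c ℓ)
    {u : Module.Carrierᴹ X → Module.Carrierᴹ X} (u-lin : IsLinear X X u) where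
  open CommutativeRing S hiding (zero)
  open Module X
  open ModuleFacts X
  private
    module u = IsSemilinear u-lin

  -- E is a polynomial in u of degree ≤ d whose coefficient at degree d is t
  Poly : Carrier → ℕ → (Carrierᴹ → Carrierᴹ) → Set (c ⊔ ℓ)
  Poly t zero E = Level.Lift c (∀ x → E x ≈ᴹ t *ₗ x)
  Poly t (suc d) E = ∃ λ s → ∃ λ E' → Poly t d E' × (∀ x → E x ≈ᴹ s *ₗ x +ᴹ u (E' x))

  Poly-≈ : ∀ {t t'} d {E} → t ≈ t' → Poly t d E → Poly t' d E
  Poly-≈ zero q (Level.lift h) = Level.lift λ x → ≈ᴹ-trans (h x) (*ₗ-congʳ q)
  Poly-≈ (suc d) q (s , E' , h , e) = s , E' , Poly-≈ d q h , e

  Poly-ext : ∀ {t} d {E G} → (∀ x → G x ≈ᴹ E x) → Poly t d E → Poly t d G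
  Poly-ext zero q (Level.lift h) = Level.lift λ x → ≈ᴹ-trans (q x) (h x)
  Poly-ext (suc d) q (s , E' , h , e) = s , E' , h , λ x → ≈ᴹ-trans (q x) (e x)

  Poly-lin : ∀ {t} d {E} → Poly t d E → IsLinear X X E
  Poly-lin {t} zero (Level.lift h) = record
    { cong = λ q → ≈ᴹ-trans (h _) (≈ᴹ-trans (*ₗ-congˡ q) (≈ᴹ-sym (h _)))
    ; +-hom = λ x y → ≈ᴹ-trans (h _) (≈ᴹ-trans (*ₗ-distribˡ t x y) (≈ᴹ-sym (+ᴹ-cong (h x) (h y))))
    ; *-hom = λ s x → ≈ᴹ-trans (h _) (≈ᴹ-trans (*ₗ-swap t s x) (*ₗ-congˡ (≈ᴹ-sym (h x)))) }
  Poly-lin (suc d) (s , E' , h , e) = record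
    { cong = λ q → ≈ᴹ-trans (e _) (≈ᴹ-trans (+ᴹ-cong (*ₗ-congˡ q) (u.cong (E'.cong q))) (≈ᴹ-sym (e _)))
    ; +-hom = λ x y → ≈ᴹ-trans (e _) (≈ᴹ-trans (+ᴹ-cong (*ₗ-distribˡ s x y) (≈ᴹ-trans (u.cong (E'.+-hom x y)) (u.+-hom _ _)))
        (≈ᴹ-trans (+-interchange _ _ _ _) (≈ᴹ-sym (+ᴹ-cong (e x) (e y)))))
    ; *-hom = λ r x → ≈ᴹ-trans (e _) (≈ᴹ-trans (+ᴹ-cong (*ₗ-swap s r x) (≈ᴹ-trans (u.cong (E'.*-hom r x)) (u.*-hom r _)))
        (≈ᴹ-trans (≈ᴹ-sym (*ₗ-distribˡ r _ _)) (*ₗ-congˡ (≈ᴹ-sym (e x))))) }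
    where
    module E' = IsSemilinear (Poly-lin d h)

  Poly-commutes : ∀ {t} d {E G} → Poly t d E → IsLinear X X G → (∀ x → G (u x) ≈ᴹ u (G x)) → ∀ x → E (G x) ≈ᴹ G (E x)
  Poly-commutes {t} zero (Level.lift h) G-lin Gu x = ≈ᴹ-trans (h _) (≈ᴹ-trans (≈ᴹ-sym (G.*-hom t x)) (G.cong (≈ᴹ-sym (h x))))
    where module G = IsSemilinear G-lin
  Poly-commutes (suc d) (s , E' , h , e) G-lin Gu x = ≈ᴹ-trans (e _) (≈ᴹ-trans
      (+ᴹ-cong (≈ᴹ-sym (G.*-hom s x)) (≈ᴹ-trans (u.cong (Poly-commutes d h G-lin Gu x)) (≈ᴹ-sym (Gu _))))
      (≈ᴹ-trans (≈ᴹ-sym (G.+-hom _ _)) (G.cong (≈ᴹ-sym (e x)))))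
    where module G = IsSemilinear G-lin

  Poly-u : ∀ {t} d {E} → Poly t d E → ∀ x → E (u x) ≈ᴹ u (E x)
  Poly-u d h = Poly-commutes d h u-lin (λ _ → ≈ᴹ-refl)

  Poly-comm : ∀ {t t'} d d' {E G} → Poly t d E → Poly t' d' G → ∀ x → E (G x) ≈ᴹ G (E x)
  Poly-comm d d' h h' = Poly-commutes d h (Poly-lin d' h') (Poly-u d' h')

  Poly-* : ∀ {t} d {E} s → Poly t d E → Poly (s * t) d (λ x → s *ₗ E x)
  Poly-* zero s (Level.lift h) = Level.lift λ x → ≈ᴹ-trans (*ₗ-congˡ (h x)) (≈ᴹ-sym (*ₗ-assoc s _ x))
  Poly-* (suc d) s (r , E' , h , e) = s * r , (λ x → s *ₗ E' x) , Poly-* d s h , λ x →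
    ≈ᴹ-trans (*ₗ-congˡ (e x)) (≈ᴹ-trans (*ₗ-distribˡ s _ _) (+ᴹ-cong (≈ᴹ-sym (*ₗ-assoc s r x)) (≈ᴹ-sym (u.*-hom s _))))

  Poly-+ : ∀ {t t'} d {E G} → Poly t d E → Poly t' d G → Poly (t + t') d (λ x → E x +ᴹ G x)
  Poly-+ zero (Level.lift h) (Level.lift h') = Level.lift λ x → ≈ᴹ-trans (+ᴹ-cong (h x) (h' x)) (≈ᴹ-sym (*ₗ-distribʳ x _ _))
  Poly-+ (suc d) (s , E' , h , e) (s' , G' , h' , e') = s + s' , (λ x → E' x +ᴹ G' x) , Poly-+ d h h' , λ x →
    ≈ᴹ-trans (+ᴹ-cong (e x) (e' x)) (≈ᴹ-trans (+-interchange _ _ _ _)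
      (≈ᴹ-sym (+ᴹ-cong (*ₗ-distribʳ x s s') (u.+-hom _ _))))

  Poly-- : ∀ {t t'} d {E G} → Poly t d E → Poly t' d G → Poly (t - t') d (λ x → E x -ᴹ G x)
  Poly-- d {E} {G} h h' = Poly-ext d (λ x → +ᴹ-congˡ (≈ᴹ-sym (-1*x≈-x (G x))))
    (Poly-≈ d (+-congˡ (ModuleFacts.-1*x≈-x (unit S) _)) (Poly-+ d h (Poly-* d (- 1#) h')))

  Poly-pad : ∀ {t} d {E} → Poly t d E → Poly 0# (suc d) E
  Poly-pad {t} zero (Level.lift h) = t , (λ _ → 0ᴹ) , Level.lift (λ x → ≈ᴹ-sym (*ₗ-zeroˡ x)) ,
    λ x → ≈ᴹ-trans (h x) (≈ᴹ-sym (≈ᴹ-trans (+ᴹ-congˡ (SemilinearFacts.map-0 u-lin)) (+ᴹ-identityʳ _)))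
  Poly-pad (suc d) (s , E' , h , e) = s , E' , Poly-pad d h , e

  Poly-pad+ : ∀ {t} k d {E} → Poly t d E → Poly 0# (suc (k ℕ.+ d)) E
  Poly-pad+ zero d h = Poly-pad d h
  Poly-pad+ (suc k) d h = Poly-pad (suc (k ℕ.+ d)) (Poly-pad+ k d h)

  Poly-∘ : ∀ {t t'} d d' {E G} → Poly t d E → Poly t' d' G → Poly (t * t') (d ℕ.+ d') (λ x → E (G x))
  Poly-∘ zero d' (Level.lift h) h' = Poly-ext d' (λ x → h _) (Poly-* d' _ h')
  Poly-∘ {t} {t'} (suc d) d' {E} {G} (s , E' , h , e) h' = Poly-ext D (λ x → e (G x))
      (Poly-≈ D (trans (+-congʳ (zeroʳ s)) (+-identityˡ _)) (Poly-+ D (Poly-* D s (Poly-pad+ d d' h'))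
        (0# , (λ x → E' (G x)) , Poly-∘ d d' h h' , λ x → ≈ᴹ-sym (≈ᴹ-trans (+ᴹ-congʳ (*ₗ-zeroˡ x)) (+ᴹ-identityˡ _)))))
    where
    D : ℕ
    D = suc (d ℕ.+ d')

  -- Fraction-free elimination; the degree pattern of the system (monic diagonal dominating its row) is preserved.
  eliminate : ∀ {n} (d : Fin n → ℕ) (E : Fin n → Fin n → Carrierᴹ → Carrierᴹ) (f : Fin n → Carrierᴹ) →
    (∀ i j → Poly (kron S i j) (d i) (E i j)) → (∀ i → sumM X (λ j → E i j (f j)) ≈ᴹ 0ᴹ) →
    ∃ λ D → ∃ λ G → Poly 1# D G × (∀ i → G (f i) ≈ᴹ 0ᴹ)
  eliminate {zero} d E f h q = 0 , (λ x → x) , Level.lift (λ x → ≈ᴹ-sym (*ₗ-identityˡ x)) , λ ()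
  eliminate {suc n} d E f h q with eliminate (λ i → d fzero ℕ.+ d (fsuc i))
      -- Two-by-two minors with pivot `E fzero fzero`. Their leading coefficients come from the
      -- first product, as `E fzero (fsuc j)` and `E (fsuc i) fzero` both have leading coefficient
      -- zero.
      (λ i j x → E fzero fzero (E (fsuc i) (fsuc j) x) -ᴹ E fzero (fsuc j) (E (fsuc i) fzero x)) (λ j → f (fsuc j))
      (λ i j → Poly-≈ (d fzero ℕ.+ d (fsuc i)) (trans (+-cong (*-identityˡ _) (trans (-‿cong (zeroˡ 0#)) (ModuleFacts.ε⁻¹≈ε (unit S)))) (+-identityʳ _))
        (Poly-- (d fzero ℕ.+ d (fsuc i)) (Poly-∘ (d fzero) (d (fsuc i)) (h fzero fzero) (h (fsuc i) (fsuc j)))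
          (Poly-∘ (d fzero) (d (fsuc i)) (h fzero (fsuc j)) (h (fsuc i) fzero))))
      reduced
    where
    open SetoidReasoning ≈ᴹ-setoid
    E₀₀ : Carrierᴹ → Carrierᴹ
    E₀₀ = E fzero fzero
    lin : ∀ i j → IsLinear X X (E i j)
    lin i j = Poly-lin (d i) (h i j)
    tail : ∀ i → sumM X (λ j → E i (fsuc j) (f (fsuc j))) ≈ᴹ -ᴹ E i fzero (f fzero)
    tail i = +≈0⇒≈- (≈ᴹ-trans (+ᴹ-comm _ _) (q i))
    reduced : ∀ i → sumM X (λ j → E₀₀ (E (fsuc i) (fsuc j) (f (fsuc j))) -ᴹ E fzero (fsuc j) (E (fsuc i) fzero (f (fsuc j)))) ≈ᴹ 0ᴹ
    reduced i = begin
      sumM X (λ j → E₀₀ (E (fsuc i) (fsuc j) (f (fsuc j))) -ᴹ E fzero (fsuc j) (E (fsuc i) fzero (f (fsuc j))))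
        ≈⟨ sum-cong {n} (λ j → +ᴹ-congˡ (-ᴹ‿cong (Poly-comm (d fzero) (d (fsuc i)) (h fzero (fsuc j)) (h (fsuc i) fzero) (f (fsuc j))))) ⟩
      sumM X (λ j → E₀₀ (E (fsuc i) (fsuc j) (f (fsuc j))) -ᴹ E (fsuc i) fzero (E fzero (fsuc j) (f (fsuc j))))
        ≈⟨ sum-cong {n} (λ j → +ᴹ-congˡ (≈ᴹ-sym (SemilinearFacts.map-neg (lin (fsuc i) fzero) _))) ⟩
      sumM X (λ j → E₀₀ (E (fsuc i) (fsuc j) (f (fsuc j))) +ᴹ E (fsuc i) fzero (-ᴹ E fzero (fsuc j) (f (fsuc j))))
        ≈⟨ sum-+ (λ j → E₀₀ (E (fsuc i) (fsuc j) (f (fsuc j)))) (λ j → E (fsuc i) fzero (-ᴹ E fzero (fsuc j) (f (fsuc j)))) ⟩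
      sumM X (λ j → E₀₀ (E (fsuc i) (fsuc j) (f (fsuc j)))) +ᴹ sumM X (λ j → E (fsuc i) fzero (-ᴹ E fzero (fsuc j) (f (fsuc j))))
        ≈⟨ +ᴹ-cong (≈ᴹ-sym (SemilinearFacts.map-sum (lin fzero fzero) (λ j → E (fsuc i) (fsuc j) (f (fsuc j)))))
             (≈ᴹ-sym (SemilinearFacts.map-sum (lin (fsuc i) fzero) (λ j → -ᴹ E fzero (fsuc j) (f (fsuc j))))) ⟩
      E₀₀ (sumM X (λ j → E (fsuc i) (fsuc j) (f (fsuc j)))) +ᴹ E (fsuc i) fzero (sumM X (λ j → -ᴹ E fzero (fsuc j) (f (fsuc j))))
        ≈⟨ +ᴹ-cong (IsSemilinear.cong (lin fzero fzero) (tail (fsuc i))) (IsSemilinear.cong (lin (fsuc i) fzero) sum-neg) ⟩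
      E₀₀ (-ᴹ E (fsuc i) fzero (f fzero)) +ᴹ E (fsuc i) fzero (E₀₀ (f fzero))
        ≈⟨ +ᴹ-cong (SemilinearFacts.map-neg (lin fzero fzero) _) (Poly-comm (d (fsuc i)) (d fzero) (h (fsuc i) fzero) (h fzero fzero) (f fzero)) ⟩
      -ᴹ E₀₀ (E (fsuc i) fzero (f fzero)) +ᴹ E₀₀ (E (fsuc i) fzero (f fzero))
        ≈⟨ -ᴹ‿inverseˡ _ ⟩
      0ᴹ ∎
      where
      sum-neg : sumM X (λ j → -ᴹ E fzero (fsuc j) (f (fsuc j))) ≈ᴹ E₀₀ (f fzero)
      sum-neg = ≈ᴹ-trans (sum-cong {n} λ j → ≈ᴹ-sym (-1*x≈-x _)) (≈ᴹ-trans (≈ᴹ-sym (sum-* (- 1#) (λ j → E fzero (fsuc j) (f (fsuc j)))))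
        (≈ᴹ-trans (-1*x≈-x _) (≈ᴹ-trans (-ᴹ‿cong (tail fzero)) (⁻¹-involutive _))))
  ... | D , G , hG , Gf = D ℕ.+ d fzero , (λ x → G (E fzero fzero x)) , Poly-≈ (D ℕ.+ d fzero) (*-identityˡ 1#) (Poly-∘ D (d fzero) hG (h fzero fzero)) , kills
    where
    lin : ∀ j → IsLinear X X (E fzero j)
    lin j = Poly-lin (d fzero) (h fzero j)
    G-lin = Poly-lin D hG
    module G = IsSemilinear G-lin
    -- `G` kills the unknowns after the first, and the first equation expresses
    -- `E fzero fzero (f fzero)` through them; all the operators commute, being polynomials in `u`.
    kills : ∀ i → G (E fzero fzero (f i)) ≈ᴹ 0ᴹ
    kills (fsuc i) = ≈ᴹ-trans (Poly-comm D (d fzero) hG (h fzero fzero) (f (fsuc i))) (≈ᴹ-trans (IsSemilinear.cong (lin fzero) (Gf i)) (SemilinearFacts.map-0 (lin fzero)))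
    kills fzero = ≈ᴹ-trans (G.cong (+≈0⇒≈- (q fzero))) (≈ᴹ-trans (SemilinearFacts.map-neg G-lin _) (≈ᴹ-trans (-ᴹ‿cong
      (≈ᴹ-trans (SemilinearFacts.map-sum G-lin (λ j → E fzero (fsuc j) (f (fsuc j)))) (sum-0 {n} λ j →
        ≈ᴹ-trans (Poly-comm D (d fzero) hG (h fzero (fsuc j)) (f (fsuc j))) (≈ᴹ-trans (IsSemilinear.cong (lin (fsuc j)) (Gf j)) (SemilinearFacts.map-0 (lin (fsuc j)))))))
      ε⁻¹≈ε))

  -- The Cayley-Hamilton argument by elimination: `f` solves the system with matrix u·1 - A, whose
  -- entries have degree at most one, with leading coefficients the identity matrix.
  monic-annihilator : ∀ {n} (A : Fin n → Fin n → Carrier) (f : Fin n → Carrierᴹ) → (∀ i → u (f i) ≈ᴹ lc (A i) f) →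
    ∃ λ D → ∃ λ G → Poly 1# D G × (∀ i → G (f i) ≈ᴹ 0ᴹ)
  monic-annihilator {n} A f q = eliminate (λ _ → 1) (λ i j x → u (kron S i j *ₗ x) -ᴹ A i j *ₗ x) f
    (λ i j → - A i j , (λ x → kron S i j *ₗ x) , Level.lift (λ x → ≈ᴹ-refl) , λ x → ≈ᴹ-trans (+ᴹ-comm _ _) (+ᴹ-congʳ (≈ᴹ-sym (neg-* _ x))))
    (λ i → ≈ᴹ-trans (sum-cong {n} λ j → +ᴹ-congˡ (≈ᴹ-sym (neg-* (A i j) (f j))))
      (≈ᴹ-trans (sum-+ (λ j → u (kron S i j *ₗ f j)) (λ j → (- A i j) *ₗ f j)) (≈ᴹ-trans
        (+ᴹ-cong (≈ᴹ-trans (≈ᴹ-sym (SemilinearFacts.map-sum u-lin (λ j → kron S i j *ₗ f j))) (≈ᴹ-trans (u.cong (lc-kron i f)) (q i)))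
          (≈ᴹ-trans (lc-congˡ f λ j → sym (ModuleFacts.-1*x≈-x (unit S) (A i j))) (≈ᴹ-trans (lc-* (- 1#) (A i) f) (-1*x≈-x _))))
        (sub-self _))))

-- Labelled formal sums and the free module

double : ℕ → ℕ
double zero = zero
double (suc n) = suc (suc (double n))

-- Even and odd numbers, so that two labellings can be used side by side without collisions.
code : ℕ ⊎ ℕ → ℕ
code (inj₁ n) = double n
code (inj₂ n) = suc (double n)

double-injective : ∀ {m n} → double m ≡ double n → m ≡ n
double-injective {zero} {zero} _ = ≡.refl
double-injective {suc m} {suc n} q = ≡.cong suc (double-injective (ℕ.suc-injective (ℕ.suc-injective q)))

double≢suc-double : ∀ m n → double m ≢ suc (double n)
double≢suc-double (suc m) zero ()
double≢suc-double (suc m) (suc n) q = double≢suc-double m n (ℕ.suc-injective (ℕ.suc-injective q))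

code-injective : ∀ {i j} → code i ≡ code j → i ≡ j
code-injective {inj₁ m} {inj₁ n} q = ≡.cong inj₁ (double-injective q)
code-injective {inj₁ m} {inj₂ n} q = ⊥-elim (double≢suc-double m n q)
code-injective {inj₂ m} {inj₁ n} q = ⊥-elim (double≢suc-double n m (≡.sym q))
code-injective {inj₂ m} {inj₂ n} q = ≡.cong inj₂ (double-injective (ℕ.suc-injective q))

map-injective : ∀ {A B : Set} {f : A → ℕ} {g : B → ℕ} → (∀ {i j} → f i ≡ f j → i ≡ j) → (∀ {i j} → g i ≡ g j → i ≡ j) →
  ∀ {i j} → Sum.map f g i ≡ Sum.map f g j → i ≡ j
map-injective f-inj g-inj {inj₁ i} {inj₁ j} e = ≡.cong inj₁ (f-inj (Sum.inj₁-injective e))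
map-injective f-inj g-inj {inj₂ i} {inj₂ j} e = ≡.cong inj₂ (g-inj (Sum.inj₂-injective e))

merge : ℕ → ℕ → ℕ → ℕ
merge a b k with k ℕ.≟ b
... | yes _ = a
... | no _ = k

merge-b : ∀ a b → merge a b b ≡ a
merge-b a b with b ℕ.≟ b
... | yes _ = ≡.refl
... | no b≢b = ⊥-elim (b≢b ≡.refl)

merge-a : ∀ a b → merge a b a ≡ a
merge-a a b with a ℕ.≟ b
... | yes _ = ≡.refl
... | no _ = ≡.refl

module _ {c ℓ} {S : CommutativeRing c ℓ} (M : Module S c ℓ) where
  open CommutativeRing S hiding (zero)
  open Module M
  open ModuleFacts M

  sum-splitAt : ∀ m {n} (h : Fin m ⊎ Fin n → Carrierᴹ) →
    sumM M (λ k → h (splitAt m k)) ≈ᴹ sumM M (λ i → h (inj₁ i)) +ᴹ sumM M (λ j → h (inj₂ j))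
  sum-splitAt zero h = ≈ᴹ-sym (+ᴹ-identityˡ _)
  sum-splitAt (suc m) h = ≈ᴹ-trans (+ᴹ-congˡ (sum-splitAt m (λ i → h (Sum.map₁ fsuc i)))) (≈ᴹ-sym (+ᴹ-assoc _ _ _))

  -- I M for modules without coordinates
  Combo : Pred Carrier (c ⊔ ℓ) → Pred Carrierᴹ (c ⊔ ℓ)
  Combo I x = ∃ λ n → Σ (Fin n → Carrier) λ a → Σ (Fin n → Carrierᴹ) λ y → (∀ k → I (a k)) × x ≈ᴹ lc a y

  combo-intro : ∀ {I a} y → I a → Combo I (a *ₗ y)
  combo-intro {a = a} y h = 1 , (λ _ → a) , (λ _ → y) , (λ _ → h) , ≈ᴹ-sym (+ᴹ-identityʳ _)

  combo-submodule : ∀ {I} → IsIdeal S I → IsSubmodule M (Combo I)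
  combo-submodule {I} I-ideal = record
    { resp = λ q (n , a , y , h , r) → n , a , y , h , ≈ᴹ-trans (≈ᴹ-sym q) r
    ; 0∈ = 0 , (λ ()) , (λ ()) , (λ ()) , ≈ᴹ-refl
    ; +∈ = λ (m , a , y , h , q) (n , b , z , h' , r) → m ℕ.+ n ,
        (λ k → [ a , b ]′ (splitAt m k)) , (λ k → [ y , z ]′ (splitAt m k)) , (λ k → both h h' (splitAt m k)) ,
        ≈ᴹ-trans (+ᴹ-cong q r) (≈ᴹ-sym (sum-splitAt m (λ i → [ a , b ]′ i *ₗ [ y , z ]′ i)))
    ; *∈ = λ s (n , a , y , h , q) → n , (λ k → s * a k) , y , (λ k → IsIdeal.*∈ I-ideal s (h k)) ,
        ≈ᴹ-trans (*ₗ-congˡ q) (≈ᴹ-sym (lc-* s a y)) }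
    where
    both : ∀ {m n} {a : Fin m → Carrier} {b : Fin n → Carrier} → (∀ k → I (a k)) → (∀ k → I (b k)) → ∀ i → I ([ a , b ]′ i)
    both h h' (inj₁ i) = h i
    both h h' (inj₂ j) = h' j

-- The free module on the setoid underlying X.  Two formal sums are equal when their terms can be labelled
-- so that terms with the same label have equal base points and the total weight of every set of labels agrees;
-- this formulation of equality lives in the universe of the equality of X.
module FreeModule {c ℓ} {S : CommutativeRing c ℓ} (X : Module S c ℓ) where
  open CommutativeRing S hiding (zero)
  private
    module X = Module X
    module XF = ModuleFacts X
    U = unit S
    module UF = ModuleFacts U

  record FormalSum : Set c where
    no-eta-equality
    constructor formal
    field
      size  : ℕ
      coef  : Fin size → Carrier
      point : Fin size → X.Carrierᴹ
  open FormalSum public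

  eval : FormalSum → X.Carrierᴹ
  eval a = XF.lc (coef a) (point a)

  χ : Bool → Carrier
  χ b = if b then 1# else 0#

  weigh : (a : FormalSum) → (Fin (size a) → Carrier) → Carrier
  weigh a ω = sumM U (λ i → ω i * coef a i)

  Valid : ∀ {A : Set} → (A → X.Carrierᴹ) → (A → ℕ) → Set ℓ
  Valid x κ = ∀ i j → κ i ≡ κ j → x i X.≈ᴹ x j

  infix 4 _≋_
  record _≋_ (a b : FormalSum) : Set ℓ where
    field
      label   : Fin (size a) ⊎ Fin (size b) → ℕ
      valid   : Valid [ point a , point b ]′ label
      weights : ∀ (w : ℕ → Bool) → weigh a (λ i → χ (w (label (inj₁ i)))) ≈ weigh b (λ j → χ (w (label (inj₂ j))))
      evals   : eval a X.≈ᴹ eval b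
  open _≋_ public

  -- For two sums whose terms come from one index set `A`, an injective numbering of `A` provides
  -- the labels; equal labels then mean equal indices, hence equal points.
  byIndex : ∀ {a b} {A : Set} (κ : A → ℕ) → (∀ {i j} → κ i ≡ κ j → i ≡ j) → (x : A → X.Carrierᴹ)
    (λa : Fin (size a) → A) (λb : Fin (size b) → A) →
    (∀ i → point a i X.≈ᴹ x (λa i)) → (∀ j → point b j X.≈ᴹ x (λb j)) →
    (∀ (w : A → Bool) → weigh a (λ i → χ (w (λa i))) ≈ weigh b (λ j → χ (w (λb j)))) →
    eval a X.≈ᴹ eval b → a ≋ b
  byIndex {a} {b} κ κ-inj x λa λb xa xb ws ev = record
    { label = λ i → κ (lab i)
    ; valid = λ i j q → X.≈ᴹ-trans (pt i) (X.≈ᴹ-trans (X.≈ᴹ-reflexive (≡.cong x (κ-inj q))) (X.≈ᴹ-sym (pt j)))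
    ; weights = λ w → ws (λ i → w (κ i))
    ; evals = ev }
    where
    lab = [ λa , λb ]′
    pt : ∀ i → [ point a , point b ]′ i X.≈ᴹ x (lab i)
    pt (inj₁ i) = xa i
    pt (inj₂ j) = xb j

  samePoints : ∀ {a} (t : Fin (size a) → Carrier) → (∀ i → coef a i ≈ t i) → a ≋ formal (size a) t (point a)
  samePoints {a} t q = byIndex toℕ Fin.toℕ-injective (point a) (λ i → i) (λ i → i) (λ _ → X.≈ᴹ-refl) (λ _ → X.≈ᴹ-refl)
    (λ w → UF.sum-cong {size a} λ i → *-congˡ (q i)) (XF.lc-congˡ (point a) q)

  ≋-refl : ∀ {a} → a ≋ a
  ≋-refl {a} = byIndex toℕ Fin.toℕ-injective (point a) (λ i → i) (λ i → i) (λ _ → X.≈ᴹ-refl) (λ _ → X.≈ᴹ-refl) (λ _ → refl) X.≈ᴹ-refl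

  ≋-sym : ∀ {a b} → a ≋ b → b ≋ a
  ≋-sym {a} {b} q = record
    { label = λ i → label q (Sum.swap i)
    ; valid = λ i j r → X.≈ᴹ-trans (pt i) (X.≈ᴹ-trans (valid q (Sum.swap i) (Sum.swap j) r) (X.≈ᴹ-sym (pt j)))
    ; weights = λ w → sym (weights q w)
    ; evals = X.≈ᴹ-sym (evals q) }
    where
    pt : ∀ i → [ point b , point a ]′ i X.≈ᴹ [ point a , point b ]′ (Sum.swap i)
    pt (inj₁ _) = X.≈ᴹ-refl
    pt (inj₂ _) = X.≈ᴹ-refl

  merge-valid : ∀ {A : Set} {x : A → X.Carrierᴹ} {κ : A → ℕ} → Valid x κ → ∀ p q → x p X.≈ᴹ x q →
    Valid x (λ i → merge (κ p) (κ q) (κ i))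
  merge-valid {κ = κ} v p q r i j e with κ i ℕ.≟ κ q | κ j ℕ.≟ κ q
  ... | yes i~q | yes j~q = v i j (≡.trans i~q (≡.sym j~q))
  ... | yes i~q | no _    = X.≈ᴹ-trans (v i q i~q) (X.≈ᴹ-trans (X.≈ᴹ-sym r) (v p j e))
  ... | no _    | yes j~q = X.≈ᴹ-trans (v i p e) (X.≈ᴹ-trans r (X.≈ᴹ-sym (v j q j~q)))
  ... | no _    | no _    = v i j e

  mergeAll : ∀ {A : Set} {x : A → X.Carrierᴹ} {κ : A → ℕ} → Valid x κ → ∀ {m} (p q : Fin m → A) → (∀ k → x (p k) X.≈ᴹ x (q k)) →
    ∃ λ (ρ : ℕ → ℕ) → Valid x (λ i → ρ (κ i)) × (∀ k → ρ (κ (p k)) ≡ ρ (κ (q k)))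
  mergeAll v {zero} p q r = (λ k → k) , v , λ ()
  mergeAll {x = x} {κ} v {suc m} p q r with mergeAll v (λ k → p (fsuc k)) (λ k → q (fsuc k)) (λ k → r (fsuc k))
  ... | ρ , v' , eq = (λ k → merge (ρ (κ (p fzero))) (ρ (κ (q fzero))) (ρ k)) ,
    merge-valid {x = x} {κ = λ i → ρ (κ i)} v' (p fzero) (q fzero) (r fzero) ,
    λ { fzero → ≡.trans (merge-a (ρ (κ (p fzero))) (ρ (κ (q fzero)))) (≡.sym (merge-b (ρ (κ (p fzero))) (ρ (κ (q fzero))))) ; (fsuc k) → ≡.cong (merge _ _) (eq k) }

  -- Both equalities label the terms of the middle sum `b`. The labellings are first made disjoint
  -- by `code`; then the two labels of each term of `b` are merged, which stays valid because both
  -- belong to the same point. Weights can now be compared through `b`.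
  ≋-trans : ∀ {a b d} → a ≋ b → b ≋ d → a ≋ d
  ≋-trans {a} {b} {d} q r = record
    { label = λ i → ρ (κ (outer i))
    ; valid = λ i j e → X.≈ᴹ-trans (pt i) (X.≈ᴹ-trans (ρ-valid (outer i) (outer j) e) (X.≈ᴹ-sym (pt j)))
    ; weights = λ w → trans (weights q (λ k → w (ρ (code (inj₁ k)))))
        (trans (UF.sum-cong {size b} λ k → *-congʳ (reflexive (≡.cong (λ l → χ (w l)) (ρ-eq k))))
          (weights r (λ k → w (ρ (code (inj₂ k))))))
    ; evals = X.≈ᴹ-trans (evals q) (evals r) }
    where
    A B : Set
    A = Fin (size a) ⊎ Fin (size b)
    B = Fin (size b) ⊎ Fin (size d)
    x : A ⊎ B → X.Carrierᴹ
    x = [ [ point a , point b ]′ , [ point b , point d ]′ ]′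
    κ : A ⊎ B → ℕ
    κ i = code (Sum.map (label q) (label r) i)
    κ-valid : Valid x κ
    κ-valid (inj₁ i) (inj₁ j) e = valid q i j (double-injective e)
    κ-valid (inj₁ i) (inj₂ j) e = ⊥-elim (double≢suc-double _ _ e)
    κ-valid (inj₂ i) (inj₁ j) e = ⊥-elim (double≢suc-double _ _ (≡.sym e))
    κ-valid (inj₂ i) (inj₂ j) e = valid r i j (double-injective (ℕ.suc-injective e))
    merged : ∃ λ (ρ : ℕ → ℕ) → Valid x (λ i → ρ (κ i)) × (∀ k → ρ (κ (inj₁ (inj₂ k))) ≡ ρ (κ (inj₂ (inj₁ k))))
    merged = mergeAll κ-valid (λ k → inj₁ (inj₂ k)) (λ k → inj₂ (inj₁ k)) (λ k → X.≈ᴹ-refl)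
    ρ = proj₁ merged
    ρ-valid = proj₁ (proj₂ merged)
    ρ-eq = proj₂ (proj₂ merged)
    outer : Fin (size a) ⊎ Fin (size d) → A ⊎ B
    outer = Sum.map inj₁ inj₂
    pt : ∀ i → [ point a , point d ]′ i X.≈ᴹ x (outer i)
    pt (inj₁ _) = X.≈ᴹ-refl
    pt (inj₂ _) = X.≈ᴹ-refl

  infixl 6 _⊞_
  _⊞_ : FormalSum → FormalSum → FormalSum
  a ⊞ b = formal (size a ℕ.+ size b) (λ k → [ coef a , coef b ]′ (splitAt (size a) k)) (λ k → [ point a , point b ]′ (splitAt (size a) k))

  scale : Carrier → FormalSum → FormalSum
  scale s a = formal (size a) (λ i → s * coef a i) (point a)

  𝟘 : FormalSum
  𝟘 = formal 0 (λ ()) (λ ())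

  eval-⊞ : ∀ a b → eval (a ⊞ b) X.≈ᴹ eval a X.+ᴹ eval b
  eval-⊞ a b = sum-splitAt X (size a) (λ i → [ coef a , coef b ]′ i X.*ₗ [ point a , point b ]′ i)

  eval-scale : ∀ s a → eval (scale s a) X.≈ᴹ s X.*ₗ eval a
  eval-scale s a = XF.lc-* s (coef a) (point a)

  weigh-⊞ : ∀ a b (ω : Fin (size a) ⊎ Fin (size b) → Carrier) →
    weigh (a ⊞ b) (λ k → ω (splitAt (size a) k)) ≈ weigh a (λ i → ω (inj₁ i)) + weigh b (λ j → ω (inj₂ j))
  weigh-⊞ a b ω = sum-splitAt U (size a) (λ i → ω i * [ coef a , coef b ]′ i)

  weigh-scale : ∀ s a ω → weigh (scale s a) ω ≈ s * weigh a ω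
  weigh-scale s a ω = trans (UF.sum-cong {size a} λ i → x∙yz≈y∙xz (ω i) s (coef a i)) (sym (UF.sum-* s (λ i → ω i * coef a i)))
    where open import Algebra.Properties.CommutativeSemigroup *-commutativeSemigroup using (x∙yz≈y∙xz)

  ⊞-cong : ∀ {a a' b b'} → a ≋ a' → b ≋ b' → a ⊞ b ≋ a' ⊞ b'
  ⊞-cong {a} {a'} {b} {b'} q r = record
    { label = lab
    ; valid = λ i j e → X.≈ᴹ-trans (pt i) (X.≈ᴹ-trans (both i j e) (X.≈ᴹ-sym (pt j)))
    ; weights = λ w → trans (weigh-⊞ a b (λ i → χ (w (code (Sum.map (λ i → label q (inj₁ i)) (λ i → label r (inj₁ i)) i)))))
        (trans (+-cong (weights q (λ k → w (code (inj₁ k)))) (weights r (λ k → w (code (inj₂ k)))))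
          (sym (weigh-⊞ a' b' (λ i → χ (w (code (Sum.map (λ i → label q (inj₂ i)) (λ i → label r (inj₂ i)) i)))))))
    ; evals = X.≈ᴹ-trans (eval-⊞ a b) (X.≈ᴹ-trans (X.+ᴹ-cong (evals q) (evals r)) (X.≈ᴹ-sym (eval-⊞ a' b'))) }
    where
    A B : Set
    A = Fin (size a) ⊎ Fin (size a')
    B = Fin (size b) ⊎ Fin (size b')
    side : Fin (size a ℕ.+ size b) ⊎ Fin (size a' ℕ.+ size b') → A ⊎ B
    side (inj₁ k) = Sum.map inj₁ inj₁ (splitAt (size a) k)
    side (inj₂ k) = Sum.map inj₂ inj₂ (splitAt (size a') k)
    x : A ⊎ B → X.Carrierᴹ
    x = [ [ point a , point a' ]′ , [ point b , point b' ]′ ]′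
    κ : A ⊎ B → ℕ
    κ i = code (Sum.map (label q) (label r) i)
    κ-valid : Valid x κ
    κ-valid (inj₁ i) (inj₁ j) e = valid q i j (double-injective e)
    κ-valid (inj₁ i) (inj₂ j) e = ⊥-elim (double≢suc-double _ _ e)
    κ-valid (inj₂ i) (inj₁ j) e = ⊥-elim (double≢suc-double _ _ (≡.sym e))
    κ-valid (inj₂ i) (inj₂ j) e = valid r i j (double-injective (ℕ.suc-injective e))
    lab : Fin (size a ℕ.+ size b) ⊎ Fin (size a' ℕ.+ size b') → ℕ
    lab (inj₁ k) = code (Sum.map (λ i → label q (inj₁ i)) (λ i → label r (inj₁ i)) (splitAt (size a) k))
    lab (inj₂ k) = code (Sum.map (λ i → label q (inj₂ i)) (λ i → label r (inj₂ i)) (splitAt (size a') k))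
    lab≡ : ∀ i → lab i ≡ κ (side i)
    lab≡ (inj₁ k) with splitAt (size a) k
    ... | inj₁ _ = ≡.refl
    ... | inj₂ _ = ≡.refl
    lab≡ (inj₂ k) with splitAt (size a') k
    ... | inj₁ _ = ≡.refl
    ... | inj₂ _ = ≡.refl
    both : ∀ i j → lab i ≡ lab j → x (side i) X.≈ᴹ x (side j)
    both i j e = κ-valid (side i) (side j) (≡.trans (≡.sym (lab≡ i)) (≡.trans e (lab≡ j)))
    pt : ∀ i → [ point (a ⊞ b) , point (a' ⊞ b') ]′ i X.≈ᴹ x (side i)
    pt (inj₁ k) with splitAt (size a) k
    ... | inj₁ _ = X.≈ᴹ-refl
    ... | inj₂ _ = X.≈ᴹ-refl
    pt (inj₂ k) with splitAt (size a') k
    ... | inj₁ _ = X.≈ᴹ-refl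
    ... | inj₂ _ = X.≈ᴹ-refl

  ⊞-comm : ∀ a b → a ⊞ b ≋ b ⊞ a
  ⊞-comm a b = byIndex κ κ-inj [ point a , point b ]′ (splitAt (size a)) (λ k → Sum.swap (splitAt (size b) k))
    (λ _ → X.≈ᴹ-refl) pt
    (λ w → trans (weigh-⊞ a b (λ i → χ (w i))) (trans (+-comm _ _) (sym (weigh-⊞ b a (λ i → χ (w (Sum.swap i)))))))
    (X.≈ᴹ-trans (eval-⊞ a b) (X.≈ᴹ-trans (X.+ᴹ-comm _ _) (X.≈ᴹ-sym (eval-⊞ b a))))
    where
    κ : Fin (size a) ⊎ Fin (size b) → ℕ
    κ i = code (Sum.map toℕ toℕ i)
    κ-inj : ∀ {i j} → κ i ≡ κ j → i ≡ j
    κ-inj e = map-injective Fin.toℕ-injective Fin.toℕ-injective (code-injective e)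
    pt : ∀ k → [ point b , point a ]′ (splitAt (size b) k) X.≈ᴹ [ point a , point b ]′ (Sum.swap (splitAt (size b) k))
    pt k with splitAt (size b) k
    ... | inj₁ _ = X.≈ᴹ-refl
    ... | inj₂ _ = X.≈ᴹ-refl

  ⊞-assoc : ∀ a b d → (a ⊞ b) ⊞ d ≋ a ⊞ (b ⊞ d)
  ⊞-assoc a b d = byIndex κ κ-inj x (λ k → left (splitAt (size (a ⊞ b)) k)) (λ k → right (splitAt (size a) k))
    (λ k → ptL (splitAt (size (a ⊞ b)) k)) (λ k → ptR (splitAt (size a) k))
    (λ w → trans (weigh-⊞ (a ⊞ b) d (λ i → χ (w (left i)))) (trans (+-congʳ (weigh-⊞ a b (λ i → χ (w (inj₁ i)))))
      (trans (+-assoc _ _ _) (sym (trans (weigh-⊞ a (b ⊞ d) (λ i → χ (w (right i)))) (+-congˡ (weigh-⊞ b d (λ i → χ (w ([ (λ j → inj₁ (inj₂ j)) , inj₂ ]′ i))))))))))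
    (X.≈ᴹ-trans (eval-⊞ (a ⊞ b) d) (X.≈ᴹ-trans (X.+ᴹ-congʳ (eval-⊞ a b)) (X.≈ᴹ-trans (X.+ᴹ-assoc _ _ _)
      (X.≈ᴹ-sym (X.≈ᴹ-trans (eval-⊞ a (b ⊞ d)) (X.+ᴹ-congˡ (eval-⊞ b d)))))))
    where
    A : Set
    A = (Fin (size a) ⊎ Fin (size b)) ⊎ Fin (size d)
    x : A → X.Carrierᴹ
    x = [ [ point a , point b ]′ , point d ]′
    κ : A → ℕ
    κ i = code (Sum.map (λ j → code (Sum.map toℕ toℕ j)) toℕ i)
    κ-inj : ∀ {i j} → κ i ≡ κ j → i ≡ j
    κ-inj e = map-injective (λ e → map-injective Fin.toℕ-injective Fin.toℕ-injective (code-injective e)) Fin.toℕ-injective (code-injective e)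
    left : Fin (size (a ⊞ b)) ⊎ Fin (size d) → A
    left = Sum.map₁ (splitAt (size a))
    right : Fin (size a) ⊎ Fin (size (b ⊞ d)) → A
    right = [ (λ i → inj₁ (inj₁ i)) , (λ k → [ (λ j → inj₁ (inj₂ j)) , inj₂ ]′ (splitAt (size b) k)) ]′
    ptL : ∀ i → [ point (a ⊞ b) , point d ]′ i X.≈ᴹ x (left i)
    ptL (inj₁ k) = X.≈ᴹ-refl
    ptL (inj₂ _) = X.≈ᴹ-refl
    ptR : ∀ i → [ point a , point (b ⊞ d) ]′ i X.≈ᴹ x (right i)
    ptR (inj₁ _) = X.≈ᴹ-refl
    ptR (inj₂ k) with splitAt (size b) k
    ... | inj₁ _ = X.≈ᴹ-refl
    ... | inj₂ _ = X.≈ᴹ-refl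

  scale-cong : ∀ {s t a b} → s ≈ t → a ≋ b → scale s a ≋ scale t b
  scale-cong {s} {t} {a} {b} p q = record
    { label = label q ; valid = valid q
    ; weights = λ w → trans (weigh-scale s a _) (trans (*-cong p (weights q w)) (sym (weigh-scale t b _)))
    ; evals = X.≈ᴹ-trans (eval-scale s a) (X.≈ᴹ-trans (X.*ₗ-cong p (evals q)) (X.≈ᴹ-sym (eval-scale t b))) }

  overPoints : ∀ {a b d} (λb : Fin (size b) → Fin (size a)) (λd : Fin (size d) → Fin (size a)) →
    (∀ i → point b i X.≈ᴹ point a (λb i)) → (∀ i → point d i X.≈ᴹ point a (λd i)) →
    (∀ ω → weigh b (λ i → ω (λb i)) ≈ weigh d (λ i → ω (λd i))) → eval b X.≈ᴹ eval d → b ≋ d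
  overPoints {a} λb λd xb xd ws ev = byIndex toℕ Fin.toℕ-injective (point a) λb λd xb xd (λ w → ws (λ i → χ (w i))) ev

  fold : ∀ a → Fin (size a) ⊎ Fin (size a) → Fin (size a)
  fold a = [ (λ i → i) , (λ i → i) ]′

  fold-point : ∀ a i → [ point a , point a ]′ i X.≈ᴹ point a (fold a i)
  fold-point a (inj₁ _) = X.≈ᴹ-refl
  fold-point a (inj₂ _) = X.≈ᴹ-refl

  weigh-fold : ∀ s t a (ω : Fin (size a) → Carrier) →
    weigh (scale s a ⊞ scale t a) (λ k → ω (fold a (splitAt (size a) k))) ≈ (s + t) * weigh a ω
  weigh-fold s t a ω = trans (weigh-⊞ (scale s a) (scale t a) (λ i → ω (fold a i)))
    (trans (+-cong (weigh-scale s a ω) (weigh-scale t a ω)) (sym (distribʳ _ s t)))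

  scale-+ : ∀ a s t → scale (s + t) a ≋ scale s a ⊞ scale t a
  scale-+ a s t = overPoints {a} {scale (s + t) a} {scale s a ⊞ scale t a} (λ i → i) (λ k → fold a (splitAt (size a) k))
    (λ _ → X.≈ᴹ-refl) (λ k → fold-point a (splitAt (size a) k))
    (λ ω → trans (weigh-scale (s + t) a ω) (sym (weigh-fold s t a ω)))
    (X.≈ᴹ-trans (eval-scale (s + t) a) (X.≈ᴹ-trans (X.*ₗ-distribʳ _ s t)
      (X.≈ᴹ-sym (X.≈ᴹ-trans (eval-⊞ (scale s a) (scale t a)) (X.+ᴹ-cong (eval-scale s a) (eval-scale t a))))))

  scale-0 : ∀ a → scale 0# a ≋ 𝟘
  scale-0 a = overPoints {a} {scale 0# a} {𝟘} (λ i → i) (λ ()) (λ _ → X.≈ᴹ-refl) (λ ())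
    (λ ω → trans (weigh-scale 0# a ω) (zeroˡ _)) (X.≈ᴹ-trans (eval-scale 0# a) (X.*ₗ-zeroˡ _))

  scale-1 : ∀ a → scale 1# a ≋ a
  scale-1 a = overPoints {a} (λ i → i) (λ i → i) (λ _ → X.≈ᴹ-refl) (λ _ → X.≈ᴹ-refl)
    (λ ω → UF.sum-cong {size a} λ i → *-congˡ (*-identityˡ _)) (X.≈ᴹ-trans (eval-scale 1# a) (X.*ₗ-identityˡ _))

  ⊞-identityˡ : ∀ a → 𝟘 ⊞ a ≋ a
  ⊞-identityˡ a = overPoints {a} (λ i → i) (λ i → i) (λ _ → X.≈ᴹ-refl) (λ _ → X.≈ᴹ-refl) (λ ω → refl) X.≈ᴹ-refl

  neg : FormalSum → FormalSum
  neg = scale (- 1#)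

  neg-inverseˡ : ∀ a → neg a ⊞ a ≋ 𝟘
  neg-inverseˡ a = ≋-trans (⊞-cong {neg a} {neg a} {a} {scale 1# a} ≋-refl (≋-sym (scale-1 a)))
    (≋-trans (≋-sym (scale-+ a (- 1#) 1#)) (≋-trans (scale-cong {a = a} {a} (-‿inverseˡ 1#) ≋-refl) (scale-0 a)))

  scale-⊞ : ∀ s a b → scale s (a ⊞ b) ≋ scale s a ⊞ scale s b
  scale-⊞ s a b = samePoints {scale s (a ⊞ b)} _ λ k → distr (splitAt (size a) k)
    where
    distr : ∀ i → s * [ coef a , coef b ]′ i ≈ [ coef (scale s a) , coef (scale s b) ]′ i
    distr (inj₁ _) = refl
    distr (inj₂ _) = refl

  scale-assoc : ∀ s t a → scale (s * t) a ≋ scale s (scale t a)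
  scale-assoc s t a = samePoints {scale (s * t) a} _ λ i → *-assoc s t _

  ⊞-isAbelianGroup : IsAbelianGroup _≋_ _⊞_ 𝟘 neg
  ⊞-isAbelianGroup = record
    { isGroup = record
      { isMonoid = record
        { isSemigroup = record
          { isMagma = record
            { isEquivalence = record { refl = ≋-refl ; sym = ≋-sym ; trans = ≋-trans }
            ; ∙-cong = ⊞-cong }
          ; assoc = ⊞-assoc }
        ; identity = ⊞-identityˡ , (λ a → ≋-trans (⊞-comm a 𝟘) (⊞-identityˡ a)) }
      ; inverse = neg-inverseˡ , (λ a → ≋-trans (⊞-comm a (neg a)) (neg-inverseˡ a))
      ; ⁻¹-cong = scale-cong refl }
    ; comm = ⊞-comm }

  freeModule : Module S c ℓ
  freeModule = mkModule FormalSum _≋_ _⊞_ 𝟘 neg scale ⊞-isAbelianGroup scale-cong scale-⊞ scale-+ scale-assoc scale-1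

  eval-lin : IsLinear freeModule X eval
  eval-lin = record { cong = evals ; +-hom = eval-⊞ ; *-hom = eval-scale }

  single : X.Carrierᴹ → FormalSum
  single x = formal 1 (λ _ → 1#) (λ _ → x)

  eval-single : ∀ x → eval (single x) X.≈ᴹ x
  eval-single x = X.≈ᴹ-trans (X.+ᴹ-identityʳ _) (X.*ₗ-identityˡ x)

  total : ∀ {m} → (Fin m → FormalSum) → FormalSum
  total {zero} b = 𝟘
  total {suc m} b = b fzero ⊞ total (λ k → b (fsuc k))

  sumM≡total : ∀ {m} (b : Fin m → FormalSum) → sumM freeModule b ≡ total b
  sumM≡total {zero} b = ≡.refl
  sumM≡total {suc m} b = ≡.cong (b fzero ⊞_) (sumM≡total (λ k → b (fsuc k)))

  total-cong : ∀ {m} {a b : Fin m → FormalSum} → (∀ k → a k ≋ b k) → total a ≋ total b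
  total-cong {zero} q = ≋-refl
  total-cong {suc m} q = ⊞-cong (q fzero) (total-cong (λ k → q (fsuc k)))

-- Equality in X is not assumed decidable, but equality of labels is; this decision drives the
-- induction in `reflects`.
collision? : ∀ {n} (κ : Fin n → ℕ) → (∃ λ i → ∃ λ j → i ≢ j × κ i ≡ κ j) ⊎ (∀ i j → κ i ≡ κ j → i ≡ j)
collision? κ with Fin.any? (λ i → Fin.any? (λ j → distinct i j))
  where
  open import Relation.Nullary.Decidable using (_×-dec_)
  distinct : ∀ i j → Dec (i ≢ j × κ i ≡ κ j)
  distinct i j = ¬? (i Fin.≟ j) ×-dec (κ i ℕ.≟ κ j)
... | yes (i , j , i≢j , q) = inj₁ (i , j , i≢j , q)
... | no ¬c = inj₂ λ i j q → injective i j q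
  where
  injective : ∀ i j → κ i ≡ κ j → i ≡ j
  injective i j q with i Fin.≟ j
  ... | yes r = r
  ... | no i≢j = ⊥-elim (¬c (i , j , i≢j , q))

module ProjectiveRetract {c ℓ} {S : CommutativeRing c ℓ} {X : Module S c ℓ} (projective : Projective X)
    {K : Pred (CommutativeRing.Carrier S) (c ⊔ ℓ)} (K-ideal : IsIdeal S K)
    (K⊆jacobson : ∀ {a} → K a → Jacobson S a)
    {n : ℕ} (f : Fin n → Module.Carrierᴹ X) (g : Fin n → Module.Carrierᴹ X → CommutativeRing.Carrier S)
    (g-lin : ∀ k → IsLinear X (unit S) (g k))
    (u≡1 : ∀ x → Combo X K (ModuleFacts._-ᴹ_ X x (ModuleFacts.lc X (λ k → g k x) f))) where
  open CommutativeRing S hiding (zero)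
  open Module X
  open ModuleFacts X
  open FreeModule X
  private
    U = unit S
    M = freeModule
    module UF = ModuleFacts U

  u v : Carrierᴹ → Carrierᴹ
  u x = lc (λ k → g k x) f
  v x = x -ᴹ u x

  u-lin : IsLinear X X u
  u-lin = record
    { cong = λ q → lc-congˡ f λ k → IsSemilinear.cong (g-lin k) q
    ; +-hom = λ x y → ≈ᴹ-trans (lc-congˡ f λ k → IsSemilinear.+-hom (g-lin k) x y) (lc-+ (λ k → g k x) (λ k → g k y) f)
    ; *-hom = λ s x → ≈ᴹ-trans (lc-congˡ f λ k → IsSemilinear.*-hom (g-lin k) s x) (lc-* s (λ k → g k x) f) }

  v-lin : IsLinear X X v
  v-lin = sub-semilinear (id-linear X) u-lin

  abstract
    -- Projectivity makes X a direct summand of the free module on its own elements, where the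
    -- coefficients of two expressions can be compared.
    section : ∃ λ (s : Carrierᴹ → FormalSum) → IsLinear X M s × (∀ x → eval (s x) ≈ᴹ x)
    section = projective M X eval eval-lin (λ y → single y , eval-single y) (λ x → x) (id-linear X)

  s : Carrierᴹ → FormalSum
  s = proj₁ section

  s-lin : IsLinear X M s
  s-lin = proj₁ (proj₂ section)

  eval-s : ∀ x → eval (s x) ≈ᴹ x
  eval-s = proj₂ (proj₂ section)

  s-lc : ∀ {m} (a : Fin m → Carrier) (y : Fin m → Carrierᴹ) → s (lc a y) ≋ total (λ k → scale (a k) (s (y k)))
  s-lc a y = ≡.subst (s (lc a y) ≋_) (sumM≡total (λ k → scale (a k) (s (y k)))) (SemilinearFacts.map-lin s-lin a y)

  module _ {I : Pred Carrier (c ⊔ ℓ)} (I-ideal : IsIdeal S I) where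
    private module I = IsIdeal I-ideal

    coefIn : FormalSum → Set (c ⊔ ℓ)
    coefIn a = ∀ i → I (coef a i)

    coefIn-weigh : ∀ a ω → coefIn a → I (weigh a ω)
    coefIn-weigh a ω h = UF.sum∈ (ideal-submodule I-ideal) λ i → I.*∈ (ω i) (h i)

    coefIn-⊞ : ∀ a b → coefIn a → coefIn b → ∀ i → I ([ coef a , coef b ]′ i)
    coefIn-⊞ a b h h' (inj₁ i) = h i
    coefIn-⊞ a b h h' (inj₂ j) = h' j

    coefIn-total : ∀ {m} (b : Fin m → FormalSum) → (∀ k → coefIn (b k)) → coefIn (total b)
    coefIn-total {suc m} b h k = coefIn-⊞ (b fzero) (total (λ k → b (fsuc k))) (h fzero) (coefIn-total (λ k → b (fsuc k)) (λ k → h (fsuc k)))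
      (splitAt (size (b fzero)) k)

    combo-section : ∀ {x} → Combo X I x → ∃ λ b → s x ≋ b × coefIn b
    combo-section {x} (m , a , y , h , q) = total (λ k → scale (a k) (s (y k))) ,
      ≋-trans (IsSemilinear.cong s-lin q) (s-lc a y) , coefIn-total (λ k → scale (a k) (s (y k))) (λ k i → ideal-*ʳ I-ideal _ (h k))

  module _ {m} (t : Fin (suc m) → Carrier) (x : Fin (suc m) → Carrierᴹ) {i j : Fin (suc m)} (j≢i : j ≢ i) (xj≈xi : x j ≈ᴹ x i) where
    private
      i' : Fin m
      i' = punchOut j≢i
      punch : Fin m → Fin (suc m)
      punch = punchIn j
      punch-i' : punch i' ≡ i
      punch-i' = Fin.punchIn-punchOut j≢i

    -- Term `j` is absorbed into term `i`, which has the same point; `i'` is the position of `i`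
    -- once `j` has been removed.
    contract : FormalSum
    contract = formal m (λ k → t (punch k) + kron S i' k * t j) (λ k → x (punch k))

    private
      ρ : Fin (suc m) → Fin (suc m)
      ρ k with k Fin.≟ j
      ... | yes _ = i
      ... | no _ = k

      ρ-j : ρ j ≡ i
      ρ-j with j Fin.≟ j
      ... | yes _ = ≡.refl
      ... | no j≢j = ⊥-elim (j≢j ≡.refl)

      ρ-punch : ∀ k → ρ (punch k) ≡ punch k
      ρ-punch k with punch k Fin.≟ j
      ... | yes q = ⊥-elim (Fin.punchInᵢ≢i j k q)
      ... | no _ = ≡.refl

      x-ρ : ∀ k → x k ≈ᴹ x (ρ k)
      x-ρ k with k Fin.≟ j
      ... | yes ≡.refl = xj≈xi
      ... | no _ = ≈ᴹ-refl

      module _ (N : Module S c ℓ) (y : Fin (suc m) → Module.Carrierᴹ N) (yj≈yi : Module._≈ᴹ_ N (y j) (y i)) where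
        private
          module N = Module N
          module NF = ModuleFacts N

        contract-lc : NF.lc t y N.≈ᴹ NF.lc (coef contract) (λ k → y (punch k))
        contract-lc = begin
          NF.lc t y
            ≈⟨ NF.sum-punchIn (λ k → t k N.*ₗ y k) j ⟩
          t j N.*ₗ y j N.+ᴹ NF.lc (λ k → t (punch k)) (λ k → y (punch k))
            ≈⟨ N.+ᴹ-comm _ _ ⟩
          NF.lc (λ k → t (punch k)) (λ k → y (punch k)) N.+ᴹ t j N.*ₗ y j
            ≈⟨ N.+ᴹ-congˡ (N.*ₗ-congˡ (N.≈ᴹ-trans yj≈yi (N.≈ᴹ-reflexive (≡.cong y (≡.sym punch-i'))))) ⟩
          NF.lc (λ k → t (punch k)) (λ k → y (punch k)) N.+ᴹ t j N.*ₗ y (punch i')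
            ≈⟨ N.+ᴹ-congˡ (N.*ₗ-congˡ (N.≈ᴹ-sym (NF.lc-kron i' (λ k → y (punch k))))) ⟩
          NF.lc (λ k → t (punch k)) (λ k → y (punch k)) N.+ᴹ t j N.*ₗ NF.lc (kron S i') (λ k → y (punch k))
            ≈⟨ N.+ᴹ-congˡ (N.≈ᴹ-sym (NF.lc-* (t j) (kron S i') (λ k → y (punch k)))) ⟩
          NF.lc (λ k → t (punch k)) (λ k → y (punch k)) N.+ᴹ NF.lc (λ k → t j * kron S i' k) (λ k → y (punch k))
            ≈⟨ N.≈ᴹ-sym (NF.lc-+ (λ k → t (punch k)) (λ k → t j * kron S i' k) (λ k → y (punch k))) ⟩
          NF.lc (λ k → t (punch k) + t j * kron S i' k) (λ k → y (punch k))
            ≈⟨ NF.lc-congˡ (λ k → y (punch k)) (λ k → +-congˡ (*-comm _ _)) ⟩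
          NF.lc (coef contract) (λ k → y (punch k)) ∎
          where open SetoidReasoning N.≈ᴹ-setoid

    contract-≋ : formal (suc m) t x ≋ contract
    contract-≋ = byIndex toℕ Fin.toℕ-injective x ρ punch x-ρ (λ _ → ≈ᴹ-refl)
      (λ w → trans (UF.sum-cong {suc m} λ k → *-comm (χ (w (ρ k))) (t k))
        (trans (contract-lc U (λ k → χ (w (ρ k))) (reflexive (≡.cong (λ l → χ (w l)) (≡.trans ρ-j (≡.sym ρ-i)))))
          (UF.sum-cong {m} λ k → trans (*-comm (coef contract k) (χ (w (ρ (punch k))))) (*-congʳ (reflexive (≡.cong (λ l → χ (w l)) (ρ-punch k)))))))
      (contract-lc X x xj≈xi)
      where
      ρ-i : ρ i ≡ i
      ρ-i with i Fin.≟ j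
      ... | yes _ = ≡.refl
      ... | no _ = ≡.refl

  kron-diag : ∀ {m} (i : Fin m) → kron S i i ≡ 1#
  kron-diag fzero = ≡.refl
  kron-diag (fsuc i) = kron-diag i

  kron-off : ∀ {m} (i k : Fin m) → i ≢ k → kron S i k ≡ 0#
  kron-off fzero fzero i≢k = ⊥-elim (i≢k ≡.refl)
  kron-off fzero (fsuc k) _ = ≡.refl
  kron-off (fsuc i) fzero _ = ≡.refl
  kron-off (fsuc i) (fsuc k) i≢k = kron-off i k λ e → i≢k (≡.cong fsuc e)

  weigh-⊞-↑ : ∀ a b (w : Fin (size (a ⊞ b)) → Carrier) →
    weigh (a ⊞ b) w ≈ weigh a (λ i → w (i Fin.↑ˡ size b)) + weigh b (λ j → w (size a Fin.↑ʳ j))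
  weigh-⊞-↑ a b w = trans (UF.sum-cong {size (a ⊞ b)} λ k → *-congʳ (reflexive (≡.cong w (≡.sym (Fin.join-splitAt (size a) (size b) k)))))
    (weigh-⊞ a b (λ i → w (Fin.join (size a) (size b) i)))

  module _ {J : Pred Carrier (c ⊔ ℓ)} (J-ideal : IsIdeal S J) where
    private
      JX = combo-submodule X J-ideal
      module JX = IsSubmodule JX

    weigh-total : ∀ {m} (t : Fin m → Carrier) (b : Fin m → FormalSum) → (∀ k → coefIn K-ideal (b k)) →
      (w : Fin (size (total (λ k → scale (t k) (b k)))) → Carrier) →
      ∃ λ (B : Fin m → Carrier) → (∀ k → K (B k)) × weigh (total (λ k → scale (t k) (b k))) w ≈ UF.lc B t
    weigh-total {zero} t b h w = (λ ()) , (λ ()) , refl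
    weigh-total {suc m} t b h w with weigh-total (λ k → t (fsuc k)) (λ k → b (fsuc k)) (λ k → h (fsuc k)) (λ k → w (size (b fzero) Fin.↑ʳ k))
    ... | B , hB , q = (λ { fzero → weigh (b fzero) w₀ ; (fsuc k) → B k }) ,
        (λ { fzero → coefIn-weigh K-ideal (b fzero) w₀ (h fzero) ; (fsuc k) → hB k }) ,
        trans (weigh-⊞-↑ (scale (t fzero) (b fzero)) (total (λ k → scale (t (fsuc k)) (b (fsuc k)))) w)
          (+-cong (trans (weigh-scale (t fzero) (b fzero) w₀) (*-comm _ _)) q)
      where
      w₀ : Fin (size (b fzero)) → Carrier
      w₀ i = w (i Fin.↑ˡ size (total (λ k → scale (t (fsuc k)) (b (fsuc k)))))

    -- Comparing the weights at the label of each term gives t_i = r_i + Σ B_ik t_k with r_i in `J`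
    -- and B_ik in `K`, hence in the radical. Nakayama's lemma for the submodule `J` of S then puts
    -- every t_i in `J`.
    independent : ∀ m (t : Fin m → Carrier) (x : Fin m → Carrierᴹ) (H : FormalSum) (b : Fin m → FormalSum) →
      coefIn J-ideal H → (∀ k → coefIn K-ideal (b k)) → (q : formal m t x ≋ H ⊞ total (λ i → scale (t i) (b i))) →
      (∀ i j → label q (inj₁ i) ≡ label q (inj₁ j) → i ≡ j) → ∀ i → J (t i)
    independent m t x H b H∈J b∈K q injective = nakayama U (ideal-submodule J-ideal) t (λ i → proj₁ (parts i)) (λ i → weigh H (λ k → weight i (k Fin.↑ˡ _)))
        (λ i j → K⊆jacobson (proj₁ (proj₂ (parts i)) j)) (λ i → coefIn-weigh J-ideal H _ H∈J) system
      where
      R : FormalSum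
      R = total (λ i → scale (t i) (b i))

      -- The set consisting of the label of term `i`; by injectivity its weights on the left form a
      -- row of the identity matrix.
      only : Fin m → ℕ → Bool
      only i k = does (k ℕ.≟ label q (inj₁ i))

      only-kron : ∀ i k → χ (only i (label q (inj₁ k))) ≈ kron S i k
      only-kron i k with i Fin.≟ k
      ... | yes ≡.refl = trans (reflexive (≡.cong χ (dec-true (label q (inj₁ i) ℕ.≟ label q (inj₁ i)) ≡.refl))) (sym (reflexive (kron-diag i)))
      ... | no i≢k = trans (reflexive (≡.cong χ (dec-false (label q (inj₁ k) ℕ.≟ label q (inj₁ i)) (λ e → i≢k (≡.sym (injective k i e)))))) (sym (reflexive (kron-off i k i≢k)))

      weight : ∀ i → Fin (size (H ⊞ R)) → Carrier
      weight i k = χ (only i (label q (inj₂ k)))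

      parts : ∀ i → ∃ λ (B : Fin m → Carrier) → (∀ k → K (B k)) × weigh R (λ k → weight i (size H Fin.↑ʳ k)) ≈ UF.lc B t
      parts i = weigh-total t b b∈K (λ k → weight i (size H Fin.↑ʳ k))

      system : ∀ i → t i ≈ weigh H (λ k → weight i (k Fin.↑ˡ size R)) + UF.lc (proj₁ (parts i)) t
      system i = trans (sym (trans (UF.sum-cong {m} λ k → *-congʳ (only-kron i k)) (UF.lc-kron i t))) (trans (weights q (only i))
        (trans (weigh-⊞-↑ H R (weight i)) (+-congˡ (proj₂ (proj₂ (parts i))))))

    -- The section is applied to x = u x + v x, with `v` expanded term by term. In the application
    -- `H` has coefficients in `J` because u x is in J X, and the `b i` have coefficients in `K`
    -- because `v` maps into K X.
    expansion : ∀ {m} (t : Fin m → Carrier) (x : Fin m → Carrierᴹ) (H : FormalSum) (b : Fin m → FormalSum) →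
      s (lc t x) ≋ formal m t x → s (u (lc t x)) ≋ H → (∀ i → s (v (x i)) ≋ b i) →
      formal m t x ≋ H ⊞ total (λ i → scale (t i) (b i))
    expansion t x H b sx sH sb = ≋-trans (≋-sym sx) (≋-trans
      (IsSemilinear.cong s-lin (≈ᴹ-sym (≈ᴹ-trans (+ᴹ-congˡ (≈ᴹ-sym (SemilinearFacts.map-lin v-lin t x))) (add-sub (lc t x) (u (lc t x))))))
      (≋-trans (IsSemilinear.+-hom s-lin (u (lc t x)) (lc t (λ i → v (x i)))) (⊞-cong sH
        (≋-trans (s-lc t (λ i → v (x i))) (total-cong (λ i → scale-cong refl (sb i)))))))

    -- Induction on the number of terms. Two terms with one label share a point and are contracted,
    -- which shortens the sum; with distinct labels, `independent` puts the coefficients in `J`.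
    reflects : ∀ m (t : Fin m → Carrier) (x : Fin m → Carrierᴹ) → s (lc t x) ≋ formal m t x →
      Combo X J (u (lc t x)) → Combo X J (lc t x)
    decide : ∀ m (t : Fin m → Carrier) (x : Fin m → Carrierᴹ) → s (lc t x) ≋ formal m t x →
      Combo X J (u (lc t x)) → (H : FormalSum) (b : Fin m → FormalSum) → coefIn J-ideal H → (∀ k → coefIn K-ideal (b k)) →
      (q : formal m t x ≋ H ⊞ total (λ i → scale (t i) (b i))) →
      (∃ λ i → ∃ λ j → i ≢ j × label q (inj₁ i) ≡ label q (inj₁ j)) ⊎
        (∀ i j → label q (inj₁ i) ≡ label q (inj₁ j) → i ≡ j) → Combo X J (lc t x)
    reflects m t x sx ux∈JX = decide m t x sx ux∈JX H b H∈J b∈K q (collision? (λ i → label q (inj₁ i)))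
      where
      H = proj₁ (combo-section J-ideal ux∈JX)
      H∈J = proj₂ (proj₂ (combo-section J-ideal ux∈JX))
      b = λ i → proj₁ (combo-section K-ideal (u≡1 (x i)))
      b∈K = λ i → proj₂ (proj₂ (combo-section K-ideal (u≡1 (x i))))
      q = expansion t x H b sx (proj₁ (proj₂ (combo-section J-ideal ux∈JX))) (λ i → proj₁ (proj₂ (combo-section K-ideal (u≡1 (x i)))))
    decide m t x sx ux∈JX H b H∈J b∈K q (inj₂ injective) = m , t , x , independent m t x H b H∈J b∈K q injective , ≈ᴹ-refl
    decide (suc m) t x sx ux∈JX H b H∈J b∈K q (inj₁ (i , j , i≢j , e)) = JX.resp (≈ᴹ-sym (evals r))
      (reflects m (coef d) (point d) (≋-trans (≋-trans (IsSemilinear.cong s-lin (≈ᴹ-sym (evals r))) sx) r)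
        (JX.resp (IsSemilinear.cong u-lin (evals r)) ux∈JX))
      where
      xj≈xi : x j ≈ᴹ x i
      xj≈xi = ≈ᴹ-sym (valid q (inj₁ i) (inj₁ j) e)
      d : FormalSum
      d = contract t x (λ e → i≢j (≡.sym e)) xj≈xi
      r : formal (suc m) t x ≋ d
      r = contract-≋ t x (λ e → i≢j (≡.sym e)) xj≈xi

    -- The terms of `s x` provide the presentation from which the induction starts. Arbitrary `J`
    -- matters: it is taken to be the conductor below for surjectivity of `u`, and zero for
    -- injectivity.
    combo-reflects : ∀ x → Combo X J (u x) → Combo X J x
    combo-reflects x h = JX.resp (eval-s x) (reflects (size a) (coef a) (point a)
        (≋-trans (IsSemilinear.cong s-lin (eval-s x)) (samePoints {a} (coef a) (λ _ → refl)))
        (JX.resp (IsSemilinear.cong u-lin (≈ᴹ-sym (eval-s x))) h))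
      where
      a : FormalSum
      a = s x

  private
    module u = IsSemilinear u-lin

    -- The conductor of X into the image of `u`. Since J X lies in that image, surjectivity reduces
    -- to X = J X.
    J : Pred Carrier (c ⊔ ℓ)
    J a = ∀ x → ∃ λ y → a *ₗ x ≈ᴹ u y

    J-ideal : IsIdeal S J
    J-ideal = record
      { resp = λ q h x → proj₁ (h x) , ≈ᴹ-trans (*ₗ-congʳ (sym q)) (proj₂ (h x))
      ; 0∈ = λ x → 0ᴹ , ≈ᴹ-trans (*ₗ-zeroˡ x) (≈ᴹ-sym (SemilinearFacts.map-0 u-lin))
      ; +∈ = λ h h' x → proj₁ (h x) +ᴹ proj₁ (h' x) ,
          ≈ᴹ-trans (*ₗ-distribʳ x _ _) (≈ᴹ-trans (+ᴹ-cong (proj₂ (h x)) (proj₂ (h' x))) (≈ᴹ-sym (u.+-hom _ _)))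
      ; *∈ = λ r h x → r *ₗ proj₁ (h x) , ≈ᴹ-trans (*ₗ-assoc r _ x) (≈ᴹ-trans (*ₗ-congˡ (proj₂ (h x))) (≈ᴹ-sym (u.*-hom r _))) }

    JX⊆im : ∀ {x} → Combo X J x → ∃ λ y → x ≈ᴹ u y
    JX⊆im (m , a , y , h , q) = sumM X (λ k → proj₁ (h k (y k))) ,
      ≈ᴹ-trans q (≈ᴹ-trans (sum-cong {m} λ k → proj₂ (h k (y k))) (≈ᴹ-sym (SemilinearFacts.map-sum u-lin (λ k → proj₁ (h k (y k))))))

    open OperatorPolynomials X u-lin

    -- Modulo J X the coefficients of a monic annihilator vanish one after the other.
    climb : ∀ d {E} → Poly 1# d E → (∀ x → Combo X J (E x)) → ∀ x → Combo X J x
    climb zero (Level.lift e) h x = IsSubmodule.resp (combo-submodule X J-ideal) (≈ᴹ-trans (e x) (*ₗ-identityˡ x)) (h x)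
    climb (suc d) {E} (r , E' , hE' , e) h = climb d hE' λ x → combo-reflects J-ideal (E' x)
        (IsSubmodule.resp JX (≈ᴹ-trans (move-sub (≈ᴹ-trans (e x) (+ᴹ-comm _ _))) ≈ᴹ-refl) (sub∈ JX (h x) (combo-intro X x r∈J)))
      where
      JX = combo-submodule X J-ideal
      -- `E x` lies in J X, hence in the image of `u`, and so does `u (E' x)`; their difference is r
      -- x. Once r is in `J`, also `u (E' x)` lies in J X, and `combo-reflects` cancels the `u`.
      r∈J : J r
      r∈J x = proj₁ (JX⊆im (h x)) -ᴹ E' x , ≈ᴹ-trans (≈ᴹ-sym (move-sub (e x)))
        (≈ᴹ-trans (-ᴹ-cong₂ (proj₂ (JX⊆im (h x))) ≈ᴹ-refl) (≈ᴹ-sym (SemilinearFacts.map-sub u-lin _ _)))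

    annihilator : ∃ λ D → ∃ λ G → Poly 1# D G × (∀ i → G (f i) ≈ᴹ 0ᴹ)
    annihilator = monic-annihilator (λ i k → g k (f i)) f (λ i → ≈ᴹ-refl)

    -- `G` kills the `f k` and commutes with `u`, so u (G x) = G (u x) = 0. Reflection then gives G
    -- x in J X, the starting point of `climb`.
    u-surjective : ∀ x → ∃ λ y → x ≈ᴹ u y
    u-surjective x with annihilator
    ... | D , G , hG , Gf = JX⊆im (climb D hG (λ x → combo-reflects J-ideal (G x) (IsSubmodule.resp (combo-submodule X J-ideal)
          (≈ᴹ-sym (uG≈0 x)) (IsSubmodule.0∈ (combo-submodule X J-ideal)))) x)
      where
      G-lin = Poly-lin D hG
      uG≈0 : ∀ x → u (G x) ≈ᴹ 0ᴹ
      uG≈0 x = ≈ᴹ-trans (≈ᴹ-sym (Poly-u D hG x)) (≈ᴹ-trans (SemilinearFacts.map-lin G-lin (λ k → g k x) f)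
        (sum-0 {n} λ k → ≈ᴹ-trans (*ₗ-congˡ (Gf k)) (*ₗ-zeroʳ _)))

    combo-zero : ∀ {x} → Combo X (λ a → Level.Lift c (a ≈ 0#)) x → x ≈ᴹ 0ᴹ
    combo-zero (m , a , y , h , r) = ≈ᴹ-trans r (sum-0 {m} λ k → ≈ᴹ-trans (*ₗ-congʳ (Level.lower (h k))) (*ₗ-zeroˡ _))

    u-injective : ∀ {x} → u x ≈ᴹ 0ᴹ → x ≈ᴹ 0ᴹ
    u-injective {x} q = combo-zero (combo-reflects (zero-ideal S) x
      (IsSubmodule.resp (combo-submodule X (zero-ideal S)) (≈ᴹ-sym q) (IsSubmodule.0∈ (combo-submodule X (zero-ideal S)))))

  fgProjective : FGProjective X
  fgProjective = record
    { n = n ; e = h ; ι = λ x k → g k x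
    ; ι-cong = λ q k → IsSemilinear.cong (g-lin k) q
    ; ι-+ = λ x y k → IsSemilinear.+-hom (g-lin k) x y
    ; ι-* = λ r x k → IsSemilinear.*-hom (g-lin k) r x
    ; retract = λ x → ≈ᴹ-sym (sub≈0⇒≈ (u-injective (≈ᴹ-trans (SemilinearFacts.map-sub u-lin x _) (≈⇒sub≈0 (≈ᴹ-sym
        (≈ᴹ-trans (SemilinearFacts.map-lin u-lin (λ k → g k x) h) (lc-congʳ (λ k → g k x) (λ k → ≈ᴹ-sym (proj₂ (u-surjective (f k)))))))))))
    }
    where
    -- Preimages of the `f k` under `u`: with them Σ g_k(x) h_k and x have the same image under `u`,
    -- which is injective.
    h : Fin n → Carrierᴹ
    h k = proj₁ (u-surjective (f k))

-- Lifting windows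

module _ {c ℓ} {S S' : CommutativeRing c ℓ} {α : CommutativeRing.Carrier S → CommutativeRing.Carrier S'} (α-hom : IsRingHom S S' α) where
  private
    module S' = CommutativeRing S'
    module α = IsRingHom α-hom

  -- S' with scalars restricted to S. The map α becomes an S-linear surjection onto it, along which
  -- projectivity lifts the coordinate functionals of P'.
  restrictUnit : Module S c ℓ
  restrictUnit = mkModule S'.Carrier S'._≈_ S'._+_ S'.0# S'.-_ (λ s x → α s S'.* x) S'.+-isAbelianGroup
    (λ p q → S'.*-cong (α.cong p) q) (λ s → S'.distribˡ (α s)) (λ x s t → S'.trans (S'.*-congʳ (α.+-hom s t)) (S'.distribʳ x _ _))
    (λ s t x → S'.trans (S'.*-congʳ (α.*-hom s t)) (S'.*-assoc _ _ x)) (λ x → S'.trans (S'.*-congʳ α.1-hom) (S'.*-identityˡ x))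

module _ {c ℓ} {S : CommutativeRing c ℓ} {M : Module S c ℓ} {q : Module.Carrierᴹ M → Module.Carrierᴹ M} (q-lin : IsLinear M M q) where
  private
    module M = Module M
    module q = IsSemilinear q-lin

  -- The image of q, presented as a quotient of M because a subset of M would leave the universe of carriers.
  coimage : Module S c ℓ
  coimage = mkModule M.Carrierᴹ (λ x y → q x M.≈ᴹ q y) M._+ᴹ_ M.0ᴹ M.-ᴹ_ M._*ₗ_
    (record
      { isGroup = record
        { isMonoid = record
          { isSemigroup = record
            { isMagma = record
              { isEquivalence = record { refl = M.≈ᴹ-refl ; sym = M.≈ᴹ-sym ; trans = M.≈ᴹ-trans }
              ; ∙-cong = λ p r → M.≈ᴹ-trans (q.+-hom _ _) (M.≈ᴹ-trans (M.+ᴹ-cong p r) (M.≈ᴹ-sym (q.+-hom _ _))) }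
            ; assoc = λ x y z → q.cong (M.+ᴹ-assoc x y z) }
          ; identity = (λ x → q.cong (M.+ᴹ-identityˡ x)) , (λ x → q.cong (M.+ᴹ-identityʳ x)) }
        ; inverse = (λ x → q.cong (M.-ᴹ‿inverseˡ x)) , (λ x → q.cong (M.-ᴹ‿inverseʳ x))
        ; ⁻¹-cong = λ p → M.≈ᴹ-trans (SemilinearFacts.map-neg q-lin _) (M.≈ᴹ-trans (M.-ᴹ‿cong p) (M.≈ᴹ-sym (SemilinearFacts.map-neg q-lin _))) }
      ; comm = λ x y → q.cong (M.+ᴹ-comm x y) })
    (λ p r → M.≈ᴹ-trans (q.*-hom _ _) (M.≈ᴹ-trans (M.*ₗ-cong p r) (M.≈ᴹ-sym (q.*-hom _ _))))
    (λ s x y → q.cong (M.*ₗ-distribˡ s x y)) (λ x s t → q.cong (M.*ₗ-distribʳ x s t))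
    (λ s t x → q.cong (M.*ₗ-assoc s t x)) (λ x → q.cong (M.*ₗ-identityˡ x))

  coimage-proj : IsLinear M coimage (λ x → x)
  coimage-proj = record { cong = q.cong ; +-hom = λ _ _ → M.≈ᴹ-refl ; *-hom = λ _ _ → M.≈ᴹ-refl }

  coimage-incl : IsLinear coimage M q
  coimage-incl = record { cong = λ p → p ; +-hom = q.+-hom ; *-hom = q.*-hom }

  coimage-fgp : (∀ x → q (q x) M.≈ᴹ q x) → FGProjective M → FGProjective coimage
  coimage-fgp qq fgp = record
    { n = P.n ; e = P.e ; ι = λ x → P.ι (q x)
    ; ι-cong = P.ι-cong
    ; ι-+ = λ x y k → S.trans (P.ι-cong (q.+-hom x y) k) (P.ι-+ _ _ k)
    ; ι-* = λ s x k → S.trans (P.ι-cong (q.*-hom s x) k) (P.ι-* s _ k)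
    ; retract = λ x → M.≈ᴹ-trans (M.≈ᴹ-sym (SemilinearFacts.map-lin coimage-proj (P.ι (q x)) P.e))
        (M.≈ᴹ-trans (q.cong (P.retract (q x))) (qq x)) }
    where
    module P = FGProjective fgp
    module S = CommutativeRing S

module _ {c ℓ} {S : CommutativeRing c ℓ} {L T : Module S c ℓ} where
  private
    module L = Module L
    module T = Module T
    LT = DirectProduct.⟨module⟩ L T

  inl-lin : IsLinear L LT (λ l → l , T.0ᴹ)
  inl-lin = record { cong = λ q → q , T.≈ᴹ-refl ; +-hom = λ _ _ → L.≈ᴹ-refl , T.≈ᴹ-sym (T.+ᴹ-identityˡ _) ; *-hom = λ s _ → L.≈ᴹ-refl , T.≈ᴹ-sym (T.*ₗ-zeroʳ s) }

  inr-lin : IsLinear T LT (λ t → L.0ᴹ , t)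
  inr-lin = record { cong = λ q → L.≈ᴹ-refl , q ; +-hom = λ _ _ → L.≈ᴹ-sym (L.+ᴹ-identityˡ _) , T.≈ᴹ-refl ; *-hom = λ s _ → L.≈ᴹ-sym (L.*ₗ-zeroʳ s) , T.≈ᴹ-refl }

  inl+inr : ∀ l t → Module._≈ᴹ_ LT (l , t) (Module._+ᴹ_ LT (l , T.0ᴹ) (L.0ᴹ , t))
  inl+inr l t = L.≈ᴹ-sym (L.+ᴹ-identityʳ l) , T.≈ᴹ-sym (T.+ᴹ-identityˡ t)

  snd-lin : IsLinear LT T proj₂
  snd-lin = record { cong = proj₂ ; +-hom = λ _ _ → T.≈ᴹ-refl ; *-hom = λ _ _ → T.≈ᴹ-refl }

  module _ {S' : CommutativeRing c ℓ} {N : Module S' c ℓ} {τ : CommutativeRing.Carrier S → CommutativeRing.Carrier S'}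
           {a : L.Carrierᴹ → Module.Carrierᴹ N} {b : T.Carrierᴹ → Module.Carrierᴹ N}
           (a-lin : IsSemilinear L N τ a) (b-lin : IsSemilinear T N τ b) where
    private
      module N = Module N
      module a = IsSemilinear a-lin
      module b = IsSemilinear b-lin
      open ModuleFacts N using (+-interchange)

    copair-lin : IsSemilinear LT N τ (λ x → a (proj₁ x) N.+ᴹ b (proj₂ x))
    copair-lin = record
      { cong = λ q → N.+ᴹ-cong (a.cong (proj₁ q)) (b.cong (proj₂ q))
      ; +-hom = λ x y → N.≈ᴹ-trans (N.+ᴹ-cong (a.+-hom _ _) (b.+-hom _ _))
          (+-interchange _ _ _ _)
      ; *-hom = λ s x → N.≈ᴹ-trans (N.+ᴹ-cong (a.*-hom s _) (b.*-hom s _)) (N.≈ᴹ-sym (N.*ₗ-distribˡ _ _ _)) }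

  product-projective : Projective L → Projective T → Projective LT
  product-projective pL pT M N f f-lin f-surj g g-lin
    with pL M N f f-lin f-surj (λ l → g (l , T.0ᴹ)) (∘-semilinear (λ q → q) inl-lin g-lin)
       | pT M N f f-lin f-surj (λ t → g (L.0ᴹ , t)) (∘-semilinear (λ q → q) inr-lin g-lin)
  ... | a , a-lin , fa | b , b-lin , fb = (λ x → Module._+ᴹ_ M (a (proj₁ x)) (b (proj₂ x))) , copair-lin a-lin b-lin ,
    λ { (l , t) → N.≈ᴹ-trans (IsSemilinear.+-hom f-lin _ _) (N.≈ᴹ-trans (N.+ᴹ-cong (fa l) (fb t))
          (N.≈ᴹ-trans (N.≈ᴹ-sym (IsSemilinear.+-hom g-lin _ _)) (IsSemilinear.cong g-lin (Module.≈ᴹ-sym LT (inl+inr l t))))) }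
    where module N = Module N

combo-map : ∀ {c ℓ} {S : CommutativeRing c ℓ} {M N : Module S c ℓ} {I f} → IsLinear M N f → ∀ {x} → Combo M I x → Combo N I (f x)
combo-map {N = N} {f = f} f-lin (m , a , y , h , q) = m , a , (λ k → f (y k)) , h ,
  Module.≈ᴹ-trans N (IsSemilinear.cong f-lin q) (SemilinearFacts.map-lin f-lin a y)

-- Finitely generated lifts adapted to a decomposition

module ProjectiveLifts {c ℓ} {p : ℕ} {S S' : CommutativeRing c ℓ} {Fr : Frame p S} {Fr' : Frame p S'} (φ : StrictHom Fr Fr')
    (I-refl : ∀ s → Frame.I Fr' (StrictHom.α φ s) → Frame.I Fr s)
    (surj : ∀ s' → ∃ λ s → CommutativeRing._≈_ S' (StrictHom.α φ s) s')
    (K : Pred (CommutativeRing.Carrier S) (c ⊔ ℓ)) (K-ideal : IsIdeal S K)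
    (K⇔ker : ∀ x → K x ⇔ₚ CommutativeRing._≈_ S' (StrictHom.α φ x) (CommutativeRing.0# S')) where
  open Reduction φ I-refl surj K K-ideal K⇔ker
  private
    module S = CommutativeRing S
    module S' = CommutativeRing S'
    module αH = IsRingHom α-hom

  K⊆jacobson : ∀ {a} → K a → Jacobson S a
  K⊆jacobson h = FrameFacts.I⊆jacobson Fr (K⊆I h)

  record Lift (P' : Module S' c ℓ) : Set (Level.suc (c ⊔ ℓ)) where
    field
      P          : Module S c ℓ
      projective : Projective P
      π          : Module.Carrierᴹ P → Module.Carrierᴹ P'
      π-lin      : IsSemilinear P P' α π
      surjective : ∀ y → ∃ λ x → Module._≈ᴹ_ P' (π x) y
      kernel     : ∀ x → Module._≈ᴹ_ P' (π x) (Module.0ᴹ P') → Combo P K x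

  lifts : LiftsProjectives φ → ∀ P' → FGProjective P' → Lift P'
  lifts lp P' fgp' with lp P' fgp'
  ... | P , proj , π , π-lin , onto , ker = record
    { P = P ; projective = proj ; π = π ; π-lin = π-lin ; surjective = onto
    ; kernel = λ x q → proj₁ (ker x q) , proj₁ (proj₂ (ker x q)) , proj₁ (proj₂ (proj₂ (ker x q))) ,
        (λ k → 0⇒K (proj₁ (proj₂ (proj₂ (proj₂ (ker x q)))) k)) , proj₂ (proj₂ (proj₂ (proj₂ (ker x q)))) }

  module _ {P' : Module S' c ℓ} (fgp' : FGProjective P') (lift : Lift P') where
    open Lift lift
    private
      module P = Module P
      module P' = Module P'
      module P'F = ModuleFacts P'
      module Q = FGP fgp'
      N = restrictUnit α-hom

      coordinate : ∀ k → ∃ λ (g : P.Carrierᴹ → S.Carrier) → IsLinear P (unit S) g × (∀ x → α (g x) S'.≈ Q.ι (π x) k)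
      coordinate k = projective (unit S) N α
        (record { cong = αH.cong ; +-hom = αH.+-hom ; *-hom = αH.*-hom }) surj
        (λ x → Q.ι (π x) k)
        (record { cong = λ q → Q.ι-cong (IsSemilinear.cong π-lin q) k
                ; +-hom = λ x y → S'.trans (Q.ι-cong (IsSemilinear.+-hom π-lin x y) k) (Q.ι-+ _ _ k)
                ; *-hom = λ s x → S'.trans (Q.ι-cong (IsSemilinear.*-hom π-lin s x) k) (Q.ι-* _ _ k) })

      f : Fin Q.n → P.Carrierᴹ
      f k = proj₁ (surjective (Q.e k))

    -- Lifted coordinates and lifted generators of P' form an endomorphism of P that factors through
    -- a finite free module and induces the identity on P'; the kernel condition makes it congruent
    -- to the identity modulo K P.
    lift-fgp : FGProjective P
    lift-fgp = ProjectiveRetract.fgProjective projective K-ideal K⊆jacobson f (λ k → proj₁ (coordinate k)) (λ k → proj₁ (proj₂ (coordinate k)))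
      λ x → kernel _ (P'.≈ᴹ-trans (SemilinearFacts.map-sub π-lin x _) (P'F.≈⇒sub≈0 (P'.≈ᴹ-sym
        (P'.≈ᴹ-trans (SemilinearFacts.map-lin π-lin (λ k → proj₁ (coordinate k) x) f)
          (P'.≈ᴹ-trans (P'F.sum-cong {Q.n} λ k → P'.*ₗ-cong (proj₂ (proj₂ (coordinate k)) x) (proj₂ (surjective (Q.e k)))) (Q.retract (π x)))))))

  -- The two summands are lifted separately and the lifts added, since a lift of P' as a whole comes
  -- with no projection above `pT`.
  module AdaptedLift {P' : Module S' c ℓ} (fgp' : FGProjective P') (lp : LiftsProjectives φ)
           {pL pT : Module.Carrierᴹ P' → Module.Carrierᴹ P'} (pL-lin : IsLinear P' P' pL) (pT-lin : IsLinear P' P' pT)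
           (pLpL : ∀ x → Module._≈ᴹ_ P' (pL (pL x)) (pL x)) (pTpT : ∀ x → Module._≈ᴹ_ P' (pT (pT x)) (pT x))
           (pTpL : ∀ x → Module._≈ᴹ_ P' (pT (pL x)) (Module.0ᴹ P')) (pLpT : ∀ x → Module._≈ᴹ_ P' (pL (pT x)) (Module.0ᴹ P'))
           (split : ∀ x → Module._≈ᴹ_ P' x (Module._+ᴹ_ P' (pL x) (pT x))) where
    private
      module P' = Module P'
      module L = Lift (lifts lp (coimage pL-lin) (coimage-fgp pL-lin pLpL fgp'))
      module T = Lift (lifts lp (coimage pT-lin) (coimage-fgp pT-lin pTpT fgp'))
      module Lm = Module L.P

      πL-lin : IsSemilinear L.P P' α (λ l → pL (L.π l))
      πL-lin = ∘-semilinear (λ q → q) L.π-lin (coimage-incl pL-lin)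

      πT-lin : IsSemilinear T.P P' α (λ t → pT (T.π t))
      πT-lin = ∘-semilinear (λ q → q) T.π-lin (coimage-incl pT-lin)

    LT : Module S c ℓ
    LT = DirectProduct.⟨module⟩ L.P T.P

    private
      π : Module.Carrierᴹ LT → P'.Carrierᴹ
      π x = pL (L.π (proj₁ x)) P'.+ᴹ pT (T.π (proj₂ x))

      πx-L : ∀ x → pL (π x) P'.≈ᴹ pL (L.π (proj₁ x))
      πx-L x = P'.≈ᴹ-trans (IsSemilinear.+-hom pL-lin _ _) (P'.≈ᴹ-trans (P'.+ᴹ-cong (pLpL _) (pLpT _)) (P'.+ᴹ-identityʳ _))

      πx-T : ∀ x → pT (π x) P'.≈ᴹ pT (T.π (proj₂ x))
      πx-T x = P'.≈ᴹ-trans (IsSemilinear.+-hom pT-lin _ _) (P'.≈ᴹ-trans (P'.+ᴹ-cong (pTpL _) (pTpT _)) (P'.+ᴹ-identityˡ _))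

    adaptedLift : Lift P'
    adaptedLift = record
      { P = LT
      ; projective = product-projective L.projective T.projective
      ; π = π
      ; π-lin = copair-lin πL-lin πT-lin
      ; surjective = λ y → (proj₁ (L.surjective y) , proj₁ (T.surjective y)) ,
          P'.≈ᴹ-trans (P'.+ᴹ-cong (proj₂ (L.surjective y)) (proj₂ (T.surjective y))) (P'.≈ᴹ-sym (split y))
      ; kernel = λ { (l , t) q → IsSubmodule.resp (combo-submodule LT K-ideal) (Module.≈ᴹ-sym LT {l , t} (inl+inr {L = L.P} {T = T.P} l t))
          (IsSubmodule.+∈ (combo-submodule LT K-ideal)
            (combo-map {I = K} (inl-lin {L = L.P} {T = T.P}) (L.kernel l (P'.≈ᴹ-trans (P'.≈ᴹ-sym (πx-L (l , t))) (IsSemilinear.cong pL-lin q))))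
            (combo-map {I = K} (inr-lin {L = L.P} {T = T.P}) (T.kernel t (P'.≈ᴹ-trans (P'.≈ᴹ-sym (πx-T (l , t))) (IsSemilinear.cong pT-lin q))))) } }

    projT : Module.Carrierᴹ LT → Module.Carrierᴹ LT
    projT (l , t) = Lm.0ᴹ , t

    projT-lin : IsLinear LT LT projT
    projT-lin = ∘-semilinear {L = LT} {M = T.P} {N = LT} (λ q → q) snd-lin inr-lin

    projT-idem : ∀ x → Module._≈ᴹ_ LT (projT (projT x)) (projT x)
    projT-idem x = Module.≈ᴹ-refl LT

    projT-π : ∀ x → Lift.π adaptedLift (projT x) P'.≈ᴹ pT (Lift.π adaptedLift x)
    projT-π x = P'.≈ᴹ-trans (P'.+ᴹ-congʳ (SemilinearFacts.map-0 πL-lin)) (P'.≈ᴹ-trans (P'.+ᴹ-identityˡ _) (P'.≈ᴹ-sym (πx-T x)))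

-- Windows from normal representations

module _ {c ℓ} {p : ℕ} {S : CommutativeRing c ℓ} (Fr : Frame p S) where
  open CommutativeRing S
  open Frame Fr

  -- Computing σ₁(a b) in two ways gives σ(a) σ₁(b) = σ(b) σ₁(a) for a, b in I. Summed against an
  -- expression 1 = Σ s_k σ₁(b_k), this yields θ = Σ s_k σ(b_k).
  σ-θσ₁ : ∃ λ θ → ∀ {a} (h : I a) → σ a ≈ θ * σ₁ a h
  σ-θσ₁ with σ₁-gen
  ... | n , s , b , hb , gen = sumM U (λ k → s k * σ (b k)) , λ {a} h → begin
    σ a                                             ≈⟨ sym (*-identityˡ _) ⟩
    1# * σ a                                        ≈⟨ *-congʳ (sym (trans (reflexive (≡.sym (sumR≡sumM S (λ k → s k * σ₁ (b k) (hb k))))) gen)) ⟩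
    sumM U (λ k → s k * σ₁ (b k) (hb k)) * σ a      ≈⟨ sum-*ʳ {M = U} (λ k → s k * σ₁ (b k) (hb k)) (σ a) ⟩
    sumM U (λ k → s k * σ₁ (b k) (hb k) * σ a)      ≈⟨ ModuleFacts.sum-cong U {n} (λ k → term (s k) (hb k) h) ⟩
    sumM U (λ k → s k * σ (b k) * σ₁ a h)           ≈⟨ sym (sum-*ʳ {M = U} (λ k → s k * σ (b k)) (σ₁ a h)) ⟩
    sumM U (λ k → s k * σ (b k)) * σ₁ a h           ∎
    where
    open SetoidReasoning setoid
    U = unit S
    term : ∀ s {a b} (hb : I b) (h : I a) → s * σ₁ b hb * σ a ≈ s * σ b * σ₁ a h
    term s {a} {b} hb h = begin
      s * σ₁ b hb * σ a     ≈⟨ *-assoc s _ _ ⟩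
      s * (σ₁ b hb * σ a)   ≈⟨ *-congˡ (trans (*-comm _ _) (sym (σ₁-* a hb (IsIdeal.*∈ I-ideal a hb)))) ⟩
      s * σ₁ (a * b) _      ≈⟨ *-congˡ (trans (σ₁-cong _ (IsIdeal.*∈ I-ideal b h) (*-comm a b)) (σ₁-* b h _)) ⟩
      s * (σ b * σ₁ a h)    ≈⟨ sym (*-assoc s _ _) ⟩
      s * σ b * σ₁ a h      ∎

-- The window with normal representation Ψ for the decomposition P = ker pT ⊕ im pT.
module FromRepresentation {c ℓ} {p : ℕ} {S : CommutativeRing c ℓ} (Fr : Frame p S) (P : Module S c ℓ) (fgp : FGProjective P)
    {pT : Module.Carrierᴹ P → Module.Carrierᴹ P} (pT-lin : IsLinear P P pT) (pTpT : ∀ x → Module._≈ᴹ_ P (pT (pT x)) (pT x))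
    {Ψ : Module.Carrierᴹ P → Module.Carrierᴹ P} (Ψ-lin : IsSemilinear P P (Frame.σ Fr) Ψ) (Ψ-generates : Generates P Ψ) where
  open CommutativeRing S using (Carrier; 0#; 1#; _+_; _*_; _≈_; -_)
  private module S = CommutativeRing S
  open Frame Fr
  open Module P
  open ModuleFacts P
  open FGP fgp
  private
    module pT = IsSemilinear pT-lin
    module Ψ = IsSemilinear Ψ-lin
    module I = IsIdeal I-ideal
    IP = ·M-submodule I-ideal
    module IP = IsSubmodule IP
    θ : Carrier
    θ = proj₁ (σ-θσ₁ Fr)

  pL : Carrierᴹ → Carrierᴹ
  pL x = x -ᴹ pT x

  pL-lin : IsLinear P P pL
  pL-lin = sub-semilinear (id-linear P) pT-lin

  pTpL : ∀ x → pT (pL x) ≈ᴹ 0ᴹ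
  pTpL x = ≈ᴹ-trans (SemilinearFacts.map-sub pT-lin x (pT x)) (≈⇒sub≈0 (≈ᴹ-sym (pTpT x)))

  pL-ker : ∀ {x} → pT x ≈ᴹ 0ᴹ → pL x ≈ᴹ x
  pL-ker q = ≈ᴹ-trans (-ᴹ-cong₂ ≈ᴹ-refl q) (sub-0 _)

  pL-im : ∀ {x} → pT x ≈ᴹ x → pL x ≈ᴹ 0ᴹ
  pL-im q = ≈⇒sub≈0 (≈ᴹ-sym q)

  split : ∀ x → x ≈ᴹ pL x +ᴹ pT x
  split x = ≈ᴹ-sym (≈ᴹ-trans (+ᴹ-comm _ _) (add-sub x (pT x)))

  Q L T : Pred Carrierᴹ (c ⊔ ℓ)
  Q x = (I ·M) (pT x)
  L x = Level.Lift c (pT x ≈ᴹ 0ᴹ)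
  T x = Level.Lift c (pT x ≈ᴹ x)

  Q-sub : IsSubmodule P Q
  Q-sub = preimage-submodule pT-lin IP

  zero-lin : IsLinear P P (λ _ → 0ᴹ)
  zero-lin = record { cong = λ _ → ≈ᴹ-refl ; +-hom = λ _ _ → ≈ᴹ-sym (+ᴹ-identityˡ _) ; *-hom = λ s _ → ≈ᴹ-sym (*ₗ-zeroʳ s) }

  decomp : NormalDecomp Fr P Q
  decomp = record
    { L = L ; T = T
    ; L-sub = equalizer-submodule pT-lin zero-lin
    ; T-sub = equalizer-submodule pT-lin (id-linear P)
    ; span = λ x → pL x , pT x , Level.lift (pTpL x) , Level.lift (pTpT x) , split x
    ; indep = λ { {l} {t} (Level.lift hl) (Level.lift ht) q → ≈ᴹ-trans (≈ᴹ-sym (+ᴹ-identityʳ l)) (≈ᴹ-trans (+ᴹ-congˡ (≈ᴹ-sym (t≈0 hl ht q))) q) }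
    ; Q-eq = λ x → (λ h → pL x , pT x , Level.lift (pTpL x) , split x , n , ι (pT x) , (λ j → pT (e j)) , h , (λ j → Level.lift (pTpT (e j))) ,
          ≈ᴹ-trans (≈ᴹ-sym (pTpT x)) (expand pT-lin (pT x)))
        , λ { (l , v , Level.lift hl , x≈ , m , a , t , ha , _ , v≈) → IP.resp (≈ᴹ-sym (≈ᴹ-trans (pT.cong (≈ᴹ-trans x≈ (+ᴹ-congˡ v≈)))
              (≈ᴹ-trans (pT.+-hom l _) (≈ᴹ-trans (+ᴹ-congʳ hl) (≈ᴹ-trans (+ᴹ-identityˡ _) (SemilinearFacts.map-lin pT-lin a t))))))
              (·M-lc I-ideal (λ k → pT (t k)) ha) } }
    where
    t≈0 : ∀ {l t} → pT l ≈ᴹ 0ᴹ → pT t ≈ᴹ t → l +ᴹ t ≈ᴹ 0ᴹ → t ≈ᴹ 0ᴹ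
    t≈0 hl ht q = ≈ᴹ-trans (≈ᴹ-sym (≈ᴹ-trans (pT.+-hom _ _) (≈ᴹ-trans (+ᴹ-cong hl ht) (+ᴹ-identityˡ _)))) (≈ᴹ-trans (pT.cong q) (SemilinearFacts.map-0 pT-lin))

  -- The factor `θ` on the `L`-part is forced: writing 1 = Σ s_k σ₁(b_k) shows F = θ F₁ on `Q` in
  -- every window.
  F : Carrierᴹ → Carrierᴹ
  F x = θ *ₗ Ψ (pL x) +ᴹ Ψ (pT x)

  private
    ΨL-lin : IsSemilinear P P σ (λ x → Ψ (pL x))
    ΨL-lin = ∘-semilinear (IsRingHom.cong σ-hom) pL-lin Ψ-lin
    ΨT-lin : IsSemilinear P P σ (λ x → Ψ (pT x))
    ΨT-lin = ∘-semilinear (IsRingHom.cong σ-hom) pT-lin Ψ-lin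
    module ΨL = IsSemilinear ΨL-lin
    module ΨT = IsSemilinear ΨT-lin

  F-lin : IsSemilinear P P σ F
  F-lin = record
    { cong = λ q → +ᴹ-cong (*ₗ-congˡ (ΨL.cong q)) (ΨT.cong q)
    ; +-hom = λ x y → ≈ᴹ-trans (+ᴹ-cong (≈ᴹ-trans (*ₗ-congˡ (ΨL.+-hom x y)) (*ₗ-distribˡ θ _ _)) (ΨT.+-hom x y))
        (+-interchange _ _ _ _)
    ; *-hom = λ s x → ≈ᴹ-trans (+ᴹ-cong (≈ᴹ-trans (*ₗ-congˡ (ΨL.*-hom s x)) (*ₗ-swap θ _ _)) (ΨT.*-hom s x)) (≈ᴹ-sym (*ₗ-distribˡ _ _ _)) }

  -- On IT the rule F₁(a t) = σ₁(a) Ψ(t) is imposed through the coordinates of `pT x`, so the value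
  -- does not depend on a chosen expression as a sum of products a t.
  F₁ : (x : Carrierᴹ) → Q x → Carrierᴹ
  F₁ x h = Ψ (pL x) +ᴹ lc (λ j → σ₁ (ι (pT x) j) (h j)) (λ j → Ψ (pT (e j)))

  F₁-cong : ∀ {x y} (hx : Q x) (hy : Q y) → x ≈ᴹ y → F₁ x hx ≈ᴹ F₁ y hy
  F₁-cong hx hy q = +ᴹ-cong (ΨL.cong q) (lc-congˡ _ λ j → σ₁-cong (hx j) (hy j) (ι-cong (pT.cong q) j))

  F₁-+ : ∀ {x y} (hx : Q x) (hy : Q y) (hxy : Q (x +ᴹ y)) → F₁ (x +ᴹ y) hxy ≈ᴹ F₁ x hx +ᴹ F₁ y hy
  F₁-+ {x} {y} hx hy hxy = ≈ᴹ-trans (+ᴹ-cong (ΨL.+-hom x y)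
      (≈ᴹ-trans (lc-congˡ _ λ j → S.trans (σ₁-cong (hxy j) (I.+∈ (hx j) (hy j)) (S.trans (ι-cong (pT.+-hom x y) j) (ι-+ _ _ j))) (σ₁-+ (hx j) (hy j) _))
        (lc-+ (λ j → σ₁ (ι (pT x) j) (hx j)) (λ j → σ₁ (ι (pT y) j) (hy j)) _)))
    (+-interchange _ _ _ _)

  F₁-* : ∀ s {x} (hx : Q x) (hsx : Q (s *ₗ x)) → F₁ (s *ₗ x) hsx ≈ᴹ σ s *ₗ F₁ x hx
  F₁-* s {x} hx hsx = ≈ᴹ-trans (+ᴹ-cong (ΨL.*-hom s x)
      (≈ᴹ-trans (lc-congˡ _ λ j → S.trans (σ₁-cong (hsx j) (I.*∈ s (hx j)) (S.trans (ι-cong (pT.*-hom s x) j) (ι-* s _ j))) (σ₁-* s (hx j) _))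
        (lc-* (σ s) (λ j → σ₁ (ι (pT x) j) (hx j)) _)))
    (≈ᴹ-sym (*ₗ-distribˡ _ _ _))

  F₁-σ₁ : ∀ {a} (ha : I a) x (hax : Q (a *ₗ x)) → F₁ (a *ₗ x) hax ≈ᴹ σ₁ a ha *ₗ F x
  F₁-σ₁ {a} ha x hax = ≈ᴹ-trans (+ᴹ-cong
      (≈ᴹ-trans (ΨL.*-hom a x) (≈ᴹ-trans (*ₗ-congʳ (S.trans (proj₂ (σ-θσ₁ Fr) ha) (S.*-comm _ _))) (*ₗ-assoc _ _ _)))
      (≈ᴹ-trans (lc-congˡ (λ j → Ψ (pT (e j))) λ j → S.trans (σ₁-cong (hax j) (I.*∈ (ι (pT x) j) ha)
            (S.trans (ι-cong (pT.*-hom a x) j) (S.trans (ι-* a _ j) (S.*-comm _ _)))) (S.trans (σ₁-* (ι (pT x) j) ha _) (S.*-comm _ _)))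
        (≈ᴹ-trans (lc-* (σ₁ a ha) (λ j → σ (ι (pT x) j)) (λ j → Ψ (pT (e j))))
          (*ₗ-congˡ (≈ᴹ-trans (≈ᴹ-sym (expand ΨT-lin (pT x))) (Ψ.cong (pTpT x)))))))
    (≈ᴹ-sym (*ₗ-distribˡ _ _ _))

  F₁-L : ∀ {x} (h : Q x) → pT x ≈ᴹ 0ᴹ → F₁ x h ≈ᴹ Ψ x
  F₁-L {x} h q = ≈ᴹ-trans (+ᴹ-cong (Ψ.cong (pL-ker q)) (sum-0 {n} λ j → ≈ᴹ-trans (*ₗ-congʳ (FrameFacts.σ₁-0 Fr (h j) (S.trans (ι-cong q j) (ι-0 j)))) (*ₗ-zeroˡ _))) (+ᴹ-identityʳ _)

  F-T : ∀ {x} → pT x ≈ᴹ x → F x ≈ᴹ Ψ x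
  F-T q = ≈ᴹ-trans (+ᴹ-cong (≈ᴹ-trans (*ₗ-congˡ (≈ᴹ-trans (Ψ.cong (pL-im q)) (SemilinearFacts.map-0 Ψ-lin))) (*ₗ-zeroʳ θ)) (Ψ.cong q)) (+ᴹ-identityˡ _)

  InF₁Span : Pred Carrierᴹ (c ⊔ ℓ)
  InF₁Span x = ∃ λ n → Σ (Fin n → Carrier) λ s → Σ (Fin n → Carrierᴹ) λ y → Σ (∀ k → Q (y k)) λ hy → x ≈ᴹ sumM P (λ k → s k *ₗ F₁ (y k) (hy k))

  F₁-span-submodule : IsSubmodule P InF₁Span
  F₁-span-submodule = record
    { resp = λ q (m , s , y , hy , r) → m , s , y , hy , ≈ᴹ-trans (≈ᴹ-sym q) r
    ; 0∈ = 0 , (λ ()) , (λ ()) , (λ ()) , ≈ᴹ-refl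
    ; +∈ = λ (m , s , y , hy , q) (m' , s' , y' , hy' , q') → m ℕ.+ m' ,
        (λ k → [ s , s' ]′ (splitAt m k)) , (λ k → [ y , y' ]′ (splitAt m k)) , (λ k → both hy hy' (splitAt m k)) ,
        ≈ᴹ-trans (+ᴹ-cong q q') (≈ᴹ-sym (sum-splitAt P m (λ i → [ s , s' ]′ i *ₗ F₁ ([ y , y' ]′ i) (both hy hy' i))))
    ; *∈ = λ r (m , s , y , hy , q) → m , (λ k → r * s k) , y , hy , ≈ᴹ-trans (*ₗ-congˡ q) (≈ᴹ-sym (lc-* r s (λ k → F₁ (y k) (hy k)))) }
    where
    both : ∀ {m n} {y : Fin m → Carrierᴹ} {y' : Fin n → Carrierᴹ} → (∀ k → Q (y k)) → (∀ k → Q (y' k)) → ∀ i → Q ([ y , y' ]′ i)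
    both h h' (inj₁ i) = h i
    both h h' (inj₂ j) = h' j

  F₁-gen : ∀ x → InF₁Span x
  F₁-gen = Ψ-generates F₁-span-submodule λ y → IsSubmodule.resp F₁-span-submodule
      (≈ᴹ-trans (≈ᴹ-sym (Ψ.+-hom _ _)) (Ψ.cong (≈ᴹ-sym (split y)))) (IsSubmodule.+∈ F₁-span-submodule (onL (pTpL y)) (onT (pTpT y)))
    where
    onL : ∀ {x} → pT x ≈ᴹ 0ᴹ → InF₁Span (Ψ x)
    onL {x} q = 1 , (λ _ → 1#) , (λ _ → x) , (λ _ → h) , ≈ᴹ-sym (≈ᴹ-trans (+ᴹ-identityʳ _) (≈ᴹ-trans (*ₗ-identityˡ _) (F₁-L h q)))
      where
      h : Q x
      h = IP.resp (≈ᴹ-sym q) IP.0∈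
    -- An element of `T` need not lie in `Q`, so its multiples by the a_k of `σ₁-gen` are used: Ψ x
    -- = Σ s_k σ₁(a_k) Ψ x = Σ s_k F₁(a_k x).
    onT : ∀ {x} → pT x ≈ᴹ x → InF₁Span (Ψ x)
    onT {x} q = m , s , (λ k → a k *ₗ x) , Q-ax , ≈ᴹ-trans (≈ᴹ-trans (≈ᴹ-sym (*ₗ-identityˡ _))
        (*ₗ-congʳ (S.sym (S.trans (S.reflexive (≡.sym (sumR≡sumM S (λ k → s k * σ₁ (a k) (ha k))))) gen))))
        (≈ᴹ-trans (sum-*ʳ {M = P} (λ k → s k * σ₁ (a k) (ha k)) (Ψ x)) (sum-cong {m} λ k → ≈ᴹ-trans (*ₗ-assoc _ _ _)
          (*ₗ-congˡ (≈ᴹ-sym (≈ᴹ-trans (F₁-σ₁ (ha k) x (Q-ax k)) (*ₗ-congˡ (F-T q)))))))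
      where
      m = proj₁ σ₁-gen
      s = proj₁ (proj₂ σ₁-gen)
      a = proj₁ (proj₂ (proj₂ σ₁-gen))
      ha = proj₁ (proj₂ (proj₂ (proj₂ σ₁-gen)))
      gen = proj₂ (proj₂ (proj₂ (proj₂ σ₁-gen)))
      Q-ax : ∀ k → Q (a k *ₗ x)
      Q-ax k = IP.resp (≈ᴹ-sym (pT.*-hom (a k) x)) (·M-intro I-ideal (pT x) (ha k))

  window : Window Fr
  window = record { P = P ; str = record
    { fgp = fgp ; Q = Q ; Q-sub = Q-sub ; decomp = decomp ; F = F ; F-lin = F-lin ; F₁ = F₁ ; F₁-cong = F₁-cong
    ; F₁-+ = F₁-+ ; F₁-* = F₁-* ; F₁-σ₁ = F₁-σ₁ ; F₁-gen = F₁-gen } }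

  window-Ψ : ∀ x → WindowFacts.Ψ window x ≈ᴹ Ψ x
  window-Ψ x = ≈ᴹ-trans (+ᴹ-cong (F₁-L _ (pTpL x)) (F-T (pTpT x))) (≈ᴹ-trans (≈ᴹ-sym (Ψ.+-hom _ _)) (Ψ.cong (≈ᴹ-sym (split x))))

module WindowLifts {c ℓ} {p : ℕ} {S S' : CommutativeRing c ℓ} {Fr : Frame p S} {Fr' : Frame p S'} (φ : StrictHom Fr Fr')
    (I-refl : ∀ s → Frame.I Fr' (StrictHom.α φ s) → Frame.I Fr s)
    (surj : ∀ s' → ∃ λ s → CommutativeRing._≈_ S' (StrictHom.α φ s) s')
    (K : Pred (CommutativeRing.Carrier S) (c ⊔ ℓ)) (K-ideal : IsIdeal S K)
    (K⇔ker : ∀ x → K x ⇔ₚ CommutativeRing._≈_ S' (StrictHom.α φ x) (CommutativeRing.0# S'))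
    (lp : LiftsProjectives φ) (W' : Window Fr') where
  open Reduction φ I-refl surj K K-ideal K⇔ker
  open ProjectiveLifts φ I-refl surj K K-ideal K⇔ker
  private
    module Fr = Frame Fr
    module Fr' = Frame Fr'
    module W' = Window W'
    module F' = WindowFacts W'

    open AdaptedLift W'.fgp lp F'.pL-lin F'.pT-lin (λ x → F'.pL-L (F'.pL∈L x)) (λ x → F'.pT-T (F'.pT∈T x))
      (λ x → F'.pT-L (F'.pL∈L x)) (λ x → F'.pL-T (F'.pT∈T x)) F'.split

    lifted : Lift W'.P
    lifted = adaptedLift

    pT : Module.Carrierᴹ (Lift.P lifted) → Module.Carrierᴹ (Lift.P lifted)
    pT = projT

    pT-lin : IsLinear (Lift.P lifted) (Lift.P lifted) pT
    pT-lin = projT-lin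

    pT-π : ∀ x → Lift.π lifted (pT x) W'.≈ᴹ F'.pT (Lift.π lifted x)
    pT-π = projT-π

    pTpT : ∀ x → Module._≈ᴹ_ (Lift.P lifted) (pT (pT x)) (pT x)
    pTpT = projT-idem

    module FromLift (P : Module S c ℓ) (fgp : FGProjective P) (π : Module.Carrierᴹ P → W'.Carrierᴹ) (π-lin : IsSemilinear P W'.P α π)
        (onto : ∀ y → ∃ λ x → π x W'.≈ᴹ y) (kernel : ∀ x → π x W'.≈ᴹ W'.0ᴹ → Combo P K x)
        (pT : Module.Carrierᴹ P → Module.Carrierᴹ P) (pT-lin : IsLinear P P pT) (pTpT : ∀ x → Module._≈ᴹ_ P (pT (pT x)) (pT x))
        (pT-π : ∀ x → π (pT x) W'.≈ᴹ F'.pT (π x)) where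
      module P = Module P
      module PF = ModuleFacts P
      module P'F = ModuleFacts W'.P
      module π = IsSemilinear π-lin
      open FGP fgp

      kernelK : ∀ {x} → π x W'.≈ᴹ W'.0ᴹ → (K ·M) x
      kernelK {x} q with kernel x q
      ... | m , a , y , h , r = IsSubmodule.resp (·M-submodule K-ideal) (P.≈ᴹ-sym r) (·M-lc K-ideal y h)

      differenceK : ∀ {x y} → π x W'.≈ᴹ π y → (K ·M) (x PF.-ᴹ y)
      differenceK {x} {y} q = kernelK (W'.≈ᴹ-trans (SemilinearFacts.map-sub π-lin x y) (P'F.≈⇒sub≈0 q))

      z : Fin n → P.Carrierᴹ
      z j = proj₁ (onto (F'.Ψ (π (e j))))

      Ψ : P.Carrierᴹ → P.Carrierᴹ
      Ψ = fromImages {N = P} {τ = Fr.σ} z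

      Ψ-lin : IsSemilinear P P Fr.σ Ψ
      Ψ-lin = fromImages-lin Fr.σ-hom z

      Ψ'π-lin : IsSemilinear P W'.P (λ s → α (Fr.σ s)) (λ x → F'.Ψ (π x))
      Ψ'π-lin = record { cong = Ψ'π.cong ; +-hom = Ψ'π.+-hom ; *-hom = λ s x → W'.≈ᴹ-trans (Ψ'π.*-hom s x) (W'.*ₗ-congʳ (σ-comm s)) }
        where module Ψ'π = IsSemilinear (∘-semilinear (IsRingHom.cong Fr'.σ-hom) π-lin F'.Ψ-lin)

      -- The value of `Ψ` at `e j` need not be `z j`, but downstairs the discrepancy disappears:
      -- `F'.Ψ (π x)` expands through its values at the `e j`, and `π` sends `z j` to these.
      πΨ : ∀ x → π (Ψ x) W'.≈ᴹ F'.Ψ (π x)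
      πΨ x = W'.≈ᴹ-trans (SemilinearFacts.map-lin π-lin (λ j → Fr.σ (ι x j)) z)
        (W'.≈ᴹ-trans (P'F.lc-congʳ (λ j → α (Fr.σ (ι x j))) (λ j → proj₂ (onto (F'.Ψ (π (e j)))))) (W'.≈ᴹ-sym (expand Ψ'π-lin x)))

      -- Nakayama applies because π carries the values of Ψ to those of Ψ', which generate P'.
      Ψ-generates : Generates P Ψ
      Ψ-generates {N} N-sub hΨ x = N.resp (retract x) (PF.sum∈ N-sub λ j → N.*∈ (ι x j) (nakayama P N-sub e (λ i j → ι (e i PF.-ᴹ r i) j) r
          (λ i j → K⊆jacobson (differenceK (W'.≈ᴹ-sym (proj₂ (proj₂ (hit (e i))))) j)) (λ i → proj₁ (proj₂ (hit (e i))))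
          (λ i → P.≈ᴹ-sym (P.≈ᴹ-trans (P.+ᴹ-congˡ (retract (e i PF.-ᴹ r i))) (PF.add-sub (e i) (r i)))) j))
        where
        module N = IsSubmodule N-sub
        image-submodule : IsSubmodule W'.P (λ y → ∃ λ x → N x × π x W'.≈ᴹ y)
        image-submodule = record
          { resp = λ q (x , h , r) → x , h , W'.≈ᴹ-trans r q
          ; 0∈ = P.0ᴹ , N.0∈ , SemilinearFacts.map-0 π-lin
          ; +∈ = λ (x , h , r) (x' , h' , r') → x P.+ᴹ x' , N.+∈ h h' , W'.≈ᴹ-trans (π.+-hom x x') (W'.+ᴹ-cong r r')
          ; *∈ = λ s (x , h , r) → lift s P.*ₗ x , N.*∈ (lift s) h , W'.≈ᴹ-trans (π.*-hom (lift s) x) (W'.*ₗ-cong (α-lift s) r) }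
        hit : ∀ y → ∃ λ x → N x × π x W'.≈ᴹ π y
        hit y = F'.Ψ-generates image-submodule (λ y' → Ψ (proj₁ (onto y')) , hΨ _ ,
          W'.≈ᴹ-trans (πΨ _) (IsSemilinear.cong F'.Ψ-lin (proj₂ (onto y')))) (π y)
        -- Elements of `N` with the same images as the `e i`. The coordinates of `e i - r i` then
        -- lie in `K` and form the radical matrix of the system.
        r : Fin n → P.Carrierᴹ
        r i = proj₁ (hit (e i))

      open FromRepresentation Fr P fgp pT-lin pTpT Ψ-lin Ψ-generates using (window; window-Ψ)
      module W = WindowFacts window

      πQ : ∀ {x} → (Fr.I ·M) (pT x) → W'.Q (π x)
      πQ {x} h = F'.pT∈IP⇒Q (IsSubmodule.resp (F'.·M-submodule Fr'.I-ideal) (W'.≈ᴹ-trans (W'.≈ᴹ-sym (expand π-lin (pT x))) (pT-π x))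
        (F'.·M-lc Fr'.I-ideal (λ j → π (e j)) λ j → I-pres (h j)))

      -- The coordinates of the `T`-component of π x lie in I' and lift into I, giving `y` in IP
      -- with the same image as `pT x`; the two differ by an element of K P, which is contained in
      -- IP.
      Qπ : ∀ x → W'.Q (π x) → (Fr.I ·M) (pT x)
      Qπ x h = IsSubmodule.resp IP (P.≈ᴹ-trans (P.+ᴹ-comm _ _) (PF.add-sub (pT x) y))
          (IsSubmodule.+∈ IP (λ k → K⊆I (differenceK (W'.≈ᴹ-trans (pT-π x) (W'.≈ᴹ-sym πy)) k)) (·M-lc Fr.I-ideal _ λ k → lift-I (F'.Q⇒pT∈IP h k)))
        where
        IP = ·M-submodule Fr.I-ideal
        y : P.Carrierᴹ
        y = PF.lc (λ k → lift (F'.ι (F'.pT (π x)) k)) (λ k → proj₁ (onto (F'.e k)))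
        πy : π y W'.≈ᴹ F'.pT (π x)
        πy = W'.≈ᴹ-trans (SemilinearFacts.map-lin π-lin (λ k → lift (F'.ι (F'.pT (π x)) k)) (λ k → proj₁ (onto (F'.e k))))
          (W'.≈ᴹ-trans (P'F.sum-cong {F'.n} λ k → W'.*ₗ-cong (α-lift _) (proj₂ (onto (F'.e k)))) (F'.retract _))

      u : SemiHom α window W'
      u = semiHom-fromΨ φ {W = window} {W' = W'} π π-lin πQ
        (λ { {l} hl → W'.≈ᴹ-trans (W'.F₁-cong _ _ W'.≈ᴹ-refl) (W'.≈ᴹ-trans (W'.≈ᴹ-sym (F'.Ψ-L (π-L (Level.lower hl)))) (back l)) })
        (λ { {t} ht → W'.≈ᴹ-trans (W'.≈ᴹ-sym (F'.Ψ-T (π-T (Level.lower ht)))) (back t) })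
        where
        back : ∀ x → F'.Ψ (π x) W'.≈ᴹ π (W.Ψ x)
        back x = W'.≈ᴹ-sym (W'.≈ᴹ-trans (π.cong (window-Ψ x)) (πΨ x))
        π-L : ∀ {l} → pT l P.≈ᴹ P.0ᴹ → F'.L (π l)
        π-L {l} q = IsSubmodule.resp F'.L-sub (W'.≈ᴹ-sym (W'.≈ᴹ-trans (F'.split (π l)) (W'.≈ᴹ-trans (W'.+ᴹ-congˡ
          (W'.≈ᴹ-trans (W'.≈ᴹ-sym (pT-π l)) (W'.≈ᴹ-trans (π.cong q) (SemilinearFacts.map-0 π-lin)))) (W'.+ᴹ-identityʳ _)))) (F'.pL∈L (π l))
        π-T : ∀ {t} → pT t P.≈ᴹ t → F'.T (π t)
        π-T {t} q = IsSubmodule.resp F'.T-sub (W'.≈ᴹ-trans (W'.≈ᴹ-sym (pT-π t)) (π.cong q)) (F'.pT∈T (π t))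

      reduction : IsReduction u
      reduction = record { surjective = onto ; kernel = λ x → kernelK ; Q-reflect = Qπ }

  windowLift : ∃ λ (W : Window Fr) → ∃ λ (u : SemiHom α W W') → IsReduction u
  windowLift = window , u , reduction
    where
    open Lift lifted using () renaming (P to P̃; π to π̃; π-lin to π̃-lin; surjective to onto; kernel to ker)
    open FromLift P̃ (lift-fgp W'.fgp lifted) π̃ π̃-lin onto ker pT pT-lin pTpT pT-π
    open FromRepresentation Fr P̃ (lift-fgp W'.fgp lifted) pT-lin pTpT Ψ-lin Ψ-generates using (window)

-- Base change as an equivalence of categories

theorem3p2 : ∀ {c ℓ} {p : ℕ} → Prime p →
    {S S' : CommutativeRing c ℓ} (Fr : Frame p S) (Fr' : Frame p S')
    (φ : StrictHom Fr Fr') →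
    (∀ s' → ∃ λ s → Frame.I Fr' (CommutativeRing._-_ S' (StrictHom.α φ s) s')) →
    (∀ s → Frame.I Fr' (StrictHom.α φ s) → Frame.I Fr s) →
    (∀ s' → ∃ λ s → CommutativeRing._≈_ S' (StrictHom.α φ s) s') →
    (n : ℕ) (𝔞 : ℕ → Pred (CommutativeRing.Carrier S) (c ⊔ ℓ)) →
    (∀ i → IsIdeal S (𝔞 i)) →
    (∀ x → 𝔞 zero x ⇔ₚ CommutativeRing._≈_ S' (StrictHom.α φ x) (CommutativeRing.0# S')) →
    (∀ x → 𝔞 n x ⇔ₚ CommutativeRing._≈_ S x (CommutativeRing.0# S)) →
    (∀ i → i < n → ∀ x → 𝔞 (suc i) x → 𝔞 i x) →
    (∀ i → i < n → ∀ x → 𝔞 i x → 𝔞 (suc i) (Frame.σ Fr x)) →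
    (∀ i → i < n → ∀ x (h : Frame.I Fr x) → 𝔞 i x → 𝔞 i (Frame.σ₁ Fr x h)) →
    (∀ i → i < n → ∀ x → 𝔞 i x → ∃ λ m → ∃ λ y → Iter p S Fr m x y × 𝔞 (suc i) y) →
    LiftsProjectives φ →
    Crystalline φ
theorem3p2 {p = p} p-prime Fr Fr' φ _ I-refl surj n 𝔞 𝔞-ideal 𝔞₀ 𝔞n 𝔞-⊇ 𝔞-σ 𝔞-σ₁ 𝔞-nil lp =
    (λ W → let open Quotient W in W₀ , u₀ , reduction⇒baseChange u₀ u₀-reduction)
  -- Full faithfulness concerns an arbitrary base change `u`, whereas the descent needs its kernel
  -- and the reflection of `Q`; passing to a reduction supplies both.
  , (λ W₁ W₂ W₂' u bc → faithful W₁ W₂ u (baseChange⇒reduction u bc) , full W₁ W₂ u (baseChange⇒reduction u bc))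
  , (λ W' → let (W , u , red) = windowLift W' in W , u , reduction⇒baseChange u red)
  where
  instance
    p-nonZero : ℕ.NonZero p
    p-nonZero = prime⇒nonZero p-prime
  open Reduction φ I-refl surj (𝔞 zero) (𝔞-ideal zero) 𝔞₀
  open Filtered φ I-refl surj n 𝔞 𝔞-ideal 𝔞₀ 𝔞n 𝔞-⊇ 𝔞-σ 𝔞-σ₁ 𝔞-nil
  open WindowLifts φ I-refl surj (𝔞 zero) (𝔞-ideal zero) 𝔞₀ lp
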